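{- Let $k\ge 1$, and let $G=(V,E)$ be a finite simple graph with $|V|\ge k$. Then \[ \sum_{i=1}^k \lambda_i(L(G))\le |E|+k^2. \]
   Context: $L(G)\in\mathbb{R}^{|V|\times|V|}$ is the Laplacian matrix of $G$: $L(G)_{u,u}=\deg_G(u)$, $L(G)_{u,v}=-1$ if $\{u,v\}\in E$, and $0$ otherwise. For a symmetric real matrix $M$, $\lambda_i(M)$ is its $i$-th largest eigenvalue (with multiplicity). -}

module Defs where

open import Algebra.Bundles using (RawRing)
import Algebra.Definitions.RawSemiring as RawSemiringDefinitions
open import Data.Bool.Base using (if_then_else_)
open import Data.Fin.Base as Fin using (Fin; zero; suc; toℕ; inject≤)
import Data.Fin.Properties as Fin
open import Data.Integer.Base using (+_)
open import Data.List.Base using (List; length; filter; allFin; cartesianProduct)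
open import Data.Nat.Base as ℕ using (ℕ; zero; suc)
import Data.Nat.Properties as ℕ
open import Data.Product.Base using (_×_; _,_; ∃-syntax; proj₁; proj₂)
open import Data.Rational.Base as ℚ using (ℚ; 0ℚ; 1ℚ; ½)
import Data.Rational.Properties as ℚ
open import Data.Rational.Solver using (module +-*-Solver)
open import Data.Vec.Functional using (Vector; removeAt)
open import Level using (0ℓ)
open import Relation.Binary.Core using (Rel)
open import Relation.Binary.Definitions using (Decidable; Irreflexive; Symmetric)
open import Relation.Binary.PropositionalEquality
  using (_≡_; refl; sym; trans; cong; cong₂; subst)
open import Relation.Nullary.Decidable using (does; _×-dec_)

------------------------------------------------------------------------
-- Real numbers: Cauchy sequences of rationals, considered up to _≈_

Eventually : (ℕ → Set) → Set
Eventually P = ∃[ N ] (∀ n → N ℕ.≤ n → P n)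

IsCauchy : (ℕ → ℚ) → Set
IsCauchy x = ∀ ε → 0ℚ ℚ.< ε →
  ∃[ N ] (∀ m n → N ℕ.≤ m → N ℕ.≤ n → ℚ.∣ x m ℚ.- x n ∣ ℚ.< ε)

record ℝ : Set where
  constructor mkℝ
  field
    seq    : ℕ → ℚ
    cauchy : IsCauchy seq

open ℝ public

infix 4 _≈_ _≤_

_≈_ : Rel ℝ 0ℓ
x ≈ y = ∀ ε → 0ℚ ℚ.< ε → Eventually λ n → ℚ.∣ seq x n ℚ.- seq y n ∣ ℚ.< ε

_≤_ : Rel ℝ 0ℓ
x ≤ y = ∀ ε → 0ℚ ℚ.< ε → Eventually λ n → seq x n ℚ.≤ seq y n ℚ.+ ε

private
  abstract
    2*½ : ∀ ε → ½ ℚ.* ε ℚ.+ ½ ℚ.* ε ≡ ε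
    2*½ ε = trans (sym (ℚ.*-distribʳ-+ ε ½ ½)) (ℚ.*-identityˡ ε)

    ½-pos : ∀ {ε} → 0ℚ ℚ.< ε → 0ℚ ℚ.< ½ ℚ.* ε
    ½-pos {ε} ε>0 = subst (ℚ._< ½ ℚ.* ε) (ℚ.*-zeroʳ ½) (ℚ.*-monoʳ-<-pos ½ ε>0)

    const-cauchy : ∀ q → IsCauchy (λ _ → q)
    const-cauchy q ε ε>0 = 0 , λ _ _ _ _ →
      subst (λ r → ℚ.∣ r ∣ ℚ.< ε) (sym (ℚ.+-inverseʳ q)) ε>0

    +-cauchy : ∀ {x y} → IsCauchy x → IsCauchy y → IsCauchy (λ n → x n ℚ.+ y n)
    +-cauchy {x} {y} cx cy ε ε>0
      with cx (½ ℚ.* ε) (½-pos ε>0) | cy (½ ℚ.* ε) (½-pos ε>0)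
    ... | N₁ , h₁ | N₂ , h₂ = N₁ ℕ.⊔ N₂ , λ m n N≤m N≤n →
      let open ℚ.≤-Reasoning in begin-strict
        ℚ.∣ (x m ℚ.+ y m) ℚ.- (x n ℚ.+ y n) ∣
          ≡⟨ cong ℚ.∣_∣ (rearrange (x m) (y m) (x n) (y n)) ⟩
        ℚ.∣ (x m ℚ.- x n) ℚ.+ (y m ℚ.- y n) ∣
          ≤⟨ ℚ.∣p+q∣≤∣p∣+∣q∣ (x m ℚ.- x n) (y m ℚ.- y n) ⟩
        ℚ.∣ x m ℚ.- x n ∣ ℚ.+ ℚ.∣ y m ℚ.- y n ∣
          <⟨ ℚ.+-mono-< (h₁ m n (ℕ.m⊔n≤o⇒m≤o N₁ N₂ N≤m) (ℕ.m⊔n≤o⇒m≤o N₁ N₂ N≤n))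
                        (h₂ m n (ℕ.m⊔n≤o⇒n≤o N₁ N₂ N≤m) (ℕ.m⊔n≤o⇒n≤o N₁ N₂ N≤n)) ⟩
        ½ ℚ.* ε ℚ.+ ½ ℚ.* ε
          ≡⟨ 2*½ ε ⟩
        ε ∎
      where
      rearrange : ∀ a b c d → (a ℚ.+ b) ℚ.- (c ℚ.+ d) ≡ (a ℚ.- c) ℚ.+ (b ℚ.- d)
      rearrange = solve 4 (λ a b c d → (a :+ b) :- (c :+ d) := (a :- c) :+ (b :- d)) refl
        where open +-*-Solver

    neg-cauchy : ∀ {x} → IsCauchy x → IsCauchy (λ n → ℚ.- x n)
    neg-cauchy {x} cx ε ε>0 with cx ε ε>0
    ... | N , h = N , λ m n N≤m N≤n →
      subst (ℚ._< ε)
        (trans (sym (ℚ.∣-p∣≡∣p∣ (x m ℚ.- x n)))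
               (cong ℚ.∣_∣ (ℚ.neg-distrib-+ (x m) (ℚ.- x n))))
        (h m n N≤m N≤n)

    bounded : ∀ {x} → IsCauchy x →
              ∃[ B ] (0ℚ ℚ.< B × Eventually λ n → ℚ.∣ x n ∣ ℚ.≤ B)
    bounded {x} cx with cx 1ℚ (ℚ.positive⁻¹ 1ℚ)
    ... | N , h = ℚ.∣ x N ∣ ℚ.+ 1ℚ ,
      ℚ.+-mono-≤-< (ℚ.0≤∣p∣ (x N)) (ℚ.positive⁻¹ 1ℚ) ,
      N , λ n N≤n → let open ℚ.≤-Reasoning in begin
        ℚ.∣ x n ∣
          ≡⟨ cong ℚ.∣_∣ (split (x N) (x n)) ⟩
        ℚ.∣ x N ℚ.+ (x n ℚ.- x N) ∣
          ≤⟨ ℚ.∣p+q∣≤∣p∣+∣q∣ (x N) (x n ℚ.- x N) ⟩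
        ℚ.∣ x N ∣ ℚ.+ ℚ.∣ x n ℚ.- x N ∣
          ≤⟨ ℚ.+-monoʳ-≤ ℚ.∣ x N ∣ (ℚ.<⇒≤ (h n N N≤n ℕ.≤-refl)) ⟩
        ℚ.∣ x N ∣ ℚ.+ 1ℚ ∎
      where
      split : ∀ a b → b ≡ a ℚ.+ (b ℚ.- a)
      split = solve 2 (λ a b → b := a :+ (b :- a)) refl
        where open +-*-Solver

    scale : ∀ {B ε} → 0ℚ ℚ.< B → 0ℚ ℚ.< ε → ∃[ δ ] (0ℚ ℚ.< δ × δ ℚ.* B ≡ ε)
    scale {B} {ε} B>0 ε>0 = ε ℚ.* ℚ.1/ B ,
      subst (ℚ._< ε ℚ.* ℚ.1/ B) (ℚ.*-zeroˡ (ℚ.1/ B)) (ℚ.*-monoˡ-<-pos (ℚ.1/ B) ε>0) ,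
      trans (ℚ.*-assoc ε (ℚ.1/ B) B)
            (trans (cong (ε ℚ.*_) (ℚ.*-inverseˡ B)) (ℚ.*-identityʳ ε))
      where
      instance
        B-pos : ℚ.Positive B
        B-pos = ℚ.positive B>0
        B≢0 : ℚ.NonZero B
        B≢0 = ℚ.pos⇒nonZero B
        1/B-pos : ℚ.Positive (ℚ.1/ B)
        1/B-pos = ℚ.1/pos⇒pos B

    ∣*∣-bound : ∀ p q {δ B} → ℚ.∣ p ∣ ℚ.< δ → ℚ.∣ q ∣ ℚ.≤ B → 0ℚ ℚ.< B →
                ℚ.∣ p ℚ.* q ∣ ℚ.< δ ℚ.* B
    ∣*∣-bound p q {δ} {B} p<δ q≤B B>0 = let open ℚ.≤-Reasoning in begin-strict
      ℚ.∣ p ℚ.* q ∣       ≡⟨ ℚ.∣p*q∣≡∣p∣*∣q∣ p q ⟩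
      ℚ.∣ p ∣ ℚ.* ℚ.∣ q ∣ ≤⟨ ℚ.*-monoˡ-≤-nonNeg ℚ.∣ p ∣ {{ℚ.∣-∣-nonNeg p}} q≤B ⟩
      ℚ.∣ p ∣ ℚ.* B       <⟨ ℚ.*-monoˡ-<-pos B {{ℚ.positive B>0}} p<δ ⟩
      δ ℚ.* B             ∎

    *-rearrange : ∀ a b c d →
      a ℚ.* b ℚ.- c ℚ.* d ≡ (a ℚ.- c) ℚ.* b ℚ.+ (b ℚ.- d) ℚ.* c
    *-rearrange = solve 4 (λ a b c d →
      a :* b :- c :* d := (a :- c) :* b :+ (b :- d) :* c) refl
      where open +-*-Solver

    *-close : ∀ a b c d {A B δ₁ δ₂} → 0ℚ ℚ.< A → 0ℚ ℚ.< B →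
              ℚ.∣ a ℚ.- c ∣ ℚ.< δ₁ → ℚ.∣ b ℚ.- d ∣ ℚ.< δ₂ →
              ℚ.∣ b ∣ ℚ.≤ B → ℚ.∣ c ∣ ℚ.≤ A →
              ℚ.∣ a ℚ.* b ℚ.- c ℚ.* d ∣ ℚ.< δ₁ ℚ.* B ℚ.+ δ₂ ℚ.* A
    *-close a b c d {A} {B} {δ₁} {δ₂} A>0 B>0 a~c b~d b≤B c≤A =
      subst (λ r → ℚ.∣ r ∣ ℚ.< δ₁ ℚ.* B ℚ.+ δ₂ ℚ.* A) (sym (*-rearrange a b c d))
        (ℚ.≤-<-trans
          (ℚ.∣p+q∣≤∣p∣+∣q∣ ((a ℚ.- c) ℚ.* b) ((b ℚ.- d) ℚ.* c))
          (ℚ.+-mono-< (∣*∣-bound (a ℚ.- c) b a~c b≤B B>0)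
                      (∣*∣-bound (b ℚ.- d) c b~d c≤A A>0)))

    *-cauchy : ∀ {x y} → IsCauchy x → IsCauchy y → IsCauchy (λ n → x n ℚ.* y n)
    *-cauchy {x} {y} cx cy ε ε>0 =
      let A  , A>0 , Nᵃ , hᵃ = bounded cx
          B  , B>0 , Nᵇ , hᵇ = bounded cy
          δ₁ , δ₁>0 , eq₁    = scale B>0 (½-pos ε>0)
          δ₂ , δ₂>0 , eq₂    = scale A>0 (½-pos ε>0)
          N₁ , h₁            = cx δ₁ δ₁>0
          N₂ , h₂            = cy δ₂ δ₂>0
          N₁₂ = N₁ ℕ.⊔ N₂
          Nᵃᵇ = Nᵃ ℕ.⊔ Nᵇ
      in N₁₂ ℕ.⊔ Nᵃᵇ , λ m n N≤m N≤n →
        let m₁₂ = ℕ.m⊔n≤o⇒m≤o N₁₂ Nᵃᵇ N≤m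
            n₁₂ = ℕ.m⊔n≤o⇒m≤o N₁₂ Nᵃᵇ N≤n
        in subst (ℚ.∣ x m ℚ.* y m ℚ.- x n ℚ.* y n ∣ ℚ.<_)
             (trans (cong₂ ℚ._+_ eq₁ eq₂) (2*½ ε))
             (*-close (x m) (y m) (x n) (y n) A>0 B>0
               (h₁ m n (ℕ.m⊔n≤o⇒m≤o N₁ N₂ m₁₂) (ℕ.m⊔n≤o⇒m≤o N₁ N₂ n₁₂))
               (h₂ m n (ℕ.m⊔n≤o⇒n≤o N₁ N₂ m₁₂) (ℕ.m⊔n≤o⇒n≤o N₁ N₂ n₁₂))
               (hᵇ m (ℕ.m⊔n≤o⇒n≤o Nᵃ Nᵇ (ℕ.m⊔n≤o⇒n≤o N₁₂ Nᵃᵇ N≤m)))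
               (hᵃ n (ℕ.m⊔n≤o⇒m≤o Nᵃ Nᵇ (ℕ.m⊔n≤o⇒n≤o N₁₂ Nᵃᵇ N≤n))))

infixl 6 _+_ _-_
infixl 7 _*_
infix  8 -_

_+_ : ℝ → ℝ → ℝ
x + y = mkℝ (λ n → seq x n ℚ.+ seq y n) (+-cauchy {seq x} {seq y} (cauchy x) (cauchy y))

_*_ : ℝ → ℝ → ℝ
x * y = mkℝ (λ n → seq x n ℚ.* seq y n) (*-cauchy {seq x} {seq y} (cauchy x) (cauchy y))

-_ : ℝ → ℝ
- x = mkℝ (λ n → ℚ.- seq x n) (neg-cauchy {seq x} (cauchy x))

_-_ : ℝ → ℝ → ℝ
x - y = x + (- y)

fromℚ : ℚ → ℝ
fromℚ q = mkℝ (λ _ → q) (const-cauchy q)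

fromℕ : ℕ → ℝ
fromℕ n = fromℚ (+ n ℚ./ 1)

0ℝ 1ℝ : ℝ
0ℝ = fromℚ 0ℚ
1ℝ = fromℚ 1ℚ

ℝ-rawRing : RawRing 0ℓ 0ℓ
ℝ-rawRing = record
  { Carrier = ℝ ; _≈_ = _≈_ ; _+_ = _+_ ; _*_ = _*_ ; -_ = -_ ; 0# = 0ℝ ; 1# = 1ℝ }

open RawSemiringDefinitions (RawRing.rawSemiring ℝ-rawRing) public
  using (sum; product)

------------------------------------------------------------------------
-- Matrices and determinants

Matrix : ∀ {a} → Set a → ℕ → Set a
Matrix A n = Fin n → Fin n → A

module Determinant {c ℓ} (R : RawRing c ℓ) where

  open RawRing R using (Carrier; 1#; rawSemiring)
    renaming (_*_ to _*ᴿ_; -_ to -ᴿ_)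
  open RawSemiringDefinitions rawSemiring using (_^_) renaming (sum to sumᴿ)

  -- Laplace expansion along the first row.
  det : ∀ {n} → Matrix Carrier n → Carrier
  det {zero}  M = 1#
  det {suc n} M = sumᴿ λ j →
    (((-ᴿ 1#) ^ toℕ j) *ᴿ M zero j) *ᴿ det (λ i → removeAt (M (suc i)) j)

open Determinant ℝ-rawRing public using (det)

scalar : ∀ {n} → ℝ → Matrix ℝ n
scalar x i j = if does (i Fin.≟ j) then x else 0ℝ

charpoly : ∀ {n} → Matrix ℝ n → ℝ → ℝ
charpoly M x = det (λ i j → scalar x i j - M i j)

-- `IsOrderedSpectrum M μ` says that μ₀ ≥ μ₁ ≥ … ≥ μₙ₋₁ are all the
-- eigenvalues of M, repeated according to their multiplicity as roots of
-- the characteristic polynomial (for symmetric M this is also the dimension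
-- of the eigenspace).  A polynomial over ℝ is determined by its values, so
-- the factorisation is stated pointwise.
record IsOrderedSpectrum {n} (M : Matrix ℝ n) (μ : Vector ℝ n) : Set where
  field
    charpoly-splits : ∀ x → charpoly M x ≈ product (λ i → x - μ i)
    decreasing      : ∀ i j → i Fin.≤ j → μ j ≤ μ i

sumFirst : ∀ {n} k → k ℕ.≤ n → Vector ℝ n → ℝ
sumFirst k k≤n μ = sum {k} (λ i → μ (inject≤ i k≤n))

------------------------------------------------------------------------
-- Finite simple graphs

record SimpleGraph (n : ℕ) : Set₁ where
  field
    Adj        : Rel (Fin n) 0ℓ
    adj?       : Decidable Adj
    adj-sym    : Symmetric Adj
    adj-irrefl : Irreflexive _≡_ Adj

module _ {n} (G : SimpleGraph n) where

  open SimpleGraph G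

  degree : Fin n → ℕ
  degree u = length (filter (adj? u) (allFin n))

  -- Each edge {u , v} is listed once, as the pair with u < v.
  edges : List (Fin n × Fin n)
  edges = filter (λ e → (proj₁ e Fin.<? proj₂ e) ×-dec adj? (proj₁ e) (proj₂ e))
                 (cartesianProduct (allFin n) (allFin n))

  edgeCount : ℕ
  edgeCount = length edges

  laplacian : Matrix ℝ n
  laplacian u v =
    if does (u Fin.≟ v) then fromℕ (degree u)
    else if does (adj? u v) then - 1ℝ
    else 0ℝ

-- By Ky Fan's principle the sum of the k largest eigenvalues of L is tr (L P) for a symmetric
-- P with P² ≤ P and tr P = k.  Write a u = P u u.  Then tr (L P) - |E| is the sum of
-- a u + a v - 2 P u v - 1 over the edges.  Bounding -2 P u v by t + (P u v)² / t, where
-- 1 / t = c u + c v and c u = 1 / (1 - a u) - 1/3, each summand turns out to be at most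
-- (c u + c v) (P u v)² + 4/3 * a u * a v.  As the off-diagonal entries of row u satisfy
-- ∑ (P u v)² ≤ a u - (a u)², these bounds add up to at most 2/3 * (k² + k), which is at most k²
-- for k ≥ 2.  For k = 1 it suffices that deg u + deg v ≤ |E| + 1 for every edge.
--
-- P is taken to be a polynomial in L, so that eigenvectors are not needed.  Since
-- det (1 - z L) = ∏ (1 - z μᵢ), comparing derivatives and letting z tend to 0 gives
-- tr Lᴺ = ∑ μᵢᴺ for all N.  Hence tr (q (L)) = ∑ q (μᵢ) for every polynomial q, and if q vanishes
-- on the spectrum then tr (q (L)²) = 0, i.e. q (L) = 0.  So interpolation on the spectrum yields
-- the spectral idempotents of L.
--
-- Cases may be distinguished although the reals are constructive, as _≤_ is stable under
-- double negation.

module Submission where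

open import Defs using (Matrix; module Determinant; SimpleGraph; degree; edgeCount)
open import Algebra.Bundles using (CommutativeRing; RawRing; Semiring)
import Algebra.Solver.Ring
open import Algebra.Solver.Ring.AlmostCommutativeRing using (_-Raw-AlmostCommutative⟶_; fromCommutativeRing)
open import Data.Bool.Base using (if_then_else_; true; false)
open import Data.Empty using (⊥-elim)
open import Data.Fin.Base as Fin using (Fin; zero; suc; toℕ; inject₁; inject≤; fromℕ<; punchIn)
import Data.Fin.Properties as Fin
open import Data.Integer.Base as ℤ using (ℤ; +_; -[1+_])
import Data.Integer.Properties as ℤ
open import Data.Maybe.Base using (Maybe; just; nothing)
open import Data.Nat.Base as ℕ using (ℕ; zero; suc; z≤n; s≤s)
import Data.Nat.Coprimality as Coprime
import Data.Nat.Properties as ℕ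
open import Data.Product.Base using (_×_; _,_; ∃-syntax; proj₁; proj₂)
open import Data.Sum.Base using (_⊎_; inj₁; inj₂)
open import Data.Vec.Functional using (Vector; removeAt; updateAt)
open import Function.Base using (_∘_; const; id)
open import Level using (0ℓ)
open import Relation.Binary.Core using (Rel)
open import Relation.Binary.Definitions using (tri<; tri≈; tri>)
import Relation.Binary.PropositionalEquality as ≡
open ≡ using (_≡_; _≢_)
open import Relation.Nullary.Decidable using (Dec; does; yes; no; _×-dec_)
open import Relation.Nullary.Negation.Core using (¬_)

-- Determinants

-- A polynomial in L takes equal values at equal eigenvalues. If the k-th largest eigenvalue t also
-- occurs at later positions, no polynomial in L projects onto k leading eigenvectors. All
-- eigenvalues equal to t therefore receive one weight θ in [0 , 1], fixed by the trace being k, and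
-- P is a convex combination of two projections: hence P² ≤ P in place of P² = P. The term 1 / (1 -
-- a) in c is matched to the budget a - a² = a * (1 - a) of a row. Subtracting 1/3 gives c * (a -
-- a²) = (2 * a + a²) / 3, so the squares over all pairs cost at most 2/3 * k + 1/3 * Q with Q = ∑
-- a². The products 4/3 * a u * a v over all pairs sum to 2/3 * (k² - Q), and the total is 2/3 * (k²
-- + k) - 1/3 * Q. Pairs that are not edges only add nonnegative amounts, so the graph drops out of
-- this sum. Derivatives are limits of difference quotients, and z = 0 is reached only as the limit
-- of 1 / (m + 1), because the determinants are compared at invertible z.

module Sums {c ℓ} (CR : CommutativeRing c ℓ) where

  open CommutativeRing CR hiding (zero)
  open import Relation.Binary.Reasoning.Setoid setoid
  import Algebra.Properties.Semiring.Sum semiring as S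

  -- Opaque, so that unification can read f off ∑ f.
  opaque
    ∑ : ∀ {n} → Vector Carrier n → Carrier
    ∑ = S.sum

    ∑-empty : ∀ (f : Vector Carrier 0) → ∑ f ≈ 0#
    ∑-empty f = refl

    ∑-suc : ∀ {n} (f : Vector Carrier (suc n)) → ∑ f ≈ f zero + ∑ (f ∘ suc)
    ∑-suc f = refl

    ∑-cong : ∀ {n} {f g : Vector Carrier n} → (∀ i → f i ≈ g i) → ∑ f ≈ ∑ g
    ∑-cong f≈g = S.sum-cong-≋ f≈g

    ∑-distrib-+ : ∀ {n} (f g : Vector Carrier n) → ∑ (λ i → f i + g i) ≈ ∑ f + ∑ g
    ∑-distrib-+ = S.∑-distrib-+

    ∑-comm : ∀ {m n} (f : Fin m → Fin n → Carrier) →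
      ∑ (λ i → ∑ (λ j → f i j)) ≈ ∑ (λ j → ∑ (λ i → f i j))
    ∑-comm = S.∑-comm

    *-distribˡ-∑ : ∀ {n} x (f : Vector Carrier n) → x * ∑ f ≈ ∑ (λ i → x * f i)
    *-distribˡ-∑ = S.*-distribˡ-sum

    *-distribʳ-∑ : ∀ {n} x (f : Vector Carrier n) → ∑ f * x ≈ ∑ (λ i → f i * x)
    *-distribʳ-∑ = S.*-distribʳ-sum

    ∑-0 : ∀ {n} {f : Vector Carrier n} → (∀ i → f i ≈ 0#) → ∑ f ≈ 0#
    ∑-0 {n} f≈0 = trans (S.sum-cong-≋ f≈0) (S.sum-replicate-zero n)

  δ : ∀ {n} → Fin n → Fin n → Carrier
  δ i j = if does (i Fin.≟ j) then 1# else 0#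

  ∑-δʳ : ∀ {n} (r : Vector Carrier n) j → ∑ (λ i → r i * δ i j) ≈ r j
  ∑-δʳ r zero = trans (∑-suc _) (trans
    (+-cong (*-identityʳ _) (∑-0 λ i → zeroʳ (r (suc i)))) (+-identityʳ _))
  ∑-δʳ r (suc j) = trans (∑-suc _) (trans
    (+-cong (zeroʳ _) (∑-δʳ (r ∘ suc) j)) (+-identityˡ _))

  δ-diag : ∀ {n} (i : Fin n) → δ i i ≈ 1#
  δ-diag zero    = refl
  δ-diag (suc i) = δ-diag i

  δ-off : ∀ {n} {i j : Fin n} → i ≢ j → δ i j ≈ 0#
  δ-off {i = i} {j} i≢j with i Fin.≟ j
  ... | yes i≡j = ⊥-elim (i≢j i≡j)
  ... | no _    = refl

  δ-sym : ∀ {n} (i j : Fin n) → δ i j ≡ δ j i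
  δ-sym zero    zero    = ≡.refl
  δ-sym zero    (suc j) = ≡.refl
  δ-sym (suc i) zero    = ≡.refl
  δ-sym (suc i) (suc j) = δ-sym i j

  ∑-δˡ : ∀ {n} (r : Vector Carrier n) j → ∑ (λ i → δ j i * r i) ≈ r j
  ∑-δˡ r j = trans
    (∑-cong λ i → trans (*-comm _ _) (*-congˡ (reflexive (δ-sym j i)))) (∑-δʳ r j)

module DetTheory {c ℓ} (CR : CommutativeRing c ℓ) where

  open import Data.Vec.Functional using (_∷_)
  open CommutativeRing CR hiding (zero)
  open Sums CR
  private module D = Determinant rawRing
  open import Algebra.Solver.Ring.NaturalCoefficients.Default commutativeSemiring
    using (solve; _:+_; _:*_; _:=_; con)
  open import Algebra.Definitions.RawSemiring (Semiring.rawSemiring semiring) using (_^_; product)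
  open import Relation.Binary.Reasoning.Setoid setoid

  minor : ∀ {n} → Matrix Carrier (suc n) → Fin (suc n) → Matrix Carrier n
  minor M j i = removeAt (M (suc i)) j

  sign : ∀ {n} → Fin n → Carrier
  sign j = (- 1#) ^ toℕ j

  opaque
    unfolding ∑

    det : ∀ {n} → Matrix Carrier n → Carrier
    det = D.det

    -- The way back from the opaque `det` to the determinant in `charpoly`.
    det≡det : ∀ {n} (M : Matrix Carrier n) → det M ≡ D.det M
    det≡det M = ≡.refl

    det-empty : ∀ (M : Matrix Carrier 0) → det M ≈ 1#
    det-empty M = refl

    det-suc : ∀ {n} (M : Matrix Carrier (suc n)) →
      det M ≈ ∑ (λ j → (sign j * M zero j) * det (minor M j))
    det-suc M = refl

  det-cong : ∀ {n} {M N : Matrix Carrier n} → (∀ i j → M i j ≈ N i j) → det M ≈ det N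
  det-cong {zero}  {M} {N} M≈N = trans (det-empty M) (sym (det-empty N))
  det-cong {suc n} {M} {N} M≈N = trans (det-suc M) (trans
    (∑-cong λ j → *-cong (*-congˡ (M≈N zero j)) (det-cong λ i l → M≈N (suc i) (punchIn j l)))
    (sym (det-suc N)))

  -- The pairs (j , punchIn j l) of distinct columns come in the two orders
  -- (inject₁ i , l) and (suc l , i) with i ≤ l.
  ∑-antisymmetric : ∀ n (G : Fin (suc n) → Fin n → Carrier) →
    (∀ i l → i Fin.≤ l → G (inject₁ i) l + G (suc l) i ≈ 0#) →
    ∑ (λ j → ∑ (G j)) ≈ 0#
  ∑-antisymmetric zero    G anti = ∑-0 λ j → ∑-empty (G j)
  ∑-antisymmetric (suc n) G anti = begin
    ∑ (λ j → ∑ (G j))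
      ≈⟨ trans (∑-suc _) (+-congˡ (∑-cong λ j → ∑-suc (G (suc j)))) ⟩
    ∑ (G zero) + ∑ (λ j → G (suc j) zero + ∑ (G (suc j) ∘ suc))
      ≈⟨ +-congˡ (∑-distrib-+ (λ j → G (suc j) zero) _) ⟩
    ∑ (G zero) + (∑ (λ j → G (suc j) zero) + ∑ (λ j → ∑ (G (suc j) ∘ suc)))
      ≈⟨ +-assoc _ _ _ ⟨
    ∑ (G zero) + ∑ (λ j → G (suc j) zero) + ∑ (λ j → ∑ (G (suc j) ∘ suc))
      ≈⟨ +-cong (sym (∑-distrib-+ (G zero) _))
                (∑-antisymmetric n (λ j l → G (suc j) (suc l)) λ i l i≤l →
                   anti (suc i) (suc l) (s≤s i≤l)) ⟩
    ∑ (λ l → G zero l + G (suc l) zero) + 0#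
      ≈⟨ +-identityʳ _ ⟩
    ∑ (λ l → G zero l + G (suc l) zero)
      ≈⟨ ∑-0 (λ l → anti zero l z≤n) ⟩
    0# ∎

  punchIn-inject₁ : ∀ {n} (i l : Fin n) → i Fin.≤ l → punchIn (inject₁ i) l ≡ suc l
  punchIn-inject₁ zero    l       _         = ≡.refl
  punchIn-inject₁ (suc i) (suc l) (s≤s i≤l) = ≡.cong suc (punchIn-inject₁ i l i≤l)

  punchIn-suc : ∀ {n} (i l : Fin n) → i Fin.≤ l → punchIn (suc l) i ≡ inject₁ i
  punchIn-suc zero    l       _         = ≡.refl
  punchIn-suc (suc i) (suc l) (s≤s i≤l) = ≡.cong suc (punchIn-suc i l i≤l)

  -- Both sides skip the same two columns, `inject₁ i` and `suc l`, in the two possible orders.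
  punchIn-comm : ∀ {n} (i l : Fin (suc n)) (k : Fin n) → i Fin.≤ l →
    punchIn (inject₁ i) (punchIn l k) ≡ punchIn (suc l) (punchIn i k)
  punchIn-comm zero    l       k       _         = ≡.refl
  punchIn-comm (suc i) (suc l) zero    _         = ≡.refl
  punchIn-comm (suc i) (suc l) (suc k) (s≤s i≤l) = ≡.cong suc (punchIn-comm i l k i≤l)

  module TwoRows {n} (R : Fin n → Vector Carrier (suc (suc n))) where

    term : (x y : Vector Carrier (suc (suc n))) → Fin (suc (suc n)) → Fin (suc n) → Carrier
    term x y j l = (sign j * x j) *
      ((sign l * y (punchIn j l)) * det (λ i k → R i (punchIn j (punchIn l k))))

    expand : ∀ x y → det (x ∷ y ∷ R) ≈ ∑ (λ j → ∑ (term x y j))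
    expand x y = trans (det-suc _) (∑-cong λ j →
      trans (*-congˡ (det-suc _)) (*-distribˡ-∑ (sign j * x j) _))

    cancel : ∀ s t a b d → (s * a) * ((t * b) * d) + ((- 1# * t) * b) * ((s * a) * d) ≈ 0#
    cancel s t a b d = trans (factor s t a b d (- 1#)) (trans (*-congʳ (-‿inverseʳ 1#)) (zeroˡ _))
      where
      factor : ∀ s t a b d e → (s * a) * ((t * b) * d) + ((e * t) * b) * ((s * a) * d) ≈ (1# + e) * (s * a * t * b * d)
      factor = solve 6 (λ s t a b d e → (s :* a) :* ((t :* b) :* d) :+ ((e :* t) :* b) :* ((s :* a) :* d)
        := (con 1 :+ e) :* (s :* a :* t :* b :* d)) refl

    -- The two terms give `x` and `y` the same columns and leave the same minor of `R`. Column
    -- `suc l` of the full matrix is column `l` once column `i` is gone, and this shift by one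
    -- produces the opposite sign.
    term-antisymmetric : ∀ x y i l → i Fin.≤ l →
      term x y (inject₁ i) l + term y x (suc l) i ≈ 0#
    term-antisymmetric x y i l i≤l = trans (+-cong
      (*-cong (*-congʳ (reflexive (≡.cong ((- 1#) ^_) (Fin.toℕ-inject₁ i))))
              (*-congʳ (*-congˡ (reflexive (≡.cong y (punchIn-inject₁ i l i≤l))))))
      (*-congˡ (*-cong (*-congˡ (reflexive (≡.cong x (punchIn-suc i l i≤l))))
         (det-cong λ r k → reflexive (≡.cong (R r) (≡.sym (punchIn-comm i l k i≤l)))))))
      (cancel (sign i) (sign l) (x (inject₁ i)) (y (suc l)) _)

    -- Read off the double sum itself: `swap-rows` with equal rows would only show that twice the
    -- determinant vanishes.
    equal-rows : ∀ x → det (x ∷ x ∷ R) ≈ 0#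
    equal-rows x = trans (expand x x)
      (∑-antisymmetric _ (term x x) (term-antisymmetric x x))

    swap-rows : ∀ x y → det (x ∷ y ∷ R) + det (y ∷ x ∷ R) ≈ 0#
    swap-rows x y = begin
      det (x ∷ y ∷ R) + det (y ∷ x ∷ R)
        ≈⟨ +-cong (expand x y) (expand y x) ⟩
      ∑ (λ j → ∑ (term x y j)) + ∑ (λ j → ∑ (term y x j))
        ≈⟨ ∑-distrib-+ (λ j → ∑ (term x y j)) _ ⟨
      ∑ (λ j → ∑ (term x y j) + ∑ (term y x j))
        ≈⟨ ∑-cong (λ j → ∑-distrib-+ (term x y j) _) ⟨
      ∑ (λ j → ∑ (λ l → term x y j l + term y x j l))
        ≈⟨ ∑-antisymmetric _ (λ j l → term x y j l + term y x j l) (λ i l i≤l →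
             trans (exchange _ _ _ _)
               (trans (+-cong (term-antisymmetric x y i l i≤l) (term-antisymmetric y x i l i≤l))
                      (+-identityˡ 0#))) ⟩
      0# ∎
      where
      exchange : ∀ a b c d → (a + b) + (c + d) ≈ (a + d) + (b + c)
      exchange = solve 4 (λ a b c d → (a :+ b) :+ (c :+ d) := (a :+ d) :+ (b :+ c)) refl

  det-minors-zero : ∀ {n} (M : Matrix Carrier (suc n)) →
    (∀ j → det (minor M j) ≈ 0#) → det M ≈ 0#
  det-minors-zero M 0s = trans (det-suc M) (∑-0 λ j → trans (*-congˡ (0s j)) (zeroʳ _))

  -- A repetition below row 0 survives in every minor. A repetition of row 0 beyond row 1 is brought
  -- below row 0 by swapping rows 0 and 1.
  det-equal-rows-< : ∀ {n} (M : Matrix Carrier n) {i k} → i Fin.< k →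
    (∀ j → M i j ≈ M k j) → det M ≈ 0#
  det-equal-rows-< M {suc i} {suc k} (s≤s i<k) eq = det-minors-zero M λ j →
    det-equal-rows-< (minor M j) i<k (λ l → eq (punchIn j l))
  det-equal-rows-< {suc (suc n)} M {zero} {suc zero} _ eq =
    trans (det-cong λ { zero j → refl ; (suc zero) j → sym (eq j) ; (suc (suc i)) j → refl })
          (TwoRows.equal-rows (λ i → M (suc (suc i))) (M zero))
  det-equal-rows-< {suc (suc n)} M {zero} {suc (suc k)} _ eq = begin
    det M
      ≈⟨ det-cong (λ { zero j → refl ; (suc zero) j → refl ; (suc (suc i)) j → refl }) ⟩
    det (M zero ∷ M (suc zero) ∷ R)
      ≈⟨ +-identityʳ _ ⟨
    det (M zero ∷ M (suc zero) ∷ R) + 0#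
      ≈⟨ +-congˡ (det-minors-zero M′ λ j →
           det-equal-rows-< (minor M′ j) {zero} {suc k} (s≤s z≤n) (λ l → eq (punchIn j l))) ⟨
    det (M zero ∷ M (suc zero) ∷ R) + det M′
      ≈⟨ TwoRows.swap-rows R (M zero) (M (suc zero)) ⟩
    0# ∎
    where
    R  = λ i → M (suc (suc i))
    M′ = M (suc zero) ∷ M zero ∷ R

  det-equal-rows : ∀ {n} (M : Matrix Carrier n) {i k} → i ≢ k →
    (∀ j → M i j ≈ M k j) → det M ≈ 0#
  det-equal-rows M {i} {k} i≢k eq with Fin.<-cmp i k
  ... | tri< i<k _ _ = det-equal-rows-< M i<k eq
  ... | tri≈ _ i≡k _ = ⊥-elim (i≢k i≡k)
  ... | tri> _ _ k<i = det-equal-rows-< M k<i (λ j → sym (eq j))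

  infix 8 _[_≔_]

  _[_≔_] : ∀ {m n} → (Fin m → Vector Carrier n) → Fin m → Vector Carrier n → Fin m → Vector Carrier n
  M [ i ≔ r ] = updateAt M i (const r)

  ≔-updates : ∀ {m n} (M : Fin m → Vector Carrier n) i r → (M [ i ≔ r ]) i ≡ r
  ≔-updates M zero    r = ≡.refl
  ≔-updates M (suc i) r = ≔-updates (M ∘ suc) i r

  ≔-minimal : ∀ {m n} (M : Fin m → Vector Carrier n) {i k} r → k ≢ i → (M [ i ≔ r ]) k ≡ M k
  ≔-minimal M {zero}  {zero}  r k≢i = ⊥-elim (k≢i ≡.refl)
  ≔-minimal M {zero}  {suc k} r k≢i = ≡.refl
  ≔-minimal M {suc i} {zero}  r k≢i = ≡.refl
  ≔-minimal M {suc i} {suc k} r k≢i = ≔-minimal (M ∘ suc) r (k≢i ∘ ≡.cong suc)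

  ≔-self : ∀ {m n} (M : Fin m → Vector Carrier n) i k → (M [ i ≔ M i ]) k ≡ M k
  ≔-self M i k with k Fin.≟ i
  ... | yes ≡.refl = ≔-updates M i (M i)
  ... | no k≢i     = ≔-minimal M (M i) k≢i

  ≔-map : ∀ {m n p} (f : Vector Carrier n → Vector Carrier p) (M : Fin m → Vector Carrier n) i r k →
    f ((M [ i ≔ r ]) k) ≡ ((f ∘ M) [ i ≔ f r ]) k
  ≔-map f M zero    r zero    = ≡.refl
  ≔-map f M zero    r (suc k) = ≡.refl
  ≔-map f M (suc i) r zero    = ≡.refl
  ≔-map f M (suc i) r (suc k) = ≔-map f (M ∘ suc) i r k

  det-minor-≔ : ∀ {n} (M : Matrix Carrier (suc n)) i r j →
    det (minor (M [ suc i ≔ r ]) j) ≈ det (minor M j [ i ≔ r ∘ punchIn j ])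
  det-minor-≔ M i r j = det-cong λ k l →
    reflexive (≡.cong (λ v → v l) (≔-map (_∘ punchIn j) (M ∘ suc) i r k))

  det-row-∑ : ∀ {n m} (M : Matrix Carrier n) i (w : Vector Carrier m) (V : Fin m → Vector Carrier n) →
    det (M [ i ≔ (λ c → ∑ λ k → w k * V k c) ]) ≈ ∑ (λ k → w k * det (M [ i ≔ V k ]))
  det-row-∑ {suc n} M zero w V = begin
    det (M [ zero ≔ _ ])
      ≈⟨ det-suc _ ⟩
    ∑ (λ j → (sign j * ∑ (λ k → w k * V k j)) * det (minor M j))
      ≈⟨ ∑-cong (λ j → trans (*-congʳ (*-distribˡ-∑ (sign j) _)) (*-distribʳ-∑ (det (minor M j)) _)) ⟩
    ∑ (λ j → ∑ (λ k → (sign j * (w k * V k j)) * det (minor M j)))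
      ≈⟨ ∑-comm (λ j k → (sign j * (w k * V k j)) * det (minor M j)) ⟩
    ∑ (λ k → ∑ (λ j → (sign j * (w k * V k j)) * det (minor M j)))
      ≈⟨ ∑-cong (λ k → ∑-cong λ j → pull (sign j) (w k) (V k j) _) ⟩
    ∑ (λ k → ∑ (λ j → w k * ((sign j * V k j) * det (minor M j))))
      ≈⟨ ∑-cong (λ k → *-distribˡ-∑ (w k) _) ⟨
    ∑ (λ k → w k * ∑ (λ j → (sign j * V k j) * det (minor M j)))
      ≈⟨ ∑-cong (λ k → *-congˡ (det-suc (M [ zero ≔ V k ]))) ⟨
    ∑ (λ k → w k * det (M [ zero ≔ V k ])) ∎
    where
    pull : ∀ s w v d → (s * (w * v)) * d ≈ w * ((s * v) * d)
    pull = solve 4 (λ s w v d → (s :* (w :* v)) :* d := w :* ((s :* v) :* d)) refl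
  det-row-∑ {suc n} M (suc i) w V = begin
    det (M [ suc i ≔ _ ])
      ≈⟨ det-suc _ ⟩
    ∑ (λ j → (sign j * M zero j) * det (minor (M [ suc i ≔ _ ]) j))
      ≈⟨ ∑-cong (λ j → trans (*-congˡ (trans (det-minor-≔ M i _ j)
                               (det-row-∑ (minor M j) i w (λ k → V k ∘ punchIn j))))
                             (*-distribˡ-∑ (sign j * M zero j) _)) ⟩
    ∑ (λ j → ∑ (λ k → (sign j * M zero j) * (w k * D j k)))
      ≈⟨ ∑-comm (λ j k → (sign j * M zero j) * (w k * D j k)) ⟩
    ∑ (λ k → ∑ (λ j → (sign j * M zero j) * (w k * D j k)))
      ≈⟨ ∑-cong (λ k → ∑-cong λ j → pull _ (w k) _) ⟩
    ∑ (λ k → ∑ (λ j → w k * ((sign j * M zero j) * D j k)))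
      ≈⟨ ∑-cong (λ k → *-distribˡ-∑ (w k) _) ⟨
    ∑ (λ k → w k * ∑ (λ j → (sign j * M zero j) * D j k))
      ≈⟨ ∑-cong (λ k → *-congˡ (trans (det-suc _) (∑-cong λ j → *-congˡ (det-minor-≔ M i (V k) j)))) ⟨
    ∑ (λ k → w k * det (M [ suc i ≔ V k ])) ∎
    where
    D = λ j k → det (minor M j [ i ≔ V k ∘ punchIn j ])
    pull : ∀ s w d → s * (w * d) ≈ w * (s * d)
    pull = solve 3 (λ s w d → s :* (w :* d) := w :* (s :* d)) refl

  -- Replacing a row by a unit vector avoids signs and deleted indices: expansion along row `i`
  -- becomes linearity in that row.
  cofactor : ∀ {n} → Matrix Carrier n → Matrix Carrier n
  cofactor M i j = det (M [ i ≔ δ j ])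

  det-≔-cong : ∀ {n} (M : Matrix Carrier n) i {r s : Vector Carrier n} →
    (∀ c → r c ≈ s c) → det (M [ i ≔ r ]) ≈ det (M [ i ≔ s ])
  det-≔-cong M i {r} {s} r≈s = det-cong (go M i)
    where
    go : ∀ {m} (M : Fin m → Vector Carrier _) i k l → (M [ i ≔ r ]) k l ≈ (M [ i ≔ s ]) k l
    go M zero    zero    l = r≈s l
    go M zero    (suc k) l = refl
    go M (suc i) zero    l = refl
    go M (suc i) (suc k) l = go (M ∘ suc) i k l

  det-row-expand : ∀ {n} (M : Matrix Carrier n) i (r : Vector Carrier n) →
    det (M [ i ≔ r ]) ≈ ∑ (λ j → r j * cofactor M i j)
  det-row-expand M i r = trans
    (det-≔-cong M i λ c → sym (∑-δʳ r c))
    (det-row-∑ M i r δ)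

  -- The sum expands the determinant of `M` with row `i` replaced by row `k`, which has two equal
  -- rows unless k = i.
  cofactor-inverse : ∀ {n} (M : Matrix Carrier n) k i →
    ∑ (λ j → M k j * cofactor M i j) ≈ δ k i * det M
  cofactor-inverse M k i = trans (sym (det-row-expand M i (M k))) replaced
    where
    replaced : det (M [ i ≔ M k ]) ≈ δ k i * det M
    replaced with k Fin.≟ i
    ... | yes ≡.refl = trans (det-cong λ r c → reflexive (≡.cong (λ v → v c) (≔-self M k r)))
                             (sym (*-identityˡ _))
    ... | no k≢i = trans (det-equal-rows (M [ i ≔ M k ]) k≢i λ j →
                            reflexive (≡.cong (λ v → v j)
                              (≡.trans (≔-minimal M (M k) k≢i) (≡.sym (≔-updates M i (M k))))))
                         (sym (zeroˡ _))

  -- The difference quotient (det X − det Y) / h for X = Y + h B.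
  slope : ∀ {n} → (X B Y : Matrix Carrier n) → Carrier
  slope {zero}  X B Y = 0#
  slope {suc n} X B Y = ∑ λ j → sign j *
    (B zero j * det (minor X j) + Y zero j * slope (minor X j) (minor B j) (minor Y j))

  -- The product rule x * d - y * e = (x - y) * d + y * (d - e), applied to each term of the Laplace
  -- expansion.
  det-slope : ∀ {n} h (X B Y : Matrix Carrier n) → (∀ i j → X i j ≈ Y i j + h * B i j) →
    det X ≈ det Y + h * slope X B Y
  det-slope {zero}  h X B Y eq = trans (det-empty X)
    (sym (trans (+-cong (det-empty Y) (zeroʳ h)) (+-identityʳ 1#)))
  det-slope {suc n} h X B Y eq = begin
    det X
      ≈⟨ det-suc X ⟩
    ∑ (λ j → (sign j * X zero j) * det (minor X j))
      ≈⟨ ∑-cong (λ j → *-congʳ (*-congˡ (eq zero j))) ⟩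
    ∑ (λ j → (sign j * (Y zero j + h * B zero j)) * det (minor X j))
      ≈⟨ ∑-cong (λ j → trans (split₁ (sign j) (Y zero j) h (B zero j) (det (minor X j)))
           (+-congʳ (*-congˡ (det-slope h (minor X j) (minor B j) (minor Y j) λ i l → eq (suc i) (punchIn j l))))) ⟩
    ∑ (λ j → (sign j * Y zero j) * (det (minor Y j) + h * S j)
             + h * (sign j * (B zero j * det (minor X j))))
      ≈⟨ ∑-cong (λ j → split₂ (sign j) (Y zero j) h _ (S j) _) ⟩
    ∑ (λ j → (sign j * Y zero j) * det (minor Y j)
             + h * (sign j * (B zero j * det (minor X j) + Y zero j * S j)))
      ≈⟨ ∑-distrib-+ (λ j → (sign j * Y zero j) * det (minor Y j)) _ ⟩
    ∑ (λ j → (sign j * Y zero j) * det (minor Y j)) + ∑ (λ j → h * (sign j * (B zero j * det (minor X j) + Y zero j * S j)))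
      ≈⟨ +-cong (det-suc Y) (*-distribˡ-∑ h _) ⟨
    det Y + h * slope X B Y ∎
    where
    S = λ j → slope (minor X j) (minor B j) (minor Y j)
    split₁ : ∀ s y h b d → (s * (y + h * b)) * d ≈ (s * y) * d + h * (s * (b * d))
    split₁ = solve 5 (λ s y h b d → (s :* (y :+ h :* b)) :* d := (s :* y) :* d :+ h :* (s :* (b :* d))) refl
    split₂ : ∀ s y h d S e → (s * y) * (d + h * S) + h * (s * e) ≈ (s * y) * d + h * (s * (e + y * S))
    split₂ = solve 6 (λ s y h d S e → (s :* y) :* (d :+ h :* S) :+ h :* (s :* e) := (s :* y) :* d :+ h :* (s :* (e :+ y :* S))) refl

  -- With both ends equal, `slope` is the derivative of the determinant in the direction `B`: by
  -- multilinearity the rows are differentiated one at a time. Together with `slope-cofactor` this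
  -- is Jacobi's formula.
  slope-diagonal : ∀ {n} (B Y : Matrix Carrier n) →
    slope Y B Y ≈ ∑ (λ i → det (Y [ i ≔ B i ]))
  slope-diagonal {zero}  B Y = sym (∑-empty _)
  slope-diagonal {suc n} B Y = begin
    ∑ (λ j → sign j * (B zero j * det (minor Y j) + Y zero j * slope (minor Y j) (minor B j) (minor Y j)))
      ≈⟨ ∑-cong (λ j → trans (split (sign j) _ _ _ _)
           (+-congˡ (trans (*-congˡ (slope-diagonal (minor B j) (minor Y j)))
                           (*-distribˡ-∑ (sign j * Y zero j) _)))) ⟩
    ∑ (λ j → (sign j * B zero j) * det (minor Y j) + ∑ (λ i → (sign j * Y zero j) * D j i))
      ≈⟨ ∑-distrib-+ (λ j → (sign j * B zero j) * det (minor Y j)) _ ⟩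
    ∑ (λ j → (sign j * B zero j) * det (minor Y j)) + ∑ (λ j → ∑ (λ i → (sign j * Y zero j) * D j i))
      ≈⟨ +-cong (sym (det-suc (Y [ zero ≔ B zero ]))) (∑-comm (λ j i → (sign j * Y zero j) * D j i)) ⟩
    det (Y [ zero ≔ B zero ]) + ∑ (λ i → ∑ (λ j → (sign j * Y zero j) * D j i))
      ≈⟨ +-congˡ (∑-cong λ i → trans (det-suc _) (∑-cong λ j → *-congˡ (det-minor-≔ Y i (B (suc i)) j))) ⟨
    det (Y [ zero ≔ B zero ]) + ∑ (λ i → det (Y [ suc i ≔ B (suc i) ]))
      ≈⟨ ∑-suc _ ⟨
    ∑ (λ i → det (Y [ i ≔ B i ])) ∎
    where
    D = λ j i → det (minor Y j [ i ≔ minor B j i ])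
    split : ∀ s b d y S → s * (b * d + y * S) ≈ (s * b) * d + (s * y) * S
    split = solve 5 (λ s b d y S → s :* (b :* d :+ y :* S) := (s :* b) :* d :+ (s :* y) :* S) refl

  slope-cofactor : ∀ {n} (B Y : Matrix Carrier n) →
    slope Y B Y ≈ ∑ (λ i → ∑ (λ j → B i j * cofactor Y i j))
  slope-cofactor B Y = trans (slope-diagonal B Y) (∑-cong λ i → det-row-expand Y i (B i))

  det-scale : ∀ {n} z (M : Matrix Carrier n) → det (λ i j → z * M i j) ≈ z ^ n * det M
  det-scale {zero}  z M = trans (det-empty _) (sym (trans (*-identityˡ _) (det-empty M)))
  det-scale {suc n} z M = trans (det-suc _) (trans
    (∑-cong λ j → trans (*-congˡ (det-scale z (minor M j))) (pull (sign j) z (M zero j) (z ^ n) _))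
    (sym (trans (*-congˡ (det-suc M)) (*-distribˡ-∑ (z ^ suc n) _))))
    where
    pull : ∀ s z m p d → (s * (z * m)) * (p * d) ≈ (z * p) * ((s * m) * d)
    pull = solve 5 (λ s z m p d → (s :* (z :* m)) :* (p :* d) := (z :* p) :* ((s :* m) :* d)) refl

  diagonal : ∀ {n} → Vector Carrier n → Matrix Carrier n
  diagonal d i j = if does (i Fin.≟ j) then d i else 0#

  det-diagonal : ∀ {n} (d : Vector Carrier n) → det (diagonal d) ≈ product d
  det-diagonal {zero}  d = det-empty _
  det-diagonal {suc n} d = trans (trans (det-suc _) (∑-suc _)) (trans (+-cong
    (*-cong (*-identityˡ _) (det-diagonal (d ∘ suc)))
    (∑-0 λ j → trans (*-congʳ (zeroʳ _)) (zeroˡ _)))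
    (+-identityʳ _))

-- Ordered fields

module IntegerCoefficients {c ℓ} (CR : CommutativeRing c ℓ) where

  open CommutativeRing CR hiding (zero)
  open import Algebra.Properties.Semiring.Mult.TCOptimised semiring
    using (×-homo-+; ×1-homo-*; 1+×) renaming (_×_ to _•_) public
  open import Algebra.Properties.Ring ring
    using (-0#≈0#; -‿+-comm; -‿involutive; -‿distribˡ-*; -‿distribʳ-*)
  open import Relation.Binary.Reasoning.Setoid setoid
  open import Algebra.Solver.Ring.NaturalCoefficients.Default commutativeSemiring as N
    using (_:+_; _:=_)

  -- With the optimised multiples `ι 1` reduces to `1#`. A solver constant `con (+ n)` evaluates to
  -- `ι n`, so numerals in goals match those in the solver.
  ι : ℕ → Carrier
  ι n = n • 1#

  fromℤ : ℤ → Carrier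
  fromℤ (+ n)    = ι n
  fromℤ -[1+ n ] = - ι (suc n)

  fromℤ-⊖ : ∀ m n → fromℤ (m ℤ.⊖ n) ≈ ι m - ι n
  fromℤ-⊖ m       zero    = sym (trans (+-congˡ -0#≈0#) (+-identityʳ _))
  fromℤ-⊖ zero    (suc n) = sym (+-identityˡ _)
  fromℤ-⊖ (suc m) (suc n) = begin
    fromℤ (suc m ℤ.⊖ suc n)
      ≈⟨ reflexive (≡.cong fromℤ (ℤ.[1+m]⊖[1+n]≡m⊖n m n)) ⟩
    fromℤ (m ℤ.⊖ n)
      ≈⟨ fromℤ-⊖ m n ⟩
    ι m - ι n
      ≈⟨ trans (+-assoc _ _ _) (trans (sym (+-assoc _ _ _)) (trans (+-congʳ (-‿inverseʳ 1#)) (+-identityˡ _))) ⟨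
    (1# + - 1#) + (ι m - ι n)
      ≈⟨ N.solve 4 (λ a b c d → (a :+ b) :+ (c :+ d) := (a :+ c) :+ (b :+ d)) refl _ _ _ _ ⟩
    (1# + ι m) + (- 1# - ι n)
      ≈⟨ +-cong (1+× m 1#) (trans (-‿cong (1+× n 1#)) (sym (-‿+-comm _ _))) ⟨
    ι (suc m) - ι (suc n) ∎

  fromℤ-neg : ∀ i → fromℤ (ℤ.- i) ≈ - fromℤ i
  fromℤ-neg (+ zero)  = sym -0#≈0#
  fromℤ-neg (+ suc n) = refl
  fromℤ-neg -[1+ n ]  = sym (-‿involutive _)

  fromℤ-+ : ∀ i j → fromℤ (i ℤ.+ j) ≈ fromℤ i + fromℤ j
  fromℤ-+ (+ m)    (+ n)    = ×-homo-+ 1# m n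
  fromℤ-+ (+ m)    -[1+ n ] = fromℤ-⊖ m (suc n)
  fromℤ-+ -[1+ m ] (+ n)    = trans (fromℤ-⊖ n (suc m)) (+-comm _ _)
  fromℤ-+ -[1+ m ] -[1+ n ] = trans
    (-‿cong (trans (reflexive (≡.cong (ι ∘ suc) (≡.sym (ℕ.+-suc m n)))) (×-homo-+ 1# (suc m) (suc n))))
    (sym (-‿+-comm _ _))

  fromℤ-*⁺ : ∀ m j → fromℤ (+ m ℤ.* j) ≈ ι m * fromℤ j
  fromℤ-*⁺ m (+ n)    = trans (reflexive (≡.cong fromℤ (≡.sym (ℤ.pos-* m n)))) (×1-homo-* m n)
  fromℤ-*⁺ m -[1+ n ] = trans
    (reflexive (≡.cong fromℤ (≡.sym (ℤ.neg-distribʳ-* (+ m) (+ suc n)))))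
    (trans (fromℤ-neg (+ m ℤ.* + suc n)) (trans (-‿cong (fromℤ-*⁺ m (+ suc n))) (-‿distribʳ-* _ _)))

  fromℤ-* : ∀ i j → fromℤ (i ℤ.* j) ≈ fromℤ i * fromℤ j
  fromℤ-* (+ m)    j = fromℤ-*⁺ m j
  fromℤ-* -[1+ m ] j = trans
    (reflexive (≡.cong fromℤ (≡.sym (ℤ.neg-distribˡ-* (+ suc m) j))))
    (trans (fromℤ-neg (+ suc m ℤ.* j)) (trans (-‿cong (fromℤ-*⁺ (suc m) j)) (-‿distribˡ-* _ _)))

  private
    ℤ-rawRing : RawRing 0ℓ 0ℓ
    ℤ-rawRing = CommutativeRing.rawRing ℤ.+-*-commutativeRing

    morphism : ℤ-rawRing -Raw-AlmostCommutative⟶ fromCommutativeRing CR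
    morphism = record
      { ⟦_⟧ = fromℤ ; +-homo = fromℤ-+ ; *-homo = fromℤ-* ; -‿homo = fromℤ-neg ; 0-homo = refl ; 1-homo = refl }

    _coeff≟_ : ∀ i j → Maybe (fromℤ i ≈ fromℤ j)
    i coeff≟ j with i ℤ.≟ j
    ... | yes ≡.refl = just refl
    ... | no  _      = nothing

  module Solver = Algebra.Solver.Ring ℤ-rawRing (fromCommutativeRing CR) morphism _coeff≟_

-- An Archimedean field whose order is total, and whose nonzero elements are
-- invertible, up to double negation.  Since _≤_ is stable, inequalities may
-- still be proved by case analysis.
record OrderedField : Set₁ where
  field
    commutativeRing : CommutativeRing 0ℓ 0ℓ

  open CommutativeRing commutativeRing public hiding (zero)
  open IntegerCoefficients commutativeRing public using (ι; _•_; module Solver)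

  infix 4 _≤_

  field
    _≤_         : Rel Carrier 0ℓ
    ≤-reflexive : ∀ {x y} → x ≈ y → x ≤ y
    ≤-trans     : ∀ {x y z} → x ≤ y → y ≤ z → x ≤ z
    ≤-antisym   : ∀ {x y} → x ≤ y → y ≤ x → x ≈ y
    +-mono-≤    : ∀ {x y u v} → x ≤ y → u ≤ v → x + u ≤ y + v
    *-nonneg    : ∀ {x y} → 0# ≤ x → 0# ≤ y → 0# ≤ x * y
    ≤-stable    : ∀ {x y} → ¬ ¬ (x ≤ y) → x ≤ y
    ≤-total     : ∀ x y → ¬ ¬ (x ≤ y ⊎ y ≤ x)
    zero-or-invertible : ∀ x → ¬ ¬ (x ≈ 0# ⊎ ∃[ y ] x * y ≈ 1#)
    ι-invertible : ∀ n → ∃[ y ] ι (suc n) * y ≈ 1#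
    archimedean  : ∀ x y → (∀ n → ι n * x ≤ y) → x ≤ 0#

module OrderedFieldProperties (F : OrderedField) where

  open OrderedField F
  open Sums commutativeRing public
  open Solver using (_:+_; _:*_; _:-_; :-_; _:=_) renaming (solve to solveℤ)
  open import Relation.Binary.Reasoning.Setoid setoid

  ≤-refl : ∀ {x} → x ≤ x
  ≤-refl = ≤-reflexive refl

  ≤-respʳ : ∀ {x y z} → y ≈ z → x ≤ y → x ≤ z
  ≤-respʳ y≈z x≤y = ≤-trans x≤y (≤-reflexive y≈z)

  ≤-respˡ : ∀ {x y z} → x ≈ y → x ≤ z → y ≤ z
  ≤-respˡ x≈y x≤z = ≤-trans (≤-reflexive (sym x≈y)) x≤z

  ≤-classical : ∀ {A : Set} {x y} → ¬ ¬ A → (A → x ≤ y) → x ≤ y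
  ≤-classical ¬¬A A⇒≤ = ≤-stable λ x≰y → ¬¬A λ a → x≰y (A⇒≤ a)

  ≈-classical : ∀ {A : Set} {x y} → ¬ ¬ A → (A → x ≈ y) → x ≈ y
  ≈-classical ¬¬A A⇒≈ = ≤-antisym (≤-classical ¬¬A (≤-reflexive ∘ A⇒≈))
                                  (≤-classical ¬¬A (≤-reflexive ∘ sym ∘ A⇒≈))

  ≤-cases : ∀ {x y} u v → (u ≤ v → x ≤ y) → (v ≤ u → x ≤ y) → x ≤ y
  ≤-cases u v f g = ≤-classical (≤-total u v) λ { (inj₁ p) → f p ; (inj₂ q) → g q }

  +-nonneg : ∀ {x y} → 0# ≤ x → 0# ≤ y → 0# ≤ x + y
  +-nonneg p q = ≤-respˡ (+-identityˡ 0#) (+-mono-≤ p q)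

  ≤⇒0≤- : ∀ {x y} → x ≤ y → 0# ≤ y - x
  ≤⇒0≤- {x} p = ≤-respˡ (-‿inverseʳ x) (+-mono-≤ p ≤-refl)

  0≤-⇒≤ : ∀ {x y} → 0# ≤ y - x → x ≤ y
  0≤-⇒≤ {x} {y} p = ≤-respˡ (+-identityˡ x)
    (≤-respʳ (solveℤ 2 (λ x y → (y :- x) :+ x := y) refl x y) (+-mono-≤ p ≤-refl))

  ≤-by : ∀ {x y d} → 0# ≤ d → y - x ≈ d → x ≤ y
  ≤-by 0≤d eq = 0≤-⇒≤ (≤-respʳ (sym eq) 0≤d)

  ≤0⇒0≤- : ∀ {x} → x ≤ 0# → 0# ≤ - x
  ≤0⇒0≤- p = ≤-respʳ (+-identityˡ _) (≤⇒0≤- p)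

  *-monoˡ : ∀ {x y z} → 0# ≤ z → x ≤ y → z * x ≤ z * y
  *-monoˡ {x} {y} {z} 0≤z x≤y = ≤-by (*-nonneg 0≤z (≤⇒0≤- x≤y))
    (solveℤ 3 (λ x y z → z :* y :- z :* x := z :* (y :- x)) refl x y z)

  square-nonneg : ∀ x → 0# ≤ x * x
  square-nonneg x = ≤-cases 0# x (λ p → *-nonneg p p) λ p →
    ≤-respʳ (solveℤ 1 (λ x → (:- x) :* (:- x) := x :* x) refl x) (*-nonneg (≤0⇒0≤- p) (≤0⇒0≤- p))

  0≤1 : 0# ≤ 1#
  0≤1 = ≤-respʳ (*-identityˡ 1#) (square-nonneg 1#)

  square≈0⇒≈0 : ∀ {x} → x * x ≈ 0# → x ≈ 0#
  square≈0⇒≈0 {x} xx≈0 = ≈-classical (zero-or-invertible x) λ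
    { (inj₁ x≈0) → x≈0
    ; (inj₂ (y , xy≈1)) → begin
        x           ≈⟨ *-identityʳ x ⟨
        x * 1#      ≈⟨ *-congˡ xy≈1 ⟨
        x * (x * y) ≈⟨ *-assoc x x y ⟨
        (x * x) * y ≈⟨ *-congʳ xx≈0 ⟩
        0# * y      ≈⟨ zeroˡ y ⟩
        0#          ∎ }

  cancelˡ : ∀ {x y z} → x * y ≈ 1# → x * z ≈ 0# → z ≈ 0#
  cancelˡ {x} {y} {z} xy≈1 xz≈0 = begin
    z           ≈⟨ *-identityˡ z ⟨
    1# * z      ≈⟨ *-congʳ xy≈1 ⟨
    (x * y) * z ≈⟨ solveℤ 3 (λ x y z → (x :* y) :* z := y :* (x :* z)) refl x y z ⟩
    y * (x * z) ≈⟨ *-congˡ xz≈0 ⟩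
    y * 0#      ≈⟨ zeroʳ y ⟩
    0#          ∎

  reciprocal-nonneg : ∀ {x y} → x * y ≈ 1# → 0# ≤ x → 0# ≤ y
  reciprocal-nonneg {x} {y} xy≈1 0≤x = ≤-respʳ
    (trans (solveℤ 2 (λ x y → x :* (y :* y) := (x :* y) :* y) refl x y) (trans (*-congʳ xy≈1) (*-identityˡ y)))
    (*-nonneg 0≤x (square-nonneg y))

  divide-nonneg : ∀ {x y z} → x * y ≈ 1# → 0# ≤ x → 0# ≤ x * z → 0# ≤ z
  divide-nonneg {x} {y} {z} xy≈1 0≤x 0≤xz = ≤-respʳ
    (trans (solveℤ 3 (λ x y z → y :* (x :* z) := (x :* y) :* z) refl x y z) (trans (*-congʳ xy≈1) (*-identityˡ z)))
    (*-nonneg (reciprocal-nonneg xy≈1 0≤x) 0≤xz)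

  ι-suc : ∀ n → ι (suc n) ≈ 1# + ι n
  ι-suc n = IntegerCoefficients.1+× commutativeRing n 1#

  ι-+ : ∀ m n → ι (m ℕ.+ n) ≈ ι m + ι n
  ι-+ = IntegerCoefficients.×-homo-+ commutativeRing 1#

  ι-* : ∀ m n → ι (m ℕ.* n) ≈ ι m * ι n
  ι-* = IntegerCoefficients.×1-homo-* commutativeRing

  ι-nonneg : ∀ n → 0# ≤ ι n
  ι-nonneg zero    = ≤-refl
  ι-nonneg (suc n) = ≤-respʳ (sym (ι-suc n)) (+-nonneg 0≤1 (ι-nonneg n))

  ι-divide-nonneg : ∀ n {x} → 0# ≤ ι (suc n) * x → 0# ≤ x
  ι-divide-nonneg n = divide-nonneg (proj₂ (ι-invertible n)) (ι-nonneg (suc n))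

  ∑-nonneg : ∀ {n} {f : Vector Carrier n} → (∀ i → 0# ≤ f i) → 0# ≤ ∑ f
  ∑-nonneg {zero}  {f} p = ≤-reflexive (sym (∑-empty f))
  ∑-nonneg {suc n} {f} p = ≤-respʳ (sym (∑-suc f)) (+-nonneg (p zero) (∑-nonneg (λ i → p (suc i))))

  ∑-mono : ∀ {n} {f g : Vector Carrier n} → (∀ i → f i ≤ g i) → ∑ f ≤ ∑ g
  ∑-mono {zero}  {f} {g} p = ≤-reflexive (trans (∑-empty f) (sym (∑-empty g)))
  ∑-mono {suc n} {f} {g} p = ≤-respˡ (sym (∑-suc f)) (≤-respʳ (sym (∑-suc g))
    (+-mono-≤ (p zero) (∑-mono (λ i → p (suc i)))))

  ∑-term-≤ : ∀ {n} {f : Vector Carrier n} → (∀ i → 0# ≤ f i) → ∀ i → f i ≤ ∑ f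
  ∑-term-≤ {f = f} p zero    = ≤-respʳ (sym (∑-suc f))
    (≤-respˡ (+-identityʳ _) (+-mono-≤ ≤-refl (∑-nonneg (λ i → p (suc i)))))
  ∑-term-≤ {f = f} p (suc i) = ≤-respʳ (sym (∑-suc f))
    (≤-respˡ (+-identityˡ _) (+-mono-≤ (p zero) (∑-term-≤ (λ i → p (suc i)) i)))

  ∑≈0⇒≈0 : ∀ {n} {f : Vector Carrier n} → (∀ i → 0# ≤ f i) → ∑ f ≈ 0# → ∀ i → f i ≈ 0#
  ∑≈0⇒≈0 p ∑≈0 i = ≤-antisym (≤-respʳ ∑≈0 (∑-term-≤ p i)) (p i)

-- Traces of powers

module MatrixAlgebra (F : OrderedField) where

  open OrderedField F
  open OrderedFieldProperties F
  open Solver using (_:+_; _:*_; _:=_) renaming (solve to solveℤ)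
  open import Relation.Binary.Reasoning.Setoid setoid

  private variable
    n : ℕ

  infixl 7 _⊗_

  _⊗_ : Matrix Carrier n → Matrix Carrier n → Matrix Carrier n
  (A ⊗ B) i j = ∑ λ k → A i k * B k j

  tr : Matrix Carrier n → Carrier
  tr A = ∑ λ i → A i i

  tr-cong : ∀ {A B : Matrix Carrier n} → (∀ i j → A i j ≈ B i j) → tr A ≈ tr B
  tr-cong A≈B = ∑-cong λ i → A≈B i i

  ⊗-cong : ∀ {A A′ B B′ : Matrix Carrier n} → (∀ i j → A i j ≈ A′ i j) → (∀ i j → B i j ≈ B′ i j) →
    ∀ i j → (A ⊗ B) i j ≈ (A′ ⊗ B′) i j
  ⊗-cong A≈A′ B≈B′ i j = ∑-cong λ k → *-cong (A≈A′ i k) (B≈B′ k j)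

  ⊗-assoc : ∀ (A B C : Matrix Carrier n) i j → ((A ⊗ B) ⊗ C) i j ≈ (A ⊗ (B ⊗ C)) i j
  ⊗-assoc A B C i j = begin
    ∑ (λ k → ∑ (λ l → A i l * B l k) * C k j)
      ≈⟨ ∑-cong (λ k → *-distribʳ-∑ (C k j) _) ⟩
    ∑ (λ k → ∑ (λ l → A i l * B l k * C k j))
      ≈⟨ ∑-comm (λ k l → A i l * B l k * C k j) ⟩
    ∑ (λ l → ∑ (λ k → A i l * B l k * C k j))
      ≈⟨ ∑-cong (λ l → trans (∑-cong λ k → *-assoc _ _ _) (sym (*-distribˡ-∑ (A i l) _))) ⟩
    ∑ (λ l → A i l * ∑ (λ k → B l k * C k j)) ∎

  ⊗-identityˡ : ∀ (A : Matrix Carrier n) i j → (δ ⊗ A) i j ≈ A i j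
  ⊗-identityˡ A i j = ∑-δˡ (λ k → A k j) i

  ⊗-identityʳ : ∀ (A : Matrix Carrier n) i j → (A ⊗ δ) i j ≈ A i j
  ⊗-identityʳ A i j = ∑-δʳ (A i) j

  ⊗-linearʳ : ∀ c (A B C : Matrix Carrier n) i j →
    (A ⊗ (λ k l → c * B k l + C k l)) i j ≈ c * (A ⊗ B) i j + (A ⊗ C) i j
  ⊗-linearʳ c A B C i j = trans
    (∑-cong λ k → solveℤ 4 (λ a b c d → a :* (c :* b :+ d) := c :* (a :* b) :+ a :* d) refl (A i k) (B k j) c (C k j))
    (trans (∑-distrib-+ (λ k → c * (A i k * B k j)) _) (+-congʳ (sym (*-distribˡ-∑ c _))))

  ⊗-linearˡ : ∀ c (A B C : Matrix Carrier n) i j →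
    ((λ k l → c * A k l + B k l) ⊗ C) i j ≈ c * (A ⊗ C) i j + (B ⊗ C) i j
  ⊗-linearˡ c A B C i j = trans
    (∑-cong λ k → solveℤ 4 (λ a b c d → (c :* a :+ b) :* d := c :* (a :* d) :+ b :* d) refl (A i k) (B i k) c (C k j))
    (trans (∑-distrib-+ (λ k → c * (A i k * C k j)) _) (+-congʳ (sym (*-distribˡ-∑ c _))))

  tr-linear : ∀ c (A B : Matrix Carrier n) → tr (λ i j → c * A i j + B i j) ≈ c * tr A + tr B
  tr-linear c A B = trans (∑-distrib-+ (λ i → c * A i i) _) (+-congʳ (sym (*-distribˡ-∑ c _)))

  pow : Matrix Carrier n → ℕ → Matrix Carrier n
  pow M zero    = δ
  pow M (suc N) = pow M N ⊗ M

-- Convergence along z = 1, 1/2, 1/3, …, with a rate, which makes it purely algebraic.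
module Limits (F : OrderedField) where

  open OrderedField F
  open OrderedFieldProperties F
  open DetTheory commutativeRing using (det; det-suc; det-empty; minor; sign; slope; cofactor; _[_≔_])
  open Solver using (_:+_; _:*_; _:-_; :-_; _:=_; con) renaming (solve to solveℤ)
  open import Relation.Binary.Reasoning.Setoid setoid

  h : ℕ → Carrier
  h m = proj₁ (ι-invertible m)

  ι*h≈1 : ∀ m → ι (suc m) * h m ≈ 1#
  ι*h≈1 m = proj₂ (ι-invertible m)

  -- Squares take the place of absolute values, whose definition would need a decision of the sign.
  Bounded : (ℕ → Carrier) → Set
  Bounded f = ∃[ B ] ∀ m → f m * f m ≤ B

  bounded-const : ∀ x → Bounded (λ _ → x)
  bounded-const x = x * x , λ _ → ≤-refl

  -- From (f + g)² + (f - g)² = 2 * f² + 2 * g².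
  bounded-+ : ∀ {f g} → Bounded f → Bounded g → Bounded (λ m → f m + g m)
  bounded-+ {f} {g} (B , p) (C , q) = (B + B) + (C + C) , λ m →
    ≤-by (+-nonneg (+-nonneg (≤⇒0≤- (p m)) (≤⇒0≤- (p m)))
                   (+-nonneg (+-nonneg (≤⇒0≤- (q m)) (≤⇒0≤- (q m))) (square-nonneg (f m - g m))))
      (solveℤ 4 (λ B C f g → ((B :+ B) :+ (C :+ C)) :- (f :+ g) :* (f :+ g) :=
        ((B :- f :* f) :+ (B :- f :* f)) :+ (((C :- g :* g) :+ (C :- g :* g)) :+ (f :- g) :* (f :- g)))
        refl B C (f m) (g m))

  bounded-* : ∀ {f g} → Bounded f → Bounded g → Bounded (λ m → f m * g m)
  bounded-* {f} {g} (B , p) (C , q) = B * C , λ m →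
    ≤-by (+-nonneg (*-nonneg (≤-trans (square-nonneg (f m)) (p m)) (≤⇒0≤- (q m)))
                   (*-nonneg (≤⇒0≤- (p m)) (square-nonneg (g m))))
      (solveℤ 4 (λ B C f g → B :* C :- (f :* g) :* (f :* g) :=
        B :* (C :- g :* g) :+ (B :- f :* f) :* (g :* g)) refl B C (f m) (g m))

  bounded-h : Bounded h
  bounded-h = 1# , λ m → ≤-by (h-bound m)
    (trans (+-congʳ (sym (trans (*-cong (ι*h≈1 m) (ι*h≈1 m)) (*-identityˡ 1#))))
      (trans (+-congʳ (*-cong (*-congʳ (ι-suc m)) (*-congʳ (ι-suc m))))
        (solveℤ 2 (λ k h → ((con (+ 1) :+ k) :* h) :* ((con (+ 1) :+ k) :* h) :- h :* h :=
          (k :+ k :+ k :* k) :* (h :* h)) refl (ι m) (h m))))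
    where
    h-bound : ∀ m → 0# ≤ (ι m + ι m + ι m * ι m) * (h m * h m)
    h-bound m = *-nonneg (+-nonneg (+-nonneg (ι-nonneg m) (ι-nonneg m)) (square-nonneg (ι m))) (square-nonneg (h m))

  infix 4 _⟶_

  _⟶_ : (ℕ → Carrier) → Carrier → Set
  f ⟶ l = ∃[ g ] (Bounded g × ∀ m → f m ≈ l + h m * g m)

  ⟶-const : ∀ x → (λ _ → x) ⟶ x
  ⟶-const x = (λ _ → 0#) , bounded-const 0# , λ m → sym (trans (+-congˡ (zeroʳ (h m))) (+-identityʳ x))

  ⟶-h : h ⟶ 0#
  ⟶-h = (λ _ → 1#) , bounded-const 1# , λ m → sym (trans (+-identityˡ _) (*-identityʳ (h m)))

  ⟶-cong : ∀ {f f′ l l′} → (∀ m → f m ≈ f′ m) → l ≈ l′ → f ⟶ l → f′ ⟶ l′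
  ⟶-cong f≈ l≈ (g , b , eq) = g , b , λ m → trans (sym (f≈ m)) (trans (eq m) (+-congʳ l≈))

  ⟶-+ : ∀ {f f′ l l′} → f ⟶ l → f′ ⟶ l′ → (λ m → f m + f′ m) ⟶ l + l′
  ⟶-+ {l = l} {l′} (g , b , eq) (g′ , b′ , eq′) = _ , bounded-+ b b′ , λ m → trans (+-cong (eq m) (eq′ m))
    (solveℤ 5 (λ l l′ h g g′ → (l :+ h :* g) :+ (l′ :+ h :* g′) := (l :+ l′) :+ h :* (g :+ g′))
      refl l l′ (h m) (g m) (g′ m))

  ⟶-* : ∀ {f f′ l l′} → f ⟶ l → f′ ⟶ l′ → (λ m → f m * f′ m) ⟶ l * l′
  ⟶-* {l = l} {l′} (g , b , eq) (g′ , b′ , eq′) = _ ,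
    bounded-+ (bounded-+ (bounded-* (bounded-const l) b′) (bounded-* (bounded-const l′) b))
              (bounded-* bounded-h (bounded-* b b′)) ,
    λ m → trans (*-cong (eq m) (eq′ m))
      (solveℤ 5 (λ l l′ h g g′ → (l :+ h :* g) :* (l′ :+ h :* g′) :=
        l :* l′ :+ h :* ((l :* g′ :+ l′ :* g) :+ h :* (g :* g′))) refl l l′ (h m) (g m) (g′ m))

  ⟶-neg : ∀ {f l} → f ⟶ l → (λ m → - f m) ⟶ - l
  ⟶-neg p = ⟶-cong (λ m → negate _) (negate _) (⟶-* (⟶-const (- 1#)) p)
    where
    negate : ∀ x → - 1# * x ≈ - x
    negate = solveℤ 1 (λ x → (:- con (+ 1)) :* x := :- x) refl

  ⟶-∑ : ∀ {n} {f : ℕ → Vector Carrier n} {l : Vector Carrier n} →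
    (∀ i → (λ m → f m i) ⟶ l i) → (λ m → ∑ (f m)) ⟶ ∑ l
  ⟶-∑ {zero}  p = ⟶-cong (λ m → sym (∑-empty _)) (sym (∑-empty _)) (⟶-const 0#)
  ⟶-∑ {suc n} p = ⟶-cong (λ m → sym (∑-suc _)) (sym (∑-suc _)) (⟶-+ (p zero) (⟶-∑ (λ i → p (suc i))))

  ⟶-det : ∀ {n} {A : ℕ → Matrix Carrier n} {B : Matrix Carrier n} →
    (∀ i j → (λ m → A m i j) ⟶ B i j) → (λ m → det (A m)) ⟶ det B
  ⟶-det {zero}  p = ⟶-cong (λ m → sym (det-empty _)) (sym (det-empty _)) (⟶-const 1#)
  ⟶-det {suc n} p = ⟶-cong (λ m → sym (det-suc _)) (sym (det-suc _))
    (⟶-∑ λ j → ⟶-* (⟶-* (⟶-const (sign j)) (p zero j)) (⟶-det λ i l → p (suc i) (punchIn j l)))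

  ⟶-slope : ∀ {n} {A : ℕ → Matrix Carrier n} {A∞ : Matrix Carrier n} (B Y : Matrix Carrier n) →
    (∀ i j → (λ m → A m i j) ⟶ A∞ i j) → (λ m → slope (A m) B Y) ⟶ slope A∞ B Y
  ⟶-slope {zero}  B Y p = ⟶-const 0#
  ⟶-slope {suc n} B Y p = ⟶-∑ λ j → ⟶-* (⟶-const (sign j)) (⟶-+
    (⟶-* (⟶-const (B zero j)) (⟶-det λ i l → p (suc i) (punchIn j l)))
    (⟶-* (⟶-const (Y zero j)) (⟶-slope (minor B j) (minor Y j) λ i l → p (suc i) (punchIn j l))))

  ⟶-≔ : ∀ {m n} {A : ℕ → Fin m → Vector Carrier n} {B : Fin m → Vector Carrier n} i r →
    (∀ k j → (λ a → A a k j) ⟶ B k j) → ∀ k j → (λ a → (A a [ i ≔ r ]) k j) ⟶ (B [ i ≔ r ]) k j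
  ⟶-≔ zero    r p zero    j = ⟶-const (r j)
  ⟶-≔ zero    r p (suc k) j = p (suc k) j
  ⟶-≔ (suc i) r p zero    j = p zero j
  ⟶-≔ (suc i) r p (suc k) j = ⟶-≔ i r (λ k → p (suc k)) k j

  ⟶-cofactor : ∀ {n} {A : ℕ → Matrix Carrier n} {B : Matrix Carrier n} →
    (∀ i j → (λ m → A m i j) ⟶ B i j) → ∀ i j → (λ m → cofactor (A m) i j) ⟶ cofactor B i j
  ⟶-cofactor p i j = ⟶-det (⟶-≔ i (δ j) p)

  -- Multiplying 0 = l + h m * g m by m + 1 gives g m = - (m + 1) * l. Hence m * l² ≤ (m + 1)² * l²
  -- ≤ B for all m, and `archimedean` yields l² ≤ 0.
  ⟶0-unique : ∀ {f l} → (∀ m → f m ≈ 0#) → f ⟶ l → l ≈ 0#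
  ⟶0-unique {f} {l} f≈0 (g , (B , bound) , eq) = square≈0⇒≈0 (≤-antisym
    (archimedean (l * l) B λ m → ≤-trans
      (≤-by (*-nonneg (+-nonneg (+-nonneg 0≤1 (ι-nonneg m)) (square-nonneg (ι m))) (square-nonneg l)) (solveℤ 2
        (λ k l → ((con (+ 1) :+ k) :* l) :* ((con (+ 1) :+ k) :* l) :- k :* (l :* l) :=
                 (con (+ 1) :+ k :+ k :* k) :* (l :* l)) refl (ι m) l))
      (≤-respˡ (g²≈ m) (bound m)))
    (square-nonneg l))
    where
    scaled : ∀ m → (1# + ι m) * l + g m ≈ 0#
    scaled m = begin
      (1# + ι m) * l + g m
        ≈⟨ +-cong (*-congʳ (sym (ι-suc m))) (sym (trans (*-congʳ (ι*h≈1 m)) (*-identityˡ (g m)))) ⟩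
      ι (suc m) * l + ι (suc m) * h m * g m
        ≈⟨ solveℤ 4 (λ k l h g → k :* l :+ k :* h :* g := k :* (l :+ h :* g)) refl _ l (h m) (g m) ⟩
      ι (suc m) * (l + h m * g m)
        ≈⟨ *-congˡ (trans (sym (eq m)) (f≈0 m)) ⟩
      ι (suc m) * 0#
        ≈⟨ zeroʳ _ ⟩
      0# ∎
    g²≈ : ∀ m → g m * g m ≈ ((1# + ι m) * l) * ((1# + ι m) * l)
    g²≈ m = begin
      g m * g m
        ≈⟨ solveℤ 2 (λ a g → g :* g := a :* a :+ (g :- a) :* (a :+ g)) refl ((1# + ι m) * l) (g m) ⟩
      _ + (g m - (1# + ι m) * l) * ((1# + ι m) * l + g m)
        ≈⟨ +-congˡ (trans (*-congˡ (scaled m)) (zeroʳ _)) ⟩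
      _ + 0#
        ≈⟨ +-identityʳ _ ⟩
      _ ∎

  ⟶-unique : ∀ {f f′ l l′} → (∀ m → f m ≈ f′ m) → f ⟶ l → f′ ⟶ l′ → l ≈ l′
  ⟶-unique {f} {f′} {l} {l′} f≈f′ p q = begin
    l               ≈⟨ solveℤ 2 (λ a b → a := b :+ (a :- b)) refl l l′ ⟩
    l′ + (l - l′)   ≈⟨ +-congˡ (⟶0-unique (λ m → trans (+-congʳ (f≈f′ m)) (-‿inverseʳ _)) (⟶-+ p (⟶-neg q))) ⟩
    l′ + 0#         ≈⟨ +-identityʳ l′ ⟩
    l′              ∎

-- Equal characteristic polynomials give equal traces of powers

module TraceFormula (F : OrderedField) where

  open OrderedField F
  open OrderedFieldProperties F
  open DetTheory commutativeRing
  open MatrixAlgebra F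
  open Limits F
  open import Algebra.Definitions.RawSemiring (Semiring.rawSemiring semiring) using (_^_; product)
  open Solver using (_:+_; _:*_; _:-_; :-_; _:=_; con) renaming (solve to solveℤ)
  open import Relation.Binary.Reasoning.Setoid setoid

  adj : ∀ {n} → Matrix Carrier n → Matrix Carrier n
  adj A i j = cofactor A j i

  -- The reversed characteristic matrix 1 - z M tends to the identity as z tends to 0, so traces can
  -- be read off there.
  pencil : ∀ {n} → Carrier → Matrix Carrier n → Matrix Carrier n
  pencil z M i j = δ i j - z * M i j

  module _ {n} (M : Matrix Carrier n) where

    -- A rearrangement of (1 - z M) * adj (1 - z M) = det (1 - z M).
    adj-recurrence : ∀ z k i →
      adj (pencil z M) k i ≈ det (pencil z M) * δ k i + z * (M ⊗ adj (pencil z M)) k i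
    adj-recurrence z k i = begin
      C k i
        ≈⟨ solveℤ 2 (λ a b → a := (a :- b) :+ b) refl (C k i) (z * (M ⊗ C) k i) ⟩
      C k i - z * (M ⊗ C) k i + z * (M ⊗ C) k i
        ≈⟨ +-congʳ expand ⟨
      ∑ (λ j → pencil z M k j * C j i) + z * (M ⊗ C) k i
        ≈⟨ +-congʳ (trans (cofactor-inverse (pencil z M) k i) (*-comm _ _)) ⟩
      det (pencil z M) * δ k i + z * (M ⊗ C) k i ∎
      where
      C = adj (pencil z M)
      expand : ∑ (λ j → pencil z M k j * C j i) ≈ C k i - z * (M ⊗ C) k i
      expand = begin
        ∑ (λ j → (δ k j - z * M k j) * C j i)
          ≈⟨ ∑-cong (λ j → solveℤ 4 (λ d z m c → (d :- z :* m) :* c := d :* c :+ (:- z) :* (m :* c)) refl (δ k j) z (M k j) (C j i)) ⟩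
        ∑ (λ j → δ k j * C j i + (- z) * (M k j * C j i))
          ≈⟨ ∑-distrib-+ (λ j → δ k j * C j i) _ ⟩
        ∑ (λ j → δ k j * C j i) + ∑ (λ j → (- z) * (M k j * C j i))
          ≈⟨ +-cong (∑-δˡ (λ j → C j i) k) (sym (*-distribˡ-∑ (- z) _)) ⟩
        C k i + (- z) * (M ⊗ C) k i
          ≈⟨ solveℤ 3 (λ c z m → c :+ (:- z) :* m := c :- z :* m) refl (C k i) z _ ⟩
        C k i - z * (M ⊗ C) k i ∎

    -- Formally det (1 - z M) times the power series in z with coefficients tr Mᴺ⁺¹, tr Mᴺ⁺², and so
    -- on. The recurrence splits off its first term.
    powerTrace : ℕ → Carrier → Carrier
    powerTrace N z = tr (pow M (suc N) ⊗ adj (pencil z M))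

    powerTrace-recurrence : ∀ N z →
      powerTrace N z ≈ det (pencil z M) * tr (pow M (suc N)) + z * powerTrace (suc N) z
    powerTrace-recurrence N z = begin
      tr (A ⊗ C)
        ≈⟨ tr-cong (⊗-cong (λ i j → refl) (adj-recurrence z)) ⟩
      tr (A ⊗ (λ k i → det (pencil z M) * δ k i + z * (M ⊗ C) k i))
        ≈⟨ tr-cong (⊗-linearʳ (det (pencil z M)) A δ (λ k i → z * (M ⊗ C) k i)) ⟩
      tr (λ k i → det (pencil z M) * (A ⊗ δ) k i + (A ⊗ (λ k i → z * (M ⊗ C) k i)) k i)
        ≈⟨ tr-linear (det (pencil z M)) (A ⊗ δ) (A ⊗ (λ k i → z * (M ⊗ C) k i)) ⟩
      det (pencil z M) * tr (A ⊗ δ) + tr (A ⊗ (λ k i → z * (M ⊗ C) k i))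
        ≈⟨ +-cong (*-congˡ (tr-cong (⊗-identityʳ A))) scale ⟩
      det (pencil z M) * tr A + z * tr ((A ⊗ M) ⊗ C) ∎
      where
      A = pow M (suc N)
      C = adj (pencil z M)
      scale : tr (A ⊗ (λ k i → z * (M ⊗ C) k i)) ≈ z * tr ((A ⊗ M) ⊗ C)
      scale = begin
        ∑ (λ i → ∑ (λ k → A i k * (z * (M ⊗ C) k i)))
          ≈⟨ ∑-cong (λ i → trans (∑-cong λ k → solveℤ 3 (λ a z m → a :* (z :* m) := z :* (a :* m)) refl (A i k) z _)
                                 (sym (*-distribˡ-∑ z _))) ⟩
        ∑ (λ i → z * (A ⊗ (M ⊗ C)) i i)
          ≈⟨ *-distribˡ-∑ z _ ⟨
        z * tr (A ⊗ (M ⊗ C))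
          ≈⟨ *-congˡ (tr-cong λ i j → sym (⊗-assoc A M C i j)) ⟩
        z * tr ((A ⊗ M) ⊗ C) ∎

    -- The left side is minus the derivative of det (1 - z M) in z; Jacobi's formula turns it into a
    -- trace.
    powerTrace-zero : ∀ z → slope (pencil z M) M (pencil z M) ≈ powerTrace 0 z
    powerTrace-zero z = trans (slope-cofactor M (pencil z M))
      (tr-cong {B = pow M 1 ⊗ adj (pencil z M)}
        (λ i j → sym (⊗-cong {B = adj (pencil z M)} (⊗-identityˡ M) (λ _ _ → refl) i j)))

    ⟶-pencil : ∀ {f z} → f ⟶ z → ∀ i j → (λ m → pencil (f m) M i j) ⟶ pencil z M i j
    ⟶-pencil p i j = ⟶-+ (⟶-const (δ i j)) (⟶-neg (⟶-* p (⟶-const (M i j))))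

    ⟶-powerTrace : ∀ N {f z} → f ⟶ z → (λ m → powerTrace N (f m)) ⟶ powerTrace N z
    ⟶-powerTrace N p = ⟶-∑ λ i → ⟶-∑ λ k → ⟶-* (⟶-const _) (⟶-cofactor (⟶-pencil p) i k)

    det-pencil-slope : ∀ z e →
      det (pencil (z + e) M) ≈ det (pencil z M) + (- e) * slope (pencil (z + e) M) M (pencil z M)
    det-pencil-slope z e = det-slope (- e) (pencil (z + e) M) M (pencil z M) λ i j →
      solveℤ 4 (λ d z e m → d :- (z :+ e) :* m := (d :- z :* m) :+ (:- e) :* m) refl (δ i j) z e (M i j)

    det-pencil-0 : det (pencil 0# M) ≈ 1#
    det-pencil-0 = trans (det-cong {N = diagonal (λ _ → 1#)}
      (λ i j → trans (+-congˡ (trans (-‿cong (zeroˡ (M i j))) (solveℤ 0 (:- con (+ 0) := con (+ 0)) refl))) (+-identityʳ (δ i j))))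
      (trans (det-diagonal (λ _ → 1#)) (ones n))
      where
      ones : ∀ n → product {n} (λ _ → 1#) ≈ 1#
      ones zero    = refl
      ones (suc n) = trans (*-identityˡ _) (ones n)

    det-pencil-reverse : ∀ z w → z * w ≈ 1# → det (pencil z M) ≈ z ^ n * det (λ i j → w * δ i j - M i j)
    det-pencil-reverse z w zw≈1 = trans
      (det-cong λ i j → sym (trans
        (solveℤ 4 (λ z w d m → z :* (w :* d :- m) := (z :* w) :* d :- z :* m) refl z w (δ i j) (M i j))
        (+-congʳ (trans (*-congʳ zw≈1) (*-identityˡ _)))))
      (det-scale z (λ i j → w * δ i j - M i j))

  module _ {n} (L D : Matrix Carrier n)
    (same : ∀ x → det (λ i j → x * δ i j - L i j) ≈ det (λ i j → x * δ i j - D i j)) where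

    same-pencil : ∀ z w → z * w ≈ 1# → det (pencil z L) ≈ det (pencil z D)
    same-pencil z w zw≈1 = trans (det-pencil-reverse L z w zw≈1)
      (trans (*-congˡ (same w)) (sym (det-pencil-reverse D z w zw≈1)))

    h*ι≈1 : ∀ m → h m * ι (suc m) ≈ 1#
    h*ι≈1 m = trans (*-comm _ _) (ι*h≈1 m)

    -- The inverse of 1 / a + 1 / b is a * b / (a + b), with a = j + 1 and b = m + 1. It is needed
    -- because `same-pencil` only speaks about invertible points.
    h+h-invertible : ∀ j m → ∃[ w ] (h j + h m) * w ≈ 1#
    h+h-invertible j m = ι (suc j) * ι (suc m) * h (j ℕ.+ suc m) , (begin
      (h j + h m) * (ι (suc j) * ι (suc m) * h (j ℕ.+ suc m))
        ≈⟨ solveℤ 5 (λ a b c d r → (a :+ b) :* (c :* d :* r) := ((c :* a) :* d :+ (d :* b) :* c) :* r) refl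
             (h j) (h m) (ι (suc j)) (ι (suc m)) _ ⟩
      (ι (suc j) * h j * ι (suc m) + ι (suc m) * h m * ι (suc j)) * h (j ℕ.+ suc m)
        ≈⟨ *-congʳ (+-cong (trans (*-congʳ (ι*h≈1 j)) (*-identityˡ _)) (trans (*-congʳ (ι*h≈1 m)) (*-identityˡ _))) ⟩
      (ι (suc m) + ι (suc j)) * h (j ℕ.+ suc m)
        ≈⟨ *-congʳ (trans (+-comm _ _) (sym (ι-+ (suc j) (suc m)))) ⟩
      ι (suc (j ℕ.+ suc m)) * h (j ℕ.+ suc m)
        ≈⟨ ι*h≈1 (j ℕ.+ suc m) ⟩
      1# ∎)

    -- The determinants agree at `h j` and at `h j + h m`, hence so do the difference quotients,
    -- after cancelling `h m`.
    same-slope : ∀ j m → slope (pencil (h j + h m) L) L (pencil (h j) L)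
                       ≈ slope (pencil (h j + h m) D) D (pencil (h j) D)
    same-slope j m = cancel (trans (sym (det-pencil-slope L (h j) (h m)))
      (trans (let w , inv = h+h-invertible j m in same-pencil (h j + h m) w inv)
        (trans (det-pencil-slope D (h j) (h m)) (+-congʳ (sym (same-pencil (h j) _ (h*ι≈1 j)))))))
      where
      cancel : ∀ {d x y} → d + (- h m) * x ≈ d + (- h m) * y → x ≈ y
      cancel {d} {x} {y} eq = begin
        x           ≈⟨ solveℤ 2 (λ x y → x := y :+ (x :- y)) refl x y ⟩
        y + (x - y) ≈⟨ +-congˡ (cancelˡ (h*ι≈1 m) (trans
                         (solveℤ 4 (λ d h x y → h :* (x :- y) := (d :+ (:- h) :* y) :- (d :+ (:- h) :* x)) refl d (h m) x y)
                         (trans (+-congʳ (sym eq)) (-‿inverseʳ _)))) ⟩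
        y + 0#      ≈⟨ +-identityʳ y ⟩
        y           ∎

    -- As m grows, the difference quotients from `same-slope` tend to the derivatives at `h j`, and
    -- limits are unique.
    same-powerTrace-zero : ∀ j → powerTrace L 0 (h j) ≈ powerTrace D 0 (h j)
    same-powerTrace-zero j = trans (sym (powerTrace-zero L (h j))) (trans
      (⟶-unique (same-slope j) (limit L) (limit D)) (powerTrace-zero D (h j)))
      where
      approach : (λ m → h j + h m) ⟶ h j
      approach = ⟶-cong (λ m → refl) (+-identityʳ (h j)) (⟶-+ (⟶-const (h j)) ⟶-h)
      limit : ∀ M → (λ m → slope (pencil (h j + h m) M) M (pencil (h j) M)) ⟶ slope (pencil (h j) M) M (pencil (h j) M)
      limit M = ⟶-slope M (pencil (h j) M) (⟶-pencil M approach)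

    -- Compare the two sides of powerTrace-recurrence as z = h m tends to 0,
    -- then cancel the factor z in what is left.
    same-trace-step : ∀ N → (∀ j → powerTrace L N (h j) ≈ powerTrace D N (h j)) →
      tr (pow L (suc N)) ≈ tr (pow D (suc N)) ×
      (∀ j → powerTrace L (suc N) (h j) ≈ powerTrace D (suc N) (h j))
    same-trace-step N same-N = same-tr , λ j → cancel j (begin
        det (pencil (h j) D) * tr (pow D (suc N)) + h j * powerTrace L (suc N) (h j)
          ≈⟨ +-congʳ (*-cong (same-pencil (h j) _ (h*ι≈1 j)) same-tr) ⟨
        det (pencil (h j) L) * tr (pow L (suc N)) + h j * powerTrace L (suc N) (h j)
          ≈⟨ both j ⟩
        det (pencil (h j) D) * tr (pow D (suc N)) + h j * powerTrace D (suc N) (h j) ∎)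
      where
      side : Matrix Carrier n → Carrier → Carrier
      side M z = det (pencil z M) * tr (pow M (suc N)) + z * powerTrace M (suc N) z
      both : ∀ j → side L (h j) ≈ side D (h j)
      both j = trans (sym (powerTrace-recurrence L N (h j))) (trans (same-N j) (powerTrace-recurrence D N (h j)))
      limit : ∀ M → (λ m → side M (h m)) ⟶ side M 0#
      limit M = ⟶-+ (⟶-* (⟶-det (⟶-pencil M ⟶-h)) (⟶-const _)) (⟶-* ⟶-h (⟶-powerTrace M (suc N) ⟶-h))
      side-0 : ∀ M → side M 0# ≈ tr (pow M (suc N))
      side-0 M = trans (+-cong (trans (*-congʳ (det-pencil-0 M)) (*-identityˡ _)) (zeroˡ _)) (+-identityʳ _)
      same-tr : tr (pow L (suc N)) ≈ tr (pow D (suc N))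
      same-tr = trans (sym (side-0 L)) (trans (⟶-unique both (limit L) (limit D)) (side-0 D))
      cancel : ∀ j {d x y} → d + h j * x ≈ d + h j * y → x ≈ y
      cancel j {d} {x} {y} eq = begin
        x           ≈⟨ solveℤ 2 (λ x y → x := y :+ (x :- y)) refl x y ⟩
        y + (x - y) ≈⟨ +-congˡ (cancelˡ (h*ι≈1 j) (trans
                         (solveℤ 4 (λ d h x y → h :* (x :- y) := (d :+ h :* x) :- (d :+ h :* y)) refl d (h j) x y)
                         (trans (+-congʳ eq) (-‿inverseʳ _)))) ⟩
        y + 0#      ≈⟨ +-identityʳ y ⟩
        y           ∎

    same-powerTrace : ∀ N j → powerTrace L N (h j) ≈ powerTrace D N (h j)
    same-powerTrace zero    = same-powerTrace-zero
    same-powerTrace (suc N) = proj₂ (same-trace-step N (same-powerTrace N))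

    same-trace : ∀ N → tr (pow L N) ≈ tr (pow D N)
    same-trace zero    = refl
    same-trace (suc N) = proj₁ (same-trace-step N (same-powerTrace N))

-- Spectral projections

-- Finitely many undecidable alternatives, such as the comparisons between all eigenvalues, can thus
-- be assumed settled together before anything is constructed from them.
¬¬-∀ : ∀ {n} {P : Fin n → Set} → (∀ i → ¬ ¬ P i) → ¬ ¬ (∀ i → P i)
¬¬-∀ {zero}  p ¬∀ = ¬∀ λ ()
¬¬-∀ {suc n} p ¬∀ = p zero λ p₀ → ¬¬-∀ (λ i → p (suc i)) λ ps →
  ¬∀ λ { zero → p₀ ; (suc i) → ps i }

-- Interpolation, and polynomials evaluated at a matrix

module Polynomials (F : OrderedField) where

  open import Data.List.Base using (List; []; _∷_; map)
  open OrderedField F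
  open OrderedFieldProperties F
  open MatrixAlgebra F
  open import Algebra.Definitions.RawSemiring (Semiring.rawSemiring semiring) using (_^_)
  open Solver using (_:+_; _:*_; _:-_; :-_; _:=_; con) renaming (solve to solveℤ)
  open import Relation.Binary.Reasoning.Setoid setoid

  -- Coefficient lists, constant term first.
  Poly : Set
  Poly = List Carrier

  infixl 6 _+ₚ_
  infixl 7 _·ₚ_ _*ₚ_

  _+ₚ_ : Poly → Poly → Poly
  []      +ₚ q       = q
  (c ∷ p) +ₚ []      = c ∷ p
  (c ∷ p) +ₚ (d ∷ q) = c + d ∷ p +ₚ q

  _·ₚ_ : Carrier → Poly → Poly
  c ·ₚ p = map (c *_) p

  _*ₚ_ : Poly → Poly → Poly
  []      *ₚ q = []
  (c ∷ p) *ₚ q = c ·ₚ q +ₚ (0# ∷ p *ₚ q)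

  eval : Poly → Carrier → Carrier
  eval []      x = 0#
  eval (c ∷ p) x = c + x * eval p x

  eval-+ : ∀ p q x → eval (p +ₚ q) x ≈ eval p x + eval q x
  eval-+ []      q       x = sym (+-identityˡ _)
  eval-+ (c ∷ p) []      x = sym (+-identityʳ _)
  eval-+ (c ∷ p) (d ∷ q) x = trans (+-congˡ (*-congˡ (eval-+ p q x)))
    (solveℤ 5 (λ c d x a b → (c :+ d) :+ x :* (a :+ b) := (c :+ x :* a) :+ (d :+ x :* b)) refl
      c d x (eval p x) (eval q x))

  eval-· : ∀ c p x → eval (c ·ₚ p) x ≈ c * eval p x
  eval-· c []      x = sym (zeroʳ c)
  eval-· c (d ∷ p) x = trans (+-congˡ (*-congˡ (eval-· c p x)))
    (solveℤ 4 (λ c d x a → c :* d :+ x :* (c :* a) := c :* (d :+ x :* a)) refl c d x (eval p x))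

  eval-* : ∀ p q x → eval (p *ₚ q) x ≈ eval p x * eval q x
  eval-* []      q x = sym (zeroˡ _)
  eval-* (c ∷ p) q x = trans (eval-+ (c ·ₚ q) (0# ∷ p *ₚ q) x)
    (trans (+-cong (eval-· c q x) (trans (+-identityˡ _) (*-congˡ (eval-* p q x))))
      (solveℤ 4 (λ c x a b → c :* b :+ x :* (a :* b) := (c :+ x :* a) :* b) refl c x (eval p x) (eval q x)))

  eval-cong : ∀ p {x y} → x ≈ y → eval p x ≈ eval p y
  eval-cong []      x≈y = refl
  eval-cong (c ∷ p) x≈y = +-congˡ (*-cong x≈y (eval-cong p x≈y))

  Apart : Carrier → Carrier → Set
  Apart x y = ∃[ z ] (x - y) * z ≈ 1#

  Compared : Carrier → Carrier → Set
  Compared x y = x ≈ y ⊎ Apart x y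

  compare : ∀ x y → ¬ ¬ Compared x y
  compare x y ¬cmp = zero-or-invertible (x - y) λ
    { (inj₁ x-y≈0) → ¬cmp (inj₁ (trans (solveℤ 2 (λ x y → x := (x :- y) :+ y) refl x y)
                                       (trans (+-congʳ x-y≈0) (+-identityˡ y))))
    ; (inj₂ apart) → ¬cmp (inj₂ apart) }

  -- If `a` differs from every node, `q` is the product of the factors x - ν j; its value at `a` is
  -- invertible because each factor is.
  separate : ∀ {n} (ν : Vector Carrier n) a → (∀ j → Compared a (ν j)) →
    (∃[ j ] a ≈ ν j) ⊎ (∃[ q ] ((∀ j → eval q (ν j) ≈ 0#) × ∃[ z ] eval q a * z ≈ 1#))
  separate {zero}  ν a cmp = inj₂ (1# ∷ [] , (λ ()) , 1# ,
    solveℤ 1 (λ a → (con (+ 1) :+ a :* con (+ 0)) :* con (+ 1) := con (+ 1)) refl a)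
  separate {suc n} ν a cmp with cmp zero | separate (ν ∘ suc) a (cmp ∘ suc)
  ... | inj₁ eq         | _ = inj₁ (zero , eq)
  ... | inj₂ _          | inj₁ (j , eq) = inj₁ (suc j , eq)
  ... | inj₂ (z₀ , inv₀) | inj₂ (q , roots , z , inv) = inj₂
    ( r
    , (λ { zero → trans (eval-r (ν zero)) (trans (*-congʳ (-‿inverseʳ _)) (zeroˡ _))
         ; (suc j) → trans (eval-r (ν (suc j))) (trans (*-congˡ (roots j)) (zeroʳ _)) })
    , z₀ * z
    , trans (*-congʳ (eval-r a)) (trans
        (solveℤ 4 (λ s q z₀ z → (s :* q) :* (z₀ :* z) := (s :* z₀) :* (q :* z)) refl (a - ν zero) (eval q a) z₀ z)
        (trans (*-cong inv₀ inv) (*-identityˡ 1#))) )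
    where
    r = (- ν zero ∷ 1# ∷ []) *ₚ q
    eval-r : ∀ x → eval r x ≈ (x - ν zero) * eval q x
    eval-r x = trans (eval-* (- ν zero ∷ 1# ∷ []) q x) (*-congʳ
      (solveℤ 2 (λ x m → :- m :+ x :* (con (+ 1) :+ x :* con (+ 0)) := x :- m) refl x (ν zero)))

  -- Newton's scheme: a new node is fitted by adding a multiple of the polynomial that vanishes at
  -- the others, and a repeated node is already fitted by compatibility.
  interpolate : ∀ {n} (ν v : Vector Carrier n) → (∀ i j → Compared (ν i) (ν j)) →
    (∀ i j → ν i ≈ ν j → v i ≈ v j) → ∃[ p ] (∀ i → eval p (ν i) ≈ v i)
  interpolate {zero}  ν v cmp compat = [] , λ ()
  interpolate {suc n} ν v cmp compat
    with interpolate (ν ∘ suc) (v ∘ suc) (λ i j → cmp (suc i) (suc j)) (λ i j → compat (suc i) (suc j))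
       | separate (ν ∘ suc) (ν zero) (cmp zero ∘ suc)
  ... | p , fits | inj₁ (j , eq) = p , λ
    { zero → trans (eval-cong p eq) (trans (fits j) (sym (compat zero (suc j) eq)))
    ; (suc i) → fits i }
  ... | p , fits | inj₂ (q , roots , z , inv) = p +ₚ c ·ₚ q , λ
    { zero → trans (eval-p+cq (ν zero)) (trans
        (solveℤ 4 (λ e v z q → e :+ ((v :- e) :* z) :* q := e :+ (v :- e) :* (q :* z)) refl (eval p (ν zero)) (v zero) z (eval q (ν zero)))
        (trans (+-congˡ (trans (*-congˡ inv) (*-identityʳ _))) (solveℤ 2 (λ e v → e :+ (v :- e) := v) refl (eval p (ν zero)) (v zero))))
    ; (suc i) → trans (eval-p+cq (ν (suc i))) (trans (+-cong (fits i) (trans (*-congˡ (roots i)) (zeroʳ c))) (+-identityʳ _)) }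
    where
    c = (v zero - eval p (ν zero)) * z
    eval-p+cq : ∀ x → eval (p +ₚ c ·ₚ q) x ≈ eval p x + c * eval q x
    eval-p+cq x = trans (eval-+ p (c ·ₚ q) x) (+-congˡ (eval-· c q x))

  module _ {n} (L : Matrix Carrier n) where

    evalM : Poly → Matrix Carrier n
    evalM []      i j = 0#
    evalM (c ∷ p) i j = c * δ i j + (L ⊗ evalM p) i j

    evalM-+ : ∀ p q i j → evalM (p +ₚ q) i j ≈ evalM p i j + evalM q i j
    evalM-+ []      q       i j = sym (+-identityˡ _)
    evalM-+ (c ∷ p) []      i j = sym (+-identityʳ _)
    evalM-+ (c ∷ p) (d ∷ q) i j = begin
      (c + d) * δ i j + (L ⊗ evalM (p +ₚ q)) i j
        ≈⟨ +-congˡ (trans (∑-cong λ k → trans (*-congˡ (evalM-+ p q k j)) (distribˡ _ _ _)) (∑-distrib-+ (λ k → L i k * evalM p k j) _)) ⟩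
      (c + d) * δ i j + ((L ⊗ evalM p) i j + (L ⊗ evalM q) i j)
        ≈⟨ solveℤ 5 (λ c d e a b → (c :+ d) :* e :+ (a :+ b) := (c :* e :+ a) :+ (d :* e :+ b)) refl c d (δ i j) _ _ ⟩
      (c * δ i j + (L ⊗ evalM p) i j) + (d * δ i j + (L ⊗ evalM q) i j) ∎

    evalM-· : ∀ c p i j → evalM (c ·ₚ p) i j ≈ c * evalM p i j
    evalM-· c []      i j = sym (zeroʳ c)
    evalM-· c (d ∷ p) i j = begin
      (c * d) * δ i j + (L ⊗ evalM (c ·ₚ p)) i j
        ≈⟨ +-congˡ (trans (∑-cong λ k → trans (*-congˡ (evalM-· c p k j))
             (solveℤ 3 (λ l c e → l :* (c :* e) := c :* (l :* e)) refl (L i k) c _)) (sym (*-distribˡ-∑ c _))) ⟩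
      (c * d) * δ i j + c * (L ⊗ evalM p) i j
        ≈⟨ solveℤ 4 (λ c d e a → (c :* d) :* e :+ c :* a := c :* (d :* e :+ a)) refl c d (δ i j) _ ⟩
      c * (d * δ i j + (L ⊗ evalM p) i j) ∎

    evalM-* : ∀ p q i j → evalM (p *ₚ q) i j ≈ (evalM p ⊗ evalM q) i j
    evalM-* []      q i j = sym (∑-0 λ k → zeroˡ _)
    evalM-* (c ∷ p) q i j = begin
      evalM (c ·ₚ q +ₚ (0# ∷ p *ₚ q)) i j
        ≈⟨ evalM-+ (c ·ₚ q) (0# ∷ p *ₚ q) i j ⟩
      evalM (c ·ₚ q) i j + (0# * δ i j + (L ⊗ evalM (p *ₚ q)) i j)
        ≈⟨ +-cong (trans (evalM-· c q i j) (*-congˡ (sym (⊗-identityˡ (evalM q) i j))))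
             (trans (+-congʳ (zeroˡ _)) (trans (+-identityˡ _)
               (trans (⊗-cong {A = L} (λ _ _ → refl) (evalM-* p q) i j) (sym (⊗-assoc L (evalM p) (evalM q) i j))))) ⟩
      c * (δ ⊗ evalM q) i j + ((L ⊗ evalM p) ⊗ evalM q) i j
        ≈⟨ ⊗-linearˡ c δ (L ⊗ evalM p) (evalM q) i j ⟨
      (evalM (c ∷ p) ⊗ evalM q) i j ∎

    evalM-commute : ∀ p i j → (L ⊗ evalM p) i j ≈ (evalM p ⊗ L) i j
    evalM-commute []      i j = trans (∑-0 λ k → zeroʳ _) (sym (∑-0 λ k → zeroˡ _))
    evalM-commute (c ∷ p) i j = begin
      (L ⊗ (λ k l → c * δ k l + (L ⊗ evalM p) k l)) i j
        ≈⟨ ⊗-linearʳ c L δ (L ⊗ evalM p) i j ⟩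
      c * (L ⊗ δ) i j + (L ⊗ (L ⊗ evalM p)) i j
        ≈⟨ +-cong (*-congˡ (trans (⊗-identityʳ L i j) (sym (⊗-identityˡ L i j))))
             (trans (⊗-cong {A = L} (λ _ _ → refl) (evalM-commute p) i j) (sym (⊗-assoc L (evalM p) L i j))) ⟩
      c * (δ ⊗ L) i j + ((L ⊗ evalM p) ⊗ L) i j
        ≈⟨ ⊗-linearˡ c δ (L ⊗ evalM p) L i j ⟨
      (evalM (c ∷ p) ⊗ L) i j ∎

    module _ (L-sym : ∀ i j → L i j ≈ L j i) where

      evalM-sym : ∀ p i j → evalM p i j ≈ evalM p j i
      evalM-sym []      i j = refl
      evalM-sym (c ∷ p) i j = +-cong (*-congˡ (reflexive (δ-sym i j))) (begin
        (L ⊗ evalM p) i j ≈⟨ ∑-cong (λ k → trans (*-cong (L-sym i k) (evalM-sym p k j)) (*-comm _ _)) ⟩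
        (evalM p ⊗ L) j i ≈⟨ evalM-commute p j i ⟨
        (L ⊗ evalM p) j i ∎)

      evalM-square : ∀ p i → (evalM p ⊗ evalM p) i i ≈ ∑ (λ j → evalM p i j * evalM p i j)
      evalM-square p i = ∑-cong λ j → *-congˡ (evalM-sym p j i)

    module _ (μ : Vector Carrier n) (moments : ∀ N → tr (pow L N) ≈ ∑ (λ i → μ i ^ N)) where

      -- The power in front makes the induction on `p` work: each Horner step passes one factor `L`
      -- from the polynomial to it.
      tr-pow-eval : ∀ N p → tr (pow L N ⊗ evalM p) ≈ ∑ (λ i → μ i ^ N * eval p (μ i))
      tr-pow-eval N []      = trans (∑-0 λ i → ∑-0 λ k → zeroʳ _) (sym (∑-0 λ i → zeroʳ _))
      tr-pow-eval N (c ∷ p) = begin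
        tr (pow L N ⊗ evalM (c ∷ p))
          ≈⟨ tr-cong (⊗-linearʳ c (pow L N) δ (L ⊗ evalM p)) ⟩
        tr (λ i j → c * (pow L N ⊗ δ) i j + (pow L N ⊗ (L ⊗ evalM p)) i j)
          ≈⟨ tr-linear c (pow L N ⊗ δ) (pow L N ⊗ (L ⊗ evalM p)) ⟩
        c * tr (pow L N ⊗ δ) + tr (pow L N ⊗ (L ⊗ evalM p))
          ≈⟨ +-cong (*-congˡ (trans (tr-cong (⊗-identityʳ (pow L N))) (moments N)))
               (trans (tr-cong λ i j → sym (⊗-assoc (pow L N) L (evalM p) i j)) (tr-pow-eval (suc N) p)) ⟩
        c * ∑ (λ i → μ i ^ N) + ∑ (λ i → μ i ^ suc N * eval p (μ i))
          ≈⟨ trans (+-congʳ (*-distribˡ-∑ c _)) (sym (∑-distrib-+ (λ i → c * μ i ^ N) _)) ⟩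
        ∑ (λ i → c * μ i ^ N + μ i ^ suc N * eval p (μ i))
          ≈⟨ ∑-cong (λ i → solveℤ 4 (λ c m x e → c :* m :+ (x :* m) :* e := m :* (c :+ x :* e)) refl c (μ i ^ N) (μ i) (eval p (μ i))) ⟩
        ∑ (λ i → μ i ^ N * eval (c ∷ p) (μ i)) ∎

      tr-eval : ∀ p → tr (evalM p) ≈ ∑ (λ i → eval p (μ i))
      tr-eval p = trans (tr-cong λ i j → sym (⊗-identityˡ (evalM p) i j))
        (trans (tr-pow-eval 0 p) (∑-cong λ i → *-identityˡ _))

      tr-L-eval : ∀ p → tr (L ⊗ evalM p) ≈ ∑ (λ i → μ i * eval p (μ i))
      tr-L-eval p = trans (tr-cong (⊗-cong {B = evalM p} (λ i j → sym (⊗-identityˡ L i j)) (λ _ _ → refl)))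
        (trans (tr-pow-eval 1 p) (∑-cong λ i → *-congʳ (*-identityʳ _)))

      -- A symmetric matrix vanishes as soon as the trace of its square does.
      evalM-vanish : (∀ i j → L i j ≈ L j i) → ∀ p → (∀ i → eval p (μ i) ≈ 0#) → ∀ i j → evalM p i j ≈ 0#
      evalM-vanish L-sym p p≈0 i j = square≈0⇒≈0 (∑≈0⇒≈0 (λ j → square-nonneg _)
        (∑≈0⇒≈0 (λ i → ∑-nonneg λ j → square-nonneg (evalM p i j)) total i) j)
        where
        total : ∑ (λ i → ∑ (λ j → evalM p i j * evalM p i j)) ≈ 0#
        total = begin
          ∑ (λ i → ∑ (λ j → evalM p i j * evalM p i j))
            ≈⟨ ∑-cong (λ i → evalM-square L-sym p i) ⟨
          tr (evalM p ⊗ evalM p)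
            ≈⟨ tr-cong (evalM-* p p) ⟨
          tr (evalM (p *ₚ p))
            ≈⟨ tr-eval (p *ₚ p) ⟩
          ∑ (λ i → eval (p *ₚ p) (μ i))
            ≈⟨ ∑-0 (λ i → trans (eval-* p p (μ i)) (trans (*-congʳ (p≈0 i)) (zeroˡ _))) ⟩
          0# ∎

      -- The difference of the polynomials vanishes on the spectrum. In this way, matrix identities
      -- such as idempotence are reduced to identities between numbers.
      evalM-agree : (∀ i j → L i j ≈ L j i) → ∀ p q → (∀ i → eval p (μ i) ≈ eval q (μ i)) →
        ∀ i j → evalM p i j ≈ evalM q i j
      evalM-agree L-sym p q p≈q i j = begin
        evalM p i j
          ≈⟨ solveℤ 2 (λ a b → a := (a :+ :- con (+ 1) :* b) :+ b) refl (evalM p i j) (evalM q i j) ⟩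
        (evalM p i j + - 1# * evalM q i j) + evalM q i j
          ≈⟨ +-congʳ (trans (evalM-+ p (- 1# ·ₚ q) i j) (+-congˡ (evalM-· (- 1#) q i j))) ⟨
        evalM (p +ₚ - 1# ·ₚ q) i j + evalM q i j
          ≈⟨ +-congʳ (evalM-vanish L-sym (p +ₚ - 1# ·ₚ q) difference i j) ⟩
        0# + evalM q i j
          ≈⟨ +-identityˡ _ ⟩
        evalM q i j ∎
        where
        difference : ∀ i → eval (p +ₚ - 1# ·ₚ q) (μ i) ≈ 0#
        difference i = trans (eval-+ p (- 1# ·ₚ q) (μ i)) (trans (+-cong (p≈q i) (eval-· (- 1#) q (μ i)))
          (solveℤ 1 (λ a → a :+ :- con (+ 1) :* a := con (+ 0)) refl (eval q (μ i))))

-- The properties of the orthogonal projection onto a κ-dimensional space that survive taking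
-- convex combinations.
record Density (F : OrderedField) {n} (κ : OrderedField.Carrier F) (P : Matrix (OrderedField.Carrier F) n) : Set where
  open OrderedField F
  open OrderedFieldProperties F
  field
    symmetric : ∀ u v → P u v ≈ P v u
    trace     : ∑ (λ u → P u u) ≈ κ
    rows      : ∀ u → ∑ (λ v → P u v * P u v) ≤ P u u
    psd       : ∀ α β u v → 0# ≤ α * α * P u u + (α * β * P u v + α * β * P u v) + β * β * P v v

-- The weighted projection onto the leading eigenspaces

module Spectral (F : OrderedField) where

  open OrderedField F
  open OrderedFieldProperties F
  open MatrixAlgebra F
  open Polynomials F
  open DetTheory commutativeRing
  open import Algebra.Definitions.RawSemiring (Semiring.rawSemiring semiring) using (_^_; product)
  open Solver using (_:+_; _:*_; _:-_; :-_; _:=_; con) renaming (solve to solveℤ)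
  open import Relation.Binary.Reasoning.Setoid setoid

  -- The diagonal matrix with entries μ has the same characteristic polynomial as `L`, and its
  -- powers are explicit.
  moments : ∀ {n} (L : Matrix Carrier n) (μ : Vector Carrier n) →
    (∀ x → det (λ i j → x * δ i j - L i j) ≈ product (λ i → x - μ i)) →
    ∀ N → tr (pow L N) ≈ ∑ (λ i → μ i ^ N)
  moments {n} L μ splits N = trans
    (TraceFormula.same-trace F L D (λ x → trans (splits x) (sym (splits-D x))) N)
    (∑-cong λ i → trans (pow-D N i i) (trans (*-congˡ (δ-diag i)) (*-identityʳ _)))
    where
    D : Matrix Carrier n
    D i j = μ i * δ i j
    splits-D : ∀ x → det (λ i j → x * δ i j - D i j) ≈ product (λ i → x - μ i)
    splits-D x = trans (det-cong entry) (det-diagonal (λ i → x - μ i))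
      where
      entry : ∀ i j → x * δ i j - μ i * δ i j ≈ diagonal (λ i → x - μ i) i j
      entry i j with does (i Fin.≟ j)
      ... | true  = solveℤ 2 (λ x m → x :* con (+ 1) :- m :* con (+ 1) := x :- m) refl x (μ i)
      ... | false = solveℤ 2 (λ x m → x :* con (+ 0) :- m :* con (+ 0) := con (+ 0)) refl x (μ i)
    pow-D : ∀ N i j → pow D N i j ≈ μ i ^ N * δ i j
    pow-D zero    i j = sym (*-identityˡ _)
    pow-D (suc N) i j = begin
      ∑ (λ k → pow D N i k * (μ k * δ k j))
        ≈⟨ ∑-cong (λ k → trans (*-congʳ (pow-D N i k)) (trans
             (solveℤ 4 (λ m d u e → (m :* d) :* (u :* e) := d :* (m :* u :* e)) refl (μ i ^ N) (δ i k) (μ k) (δ k j)) refl)) ⟩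
      ∑ (λ k → δ i k * (μ i ^ N * μ k * δ k j))
        ≈⟨ ∑-δˡ (λ k → μ i ^ N * μ k * δ k j) i ⟩
      μ i ^ N * μ i * δ i j
        ≈⟨ *-congʳ (*-comm _ _) ⟩
      μ i ^ suc N * δ i j ∎

  initial : ∀ {n} → ℕ → Fin n → Carrier
  initial zero    i       = 0#
  initial (suc k) zero    = 1#
  initial (suc k) (suc i) = initial k i

  initial-cases : ∀ {n} k (i : Fin n) →
    (initial k i ≈ 1# × toℕ i ℕ.< k) ⊎ (initial k i ≈ 0# × k ℕ.≤ toℕ i)
  initial-cases zero    i       = inj₂ (refl , ℕ.z≤n)
  initial-cases (suc k) zero    = inj₁ (refl , ℕ.s≤s ℕ.z≤n)
  initial-cases (suc k) (suc i) with initial-cases k i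
  ... | inj₁ (eq , i<k) = inj₁ (eq , ℕ.s≤s i<k)
  ... | inj₂ (eq , k≤i) = inj₂ (eq , ℕ.s≤s k≤i)

  ∑-initial : ∀ {n} k → k ℕ.≤ n → ∑ {n} (initial k) ≈ ι k
  ∑-initial {n}     zero    _             = ∑-0 {n} λ i → refl
  ∑-initial {suc n} (suc k) (ℕ.s≤s k≤n) =
    trans (∑-suc _) (trans (+-congˡ (∑-initial {n} k k≤n)) (sym (ι-suc k)))

  module _ {n} (L : Matrix Carrier n) (L-sym : ∀ i j → L i j ≈ L j i) (μ : Vector Carrier n)
    (splits : ∀ x → det (λ i j → x * δ i j - L i j) ≈ product (λ i → x - μ i))
    (decreasing : ∀ i j → i Fin.≤ j → μ j ≤ μ i)
    (κ : Fin n) where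

    private
      k : ℕ
      -- `κ` counts from 0, so `t` below is the k-th largest eigenvalue.
      k = suc (toℕ κ)
      t = μ κ
      χ : Vector Carrier n
      χ = initial k

      χ-cases : ∀ i → (χ i ≈ 1# × t ≤ μ i) ⊎ (χ i ≈ 0# × μ i ≤ t)
      χ-cases i with initial-cases k i
      ... | inj₁ (eq , i<k) = inj₁ (eq , decreasing i κ (ℕ.s≤s⁻¹ i<k))
      ... | inj₂ (eq , k≤i) = inj₂ (eq , decreasing κ i (ℕ.<⇒≤ k≤i))

      -- An `OrderedField` may be the zero ring, so contradictory cases end in 1 = 0, from which
      -- every equation follows.
      collapse : 1# ≈ 0# → ∀ {x y} → x ≈ y
      collapse 1≈0 {x} {y} = trans (zero-all x) (sym (zero-all y))
        where
        zero-all : ∀ x → x ≈ 0#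
        zero-all x = trans (sym (*-identityˡ x)) (trans (*-congʳ 1≈0) (zeroˡ x))

      clash : ∀ {x y} → x ≈ y → Apart x y → 1# ≈ 0#
      clash {x} {y} x≈y (z , eq) = trans (sym eq) (trans (*-congʳ (trans (+-congʳ x≈y) (-‿inverseʳ y))) (zeroˡ z))

      0∨1-idem : ∀ {x} → x ≈ 1# ⊎ x ≈ 0# → x * x ≈ x
      0∨1-idem (inj₁ eq) = trans (*-congʳ eq) (*-identityˡ _)
      0∨1-idem (inj₂ eq) = trans (*-congʳ eq) (trans (zeroˡ _) (sym eq))

      0∨1-nonneg : ∀ {x} → x ≈ 1# ⊎ x ≈ 0# → 0# ≤ x
      0∨1-nonneg (inj₁ eq) = ≤-respʳ (sym eq) 0≤1
      0∨1-nonneg (inj₂ eq) = ≤-reflexive (sym eq)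

      χ-0∨1 : ∀ i → χ i ≈ 1# ⊎ χ i ≈ 0#
      χ-0∨1 i with χ-cases i
      ... | inj₁ (eq , _) = inj₁ eq
      ... | inj₂ (eq , _) = inj₂ eq

    module _ (cmp : ∀ i j → Compared (μ i) (μ j)) where

      private
        tie : Fin n → Carrier
        tie i with cmp i κ
        ... | inj₁ _ = 1#
        ... | inj₂ _ = 0#

        tie-cases : ∀ i → (tie i ≈ 1# × μ i ≈ t) ⊎ (tie i ≈ 0# × Apart (μ i) t)
        tie-cases i with cmp i κ
        ... | inj₁ eq    = inj₁ (refl , eq)
        ... | inj₂ apart = inj₂ (refl , apart)

        tie-0∨1 : ∀ i → tie i ≈ 1# ⊎ tie i ≈ 0#
        tie-0∨1 i with tie-cases i
        ... | inj₁ (eq , _) = inj₁ eq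
        ... | inj₂ (eq , _) = inj₂ eq

        tie-≈1 : ∀ {i} → μ i ≈ t → tie i ≈ 1#
        tie-≈1 {i} μi≈t with tie-cases i
        ... | inj₁ (eq , _)    = eq
        ... | inj₂ (_ , apart) = collapse (clash μi≈t apart)

        μ*tie : ∀ i → μ i * tie i ≈ t * tie i
        μ*tie i with tie-cases i
        ... | inj₁ (_ , μi≈t) = *-congʳ μi≈t
        ... | inj₂ (eq , _)   = trans (*-congˡ eq) (trans (zeroʳ _) (sym (trans (*-congˡ eq) (zeroʳ _))))

        -- The indicator of the eigenvalues strictly above `t`.
        top : Fin n → Carrier
        top i = χ i * (1# - tie i)

        tie-compat : ∀ i j → μ i ≈ μ j → tie i ≈ tie j
        tie-compat i j eq with tie-cases i | tie-cases j
        ... | inj₁ (p , _)    | inj₁ (q , _)    = trans p (sym q)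
        ... | inj₂ (p , _)    | inj₂ (q , _)    = trans p (sym q)
        ... | inj₁ (p , μi≈t) | inj₂ _          = trans p (sym (tie-≈1 (trans (sym eq) μi≈t)))
        ... | inj₂ _          | inj₁ (q , μj≈t) = trans (tie-≈1 (trans eq μj≈t)) (sym q)

        top-≈0 : ∀ {i} → μ i ≈ t → top i ≈ 0#
        top-≈0 μi≈t = trans (*-congˡ (trans (+-congˡ (-‿cong (tie-≈1 μi≈t))) (-‿inverseʳ 1#))) (zeroʳ _)

        -- `χ` depends on the position and need not be a function of the eigenvalue. Equal
        -- eigenvalues on both sides of position k are squeezed to `t`, however, and there `top`
        -- vanishes.
        top-compat : ∀ i j → μ i ≈ μ j → top i ≈ top j
        top-compat i j eq with χ-cases i | χ-cases j
        ... | inj₁ (p , _)    | inj₁ (q , _)    = *-cong (trans p (sym q)) (+-congˡ (-‿cong (tie-compat i j eq)))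
        ... | inj₂ (p , _)    | inj₂ (q , _)    = *-cong (trans p (sym q)) (+-congˡ (-‿cong (tie-compat i j eq)))
        ... | inj₁ (_ , t≤μi) | inj₂ (_ , μj≤t) = trans (top-≈0 (≤-antisym (≤-respˡ (sym eq) μj≤t) t≤μi))
                                                    (sym (top-≈0 (≤-antisym μj≤t (≤-respʳ eq t≤μi))))
        ... | inj₂ (_ , μi≤t) | inj₁ (_ , t≤μj) = trans (top-≈0 (≤-antisym μi≤t (≤-respʳ (sym eq) t≤μj)))
                                                    (sym (top-≈0 (≤-antisym (≤-respˡ eq μi≤t) t≤μj)))

        tiePoly = interpolate μ tie cmp tie-compat
        topPoly = interpolate μ top cmp top-compat
        e = proj₁ tiePoly
        p = proj₁ topPoly

        -- The multiplicity of `t`, followed by the number of its copies among the first k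
        -- positions. Their quotient will be the weight θ.
        ties = ∑ tie
        initialTies = ∑ (λ i → χ i * tie i)

        1≤ties : 1# ≤ ties
        1≤ties = ≤-respˡ (tie-≈1 refl) (∑-term-≤ (λ i → 0∨1-nonneg (tie-0∨1 i)) κ)

        E₁ E₂ : Matrix Carrier n
        E₁ = evalM L p
        E₂ = evalM L e

        mom : ∀ N → tr (pow L N) ≈ ∑ (λ i → μ i ^ N)
        mom = moments L μ splits

        -- A symmetric idempotent is the Gram matrix of its own rows.
        gram : ∀ q → (∀ i → eval q (μ i) * eval q (μ i) ≈ eval q (μ i)) → ∀ u v →
          evalM L q u v ≈ ∑ (λ w → evalM L q u w * evalM L q v w)
        gram q idem u v = trans
          (evalM-agree L μ mom L-sym q (q *ₚ q) (λ i → sym (trans (eval-* q q (μ i)) (idem i))) u v)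
          (trans (evalM-* L q q u v) (∑-cong λ w → *-congˡ (evalM-sym L L-sym q w v)))

        -- By `gram` the form is the squared length of α times row `u` plus β times row `v`.
        idempotent-psd : ∀ q → (∀ i → eval q (μ i) * eval q (μ i) ≈ eval q (μ i)) → ∀ α β u v →
          0# ≤ α * α * evalM L q u u + (α * β * evalM L q u v + α * β * evalM L q u v) + β * β * evalM L q v v
        idempotent-psd q idem α β u v = ≤-respʳ (sym expand) (∑-nonneg λ w → square-nonneg (α * E u w + β * E v w))
          where
          E = evalM L q
          expand : α * α * E u u + (α * β * E u v + α * β * E u v) + β * β * E v v
            ≈ ∑ (λ w → (α * E u w + β * E v w) * (α * E u w + β * E v w))
          expand = begin
            α * α * E u u + (α * β * E u v + α * β * E u v) + β * β * E v v
              ≈⟨ +-cong (+-cong (*-congˡ (gram q idem u u)) (+-cong (*-congˡ (gram q idem u v)) (*-congˡ (gram q idem u v))))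
                        (*-congˡ (gram q idem v v)) ⟩
            α * α * ∑ (λ w → E u w * E u w) + (α * β * ∑ (λ w → E u w * E v w) + α * β * ∑ (λ w → E u w * E v w))
              + β * β * ∑ (λ w → E v w * E v w)
              ≈⟨ +-cong (+-cong (*-distribˡ-∑ _ _) (+-cong (*-distribˡ-∑ _ _) (*-distribˡ-∑ _ _))) (*-distribˡ-∑ _ _) ⟩
            ∑ (λ w → α * α * (E u w * E u w)) + (∑ (λ w → α * β * (E u w * E v w)) + ∑ (λ w → α * β * (E u w * E v w)))
              + ∑ (λ w → β * β * (E v w * E v w))
              ≈⟨ +-congʳ (+-congˡ (∑-distrib-+ (λ w → α * β * (E u w * E v w)) _)) ⟨
            ∑ (λ w → α * α * (E u w * E u w)) + ∑ (λ w → α * β * (E u w * E v w) + α * β * (E u w * E v w))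
              + ∑ (λ w → β * β * (E v w * E v w))
              ≈⟨ +-congʳ (∑-distrib-+ (λ w → α * α * (E u w * E u w)) _) ⟨
            ∑ (λ w → α * α * (E u w * E u w) + (α * β * (E u w * E v w) + α * β * (E u w * E v w)))
              + ∑ (λ w → β * β * (E v w * E v w))
              ≈⟨ ∑-distrib-+ (λ w → α * α * (E u w * E u w) + (α * β * (E u w * E v w) + α * β * (E u w * E v w))) _ ⟨
            ∑ (λ w → α * α * (E u w * E u w) + (α * β * (E u w * E v w) + α * β * (E u w * E v w)) + β * β * (E v w * E v w))
              ≈⟨ ∑-cong (λ w → solveℤ 4 (λ a b x y →
                   a :* a :* (x :* x) :+ (a :* b :* (x :* y) :+ a :* b :* (x :* y)) :+ b :* b :* (y :* y) :=
                   (a :* x :+ b :* y) :* (a :* x :+ b :* y)) refl α β (E u w) (E v w)) ⟩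
            ∑ (λ w → (α * E u w + β * E v w) * (α * E u w + β * E v w)) ∎

        e-idem : ∀ i → eval e (μ i) * eval e (μ i) ≈ eval e (μ i)
        e-idem i = trans (*-cong (proj₂ tiePoly i) (proj₂ tiePoly i))
          (trans (0∨1-idem (tie-0∨1 i)) (sym (proj₂ tiePoly i)))

        top-idem : ∀ i → top i * top i ≈ top i
        top-idem i = begin
          χ i * (1# - tie i) * (χ i * (1# - tie i))
            ≈⟨ solveℤ 2 (λ x e → x :* (con (+ 1) :- e) :* (x :* (con (+ 1) :- e)) :=
                 x :* x :* (con (+ 1) :- e :- e :+ e :* e)) refl (χ i) (tie i) ⟩
          χ i * χ i * (1# - tie i - tie i + tie i * tie i)
            ≈⟨ *-cong (0∨1-idem (χ-0∨1 i)) (+-congˡ (0∨1-idem (tie-0∨1 i))) ⟩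
          χ i * (1# - tie i - tie i + tie i)
            ≈⟨ solveℤ 2 (λ x e → x :* (con (+ 1) :- e :- e :+ e) := x :* (con (+ 1) :- e)) refl (χ i) (tie i) ⟩
          χ i * (1# - tie i) ∎

        top*tie : ∀ i → top i * tie i ≈ 0#
        top*tie i = begin
          χ i * (1# - tie i) * tie i
            ≈⟨ solveℤ 2 (λ x e → x :* (con (+ 1) :- e) :* e := x :* (e :- e :* e)) refl (χ i) (tie i) ⟩
          χ i * (tie i - tie i * tie i)
            ≈⟨ *-congˡ (trans (+-congˡ (-‿cong (0∨1-idem (tie-0∨1 i)))) (-‿inverseʳ _)) ⟩
          χ i * 0#
            ≈⟨ zeroʳ _ ⟩
          0# ∎

        p-idem : ∀ i → eval p (μ i) * eval p (μ i) ≈ eval p (μ i)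
        p-idem i = trans (*-cong (proj₂ topPoly i) (proj₂ topPoly i)) (trans (top-idem i) (sym (proj₂ topPoly i)))

        E₂-diag : ∀ u → 0# ≤ E₂ u u
        E₂-diag u = ≤-respʳ (sym (gram e e-idem u u)) (∑-nonneg λ w → square-nonneg (E₂ u w))

      -- Eigenvalues tied with the k-th one receive a common weight θ ∈ [0 , 1], so that the
      -- total weight is k.
      module _ (y : Carrier) (ties*y : ties * y ≈ 1#) where

        private
          θ = initialTies * y

          θ*ties : θ * ties ≈ initialTies
          θ*ties = trans (solveℤ 3 (λ s y r → s :* y :* r := s :* (r :* y)) refl initialTies y ties)
            (trans (*-congˡ ties*y) (*-identityʳ _))

          0≤y : 0# ≤ y
          0≤y = reciprocal-nonneg ties*y (≤-trans 0≤1 1≤ties)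

          0≤θ : 0# ≤ θ
          0≤θ = *-nonneg (∑-nonneg λ i → *-nonneg (0∨1-nonneg (χ-0∨1 i)) (0∨1-nonneg (tie-0∨1 i))) 0≤y

          χ*tie≤tie : ∀ i → χ i * tie i ≤ tie i
          χ*tie≤tie i with χ-0∨1 i
          ... | inj₁ eq = ≤-reflexive (trans (*-congʳ eq) (*-identityˡ _))
          ... | inj₂ eq = ≤-respˡ (sym (trans (*-congʳ eq) (zeroˡ _))) (0∨1-nonneg (tie-0∨1 i))

          θ≤1 : θ ≤ 1#
          θ≤1 = ≤-by (*-nonneg (≤⇒0≤- (∑-mono χ*tie≤tie)) 0≤y) (trans (+-congʳ (sym ties*y))
            (solveℤ 3 (λ r s y → r :* y :- s :* y := (r :- s) :* y) refl ties initialTies y))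

          π = p +ₚ θ ·ₚ e

          w : Fin n → Carrier
          w i = top i + θ * tie i

          π-value : ∀ i → eval π (μ i) ≈ w i
          π-value i = trans (eval-+ p (θ ·ₚ e) (μ i))
            (+-cong (proj₂ topPoly i) (trans (eval-· θ e (μ i)) (*-congˡ (proj₂ tiePoly i))))

          P : Matrix Carrier n
          P = evalM L π

          P-split : ∀ u v → P u v ≈ E₁ u v + θ * E₂ u v
          P-split u v = trans (evalM-+ L p (θ ·ₚ e) u v) (+-congˡ (evalM-· L θ e u v))

          -- `E₁` and `E₂` are orthogonal idempotents, because `top` and `tie` are indicators of
          -- disjoint sets of eigenvalues.
          P-squared : ∀ u v → (P ⊗ P) u v ≈ E₁ u v + θ * θ * E₂ u v
          P-squared u v = begin
            (P ⊗ P) u v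
              ≈⟨ evalM-* L π π u v ⟨
            evalM L (π *ₚ π) u v
              ≈⟨ evalM-agree L μ mom L-sym (π *ₚ π) (p +ₚ (θ * θ) ·ₚ e) agree u v ⟩
            evalM L (p +ₚ (θ * θ) ·ₚ e) u v
              ≈⟨ trans (evalM-+ L p ((θ * θ) ·ₚ e) u v) (+-congˡ (evalM-· L (θ * θ) e u v)) ⟩
            E₁ u v + θ * θ * E₂ u v ∎
            where
            agree : ∀ i → eval (π *ₚ π) (μ i) ≈ eval (p +ₚ (θ * θ) ·ₚ e) (μ i)
            agree i = begin
              eval (π *ₚ π) (μ i)
                ≈⟨ trans (eval-* π π (μ i)) (*-cong (π-value i) (π-value i)) ⟩
              w i * w i
                ≈⟨ solveℤ 3 (λ a t e → (a :+ t :* e) :* (a :+ t :* e) :=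
                     a :* a :+ (t :+ t) :* (a :* e) :+ t :* t :* (e :* e)) refl (top i) θ (tie i) ⟩
              top i * top i + (θ + θ) * (top i * tie i) + θ * θ * (tie i * tie i)
                ≈⟨ +-cong (trans (+-cong (top-idem i) (trans (*-congˡ (top*tie i)) (zeroʳ _))) (+-identityʳ _))
                          (*-congˡ (0∨1-idem (tie-0∨1 i))) ⟩
              top i + θ * θ * tie i
                ≈⟨ trans (eval-+ p ((θ * θ) ·ₚ e) (μ i))
                     (+-cong (proj₂ topPoly i) (trans (eval-· (θ * θ) e (μ i)) (*-congˡ (proj₂ tiePoly i)))) ⟨
              eval (p +ₚ (θ * θ) ·ₚ e) (μ i) ∎

          -- Since μ i * tie i ≈ t * tie i, both the trace and the value only see χ.
          total : ∀ (f : Vector Carrier n) c → (∀ i → f i * tie i ≈ c * tie i) →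
            ∑ (λ i → f i * w i) ≈ ∑ (λ i → χ i * f i)
          total f c f*tie = begin
            ∑ (λ i → f i * w i)
              ≈⟨ ∑-cong (λ i → trans
                   (solveℤ 4 (λ f x e t → f :* (x :* (con (+ 1) :- e) :+ t :* e) :=
                     (x :* f :+ t :* (f :* e)) :+ (:- x) :* (f :* e)) refl (f i) (χ i) (tie i) θ)
                   (trans (+-cong (+-congˡ (*-congˡ (f*tie i))) (*-congˡ (f*tie i)))
                     (solveℤ 5 (λ f x e t c → (x :* f :+ t :* (c :* e)) :+ (:- x) :* (c :* e) :=
                       (x :* f :+ t :* c :* e) :+ (:- c) :* (x :* e)) refl (f i) (χ i) (tie i) θ c))) ⟩
            ∑ (λ i → (χ i * f i + θ * c * tie i) + (- c) * (χ i * tie i))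
              ≈⟨ trans (∑-distrib-+ (λ i → χ i * f i + θ * c * tie i) _) (+-congʳ (∑-distrib-+ (λ i → χ i * f i) _)) ⟩
            (∑ (λ i → χ i * f i) + ∑ (λ i → θ * c * tie i)) + ∑ (λ i → (- c) * (χ i * tie i))
              ≈⟨ +-cong (+-congˡ (*-distribˡ-∑ (θ * c) tie)) (*-distribˡ-∑ (- c) _) ⟨
            (∑ (λ i → χ i * f i) + θ * c * ties) + (- c) * initialTies
              ≈⟨ +-cong (+-congˡ (trans (solveℤ 3 (λ t c r → t :* c :* r := c :* (t :* r)) refl θ c ties) (*-congˡ θ*ties))) refl ⟩
            (∑ (λ i → χ i * f i) + c * initialTies) + (- c) * initialTies
              ≈⟨ solveℤ 3 (λ a c s → (a :+ c :* s) :+ (:- c) :* s := a) refl _ c initialTies ⟩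
            ∑ (λ i → χ i * f i) ∎

        weighted-projection : ∃[ P ] (Density F (ι k) P × tr (L ⊗ P) ≈ ∑ (λ i → initial k i * μ i))
        weighted-projection = P , record
          { symmetric = evalM-sym L L-sym π
          ; trace = begin
              tr P
                ≈⟨ trans (tr-eval L μ mom π) (∑-cong λ i → trans (π-value i) (sym (*-identityˡ _))) ⟩
              ∑ (λ i → 1# * w i)
                ≈⟨ total (λ _ → 1#) 1# (λ i → refl) ⟩
              ∑ (λ i → χ i * 1#)
                ≈⟨ ∑-cong (λ i → *-identityʳ (χ i)) ⟩
              ∑ χ
                ≈⟨ ∑-initial k (Fin.toℕ<n κ) ⟩
              ι k ∎
          -- P - P² = θ * (1 - θ) * E₂, and the diagonal of `E₂` is nonnegative.
          ; rows = λ u → ≤-by (*-nonneg (*-nonneg 0≤θ (≤⇒0≤- θ≤1)) (E₂-diag u)) (trans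
              (+-cong (P-split u u) (-‿cong (trans (sym (evalM-square L L-sym π u)) (P-squared u u))))
              (solveℤ 3 (λ a t b → (a :+ t :* b) :- (a :+ t :* t :* b) := t :* (con (+ 1) :- t) :* b) refl (E₁ u u) θ (E₂ u u)))
          ; psd = λ α β u v → ≤-respʳ
              (sym (trans (+-cong (+-cong (*-congˡ (P-split u u)) (+-cong (*-congˡ (P-split u v)) (*-congˡ (P-split u v))))
                                  (*-congˡ (P-split v v)))
                (solveℤ 9 (λ α β θ a b c a′ b′ c′ →
                  α :* α :* (a :+ θ :* a′) :+ (α :* β :* (b :+ θ :* b′) :+ α :* β :* (b :+ θ :* b′)) :+ β :* β :* (c :+ θ :* c′) :=
                  (α :* α :* a :+ (α :* β :* b :+ α :* β :* b) :+ β :* β :* c) :+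
                  θ :* (α :* α :* a′ :+ (α :* β :* b′ :+ α :* β :* b′) :+ β :* β :* c′)) refl
                  α β θ (E₁ u u) (E₁ u v) (E₁ v v) (E₂ u u) (E₂ u v) (E₂ v v))))
              (+-nonneg (idempotent-psd p p-idem α β u v) (*-nonneg 0≤θ (idempotent-psd e e-idem α β u v)))
          } , (begin
            tr (L ⊗ P)
              ≈⟨ trans (tr-L-eval L μ mom π) (∑-cong λ i → *-congˡ (π-value i)) ⟩
            ∑ (λ i → μ i * w i)
              ≈⟨ total μ t μ*tie ⟩
            ∑ (λ i → χ i * μ i) ∎)

      ties-invertible : ¬ ¬ (∃[ y ] ties * y ≈ 1#)
      ties-invertible ¬inv = zero-or-invertible ties λ
        { (inj₁ ties≈0) → ¬inv (0# , collapse (≤-antisym (≤-respʳ ties≈0 1≤ties) 0≤1))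
        ; (inj₂ inv)    → ¬inv inv }

    density : ¬ ¬ (∃[ P ] (Density F (ι k) P × tr (L ⊗ P) ≈ ∑ (λ i → initial k i * μ i)))
    density ¬P = ¬¬-∀ (λ i → ¬¬-∀ λ j → compare (μ i) (μ j)) λ cmp →
      ties-invertible cmp λ (y , eq) → ¬P (weighted-projection cmp y eq)

-- Graph Laplacians

module PairInequality (F : OrderedField) where

  open OrderedField F
  open OrderedFieldProperties F
  open Solver using (_:+_; _:*_; _:-_; :-_; _:=_; con) renaming (solve to solveℤ)
  open import Relation.Binary.Reasoning.Setoid setoid

  -- In the case y ≤ x, - (x - y)² = (y² - x²) + 2 * y * (x - y) is nonnegative, which forces x = y.
  ≤-from-squares : ∀ {x y} → 0# ≤ y → x * x ≤ y * y → x ≤ y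
  ≤-from-squares {x} {y} 0≤y xx≤yy = ≤-cases x y id λ y≤x → ≤-reflexive (begin
    x             ≈⟨ solveℤ 2 (λ x y → x := y :+ (x :- y)) refl x y ⟩
    y + (x - y)   ≈⟨ +-congˡ (square≈0⇒≈0 (≤-antisym
      (0≤-⇒≤ (≤-respʳ
        (solveℤ 2 (λ x y → (y :* y :- x :* x) :+ ((y :+ y) :* (x :- y)) := con (+ 0) :- (x :- y) :* (x :- y)) refl x y)
        (+-nonneg (≤⇒0≤- xx≤yy) (*-nonneg (+-nonneg 0≤y 0≤y) (≤⇒0≤- y≤x)))))
      (square-nonneg (x - y)))) ⟩
    y + 0#        ≈⟨ +-identityʳ y ⟩
    y             ∎)

  module _ {a b : Carrier} (0≤a : 0# ≤ a) (0≤b : 0# ≤ b) (0≤p : 0# ≤ 1# - a) (0≤q : 0# ≤ 1# - b) where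

    private
      -- Expanding ((1 - a) + a) * ((1 - b) + b) = 1 gives X + Y + w = 1.
      X = (1# - a) * (1# - b)
      Y = a * b
      w = (1# - a) * b + (1# - b) * a

      0≤X : 0# ≤ X
      0≤X = *-nonneg 0≤p 0≤q
      0≤Y : 0# ≤ Y
      0≤Y = *-nonneg 0≤a 0≤b
      0≤w : 0# ≤ w
      0≤w = +-nonneg (*-nonneg 0≤p 0≤b) (*-nonneg 0≤q 0≤a)

      4XY≤ww : ι 4 * (X * Y) ≤ w * w
      4XY≤ww = ≤-by (square-nonneg ((1# - a) * b - (1# - b) * a))
        (solveℤ 4 (λ p q a b →
          (p :* b :+ q :* a) :* (p :* b :+ q :* a) :- con (+ 4) :* ((p :* q) :* (a :* b)) :=
          (p :* b :- q :* a) :* (p :* b :- q :* a)) refl (1# - a) (1# - b) a b)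

      2z≤w : ∀ {z} → z * z ≤ X * Y → ι 2 * z ≤ w
      2z≤w {z} zz≤XY = ≤-from-squares 0≤w (≤-trans
        (≤-respˡ (solveℤ 1 (λ z → con (+ 4) :* (z :* z) := (con (+ 2) :* z) :* (con (+ 2) :* z)) refl z)
          (*-monoˡ (ι-nonneg 4) zz≤XY)) 4XY≤ww)

    -- By AM-GM w² ≥ 4 * X * Y, so w is at least twice the smaller of X and Y. Subtracting that from
    -- w leaves sums of nonnegative terms.
    discriminant-nonneg : 0# ≤ ι 3 * (X * X) - ι 5 * (X * Y) + ι 3 * (w * Y)
    discriminant-nonneg = ≤-cases X Y
      (λ X≤Y → ≤-respʳ
        (solveℤ 3 (λ X Y w → con (+ 3) :* (X :* X) :+ X :* Y :+ con (+ 3) :* ((w :- con (+ 2) :* X) :* Y) :=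
          con (+ 3) :* (X :* X) :- con (+ 5) :* (X :* Y) :+ con (+ 3) :* (w :* Y)) refl X Y w)
        (+-nonneg (+-nonneg (*-nonneg (ι-nonneg 3) (square-nonneg X)) (*-nonneg 0≤X 0≤Y))
          (*-nonneg (ι-nonneg 3) (*-nonneg (≤⇒0≤- (2z≤w (*-monoˡ 0≤X X≤Y))) 0≤Y))))
      (λ Y≤X → ≤-respʳ
        (solveℤ 3 (λ X Y w → con (+ 3) :* ((X :- Y) :* (X :- Y)) :+ (X :* Y :+ con (+ 3) :* (Y :* Y))
            :+ con (+ 3) :* ((w :- con (+ 2) :* Y) :* Y) :=
          con (+ 3) :* (X :* X) :- con (+ 5) :* (X :* Y) :+ con (+ 3) :* (w :* Y)) refl X Y w)
        (+-nonneg (+-nonneg (*-nonneg (ι-nonneg 3) (square-nonneg (X - Y)))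
                            (+-nonneg (*-nonneg 0≤X 0≤Y) (*-nonneg (ι-nonneg 3) (square-nonneg Y))))
          (*-nonneg (ι-nonneg 3) (*-nonneg (≤⇒0≤- (2z≤w (≤-respʳ (*-comm Y X) (*-monoˡ 0≤Y Y≤X)))) 0≤Y))))

    module _ {i j : Carrier} (pi≈1 : (1# - a) * i ≈ 1#) (qj≈1 : (1# - b) * j ≈ 1#) where

      private
        M = (ι 3 * i - 1#) + (ι 3 * j - 1#)
        C = ι 4 * (a * b) + ι 3 * (1# - a - b)

        0≤i : 0# ≤ i
        0≤i = reciprocal-nonneg pi≈1 0≤p
        0≤j : 0# ≤ j
        0≤j = reciprocal-nonneg qj≈1 0≤q

        i-split : i ≈ 1# + a * i
        i-split = trans (solveℤ 2 (λ a i → i := (con (+ 1) :- a) :* i :+ a :* i) refl a i) (+-congʳ pi≈1)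
        j-split : j ≈ 1# + b * j
        j-split = trans (solveℤ 2 (λ a i → i := (con (+ 1) :- a) :* i :+ a :* i) refl b j) (+-congʳ qj≈1)

        -- Since i = 1 + a * i and j = 1 + b * j, M - 1 equals 3 + 3 * (a * i + b * j). The margin
        -- of 1 later replaces a division by M: if S ≤ 0 ≤ M * S, then S = M * S + (M - 1) * (- S)
        -- is nonnegative.
        0≤M-1 : 0# ≤ M - 1#
        0≤M-1 = ≤-respʳ (sym (begin
          M - 1#
            ≈⟨ +-congʳ (+-cong (+-congʳ (*-congˡ i-split)) (+-congʳ (*-congˡ j-split))) ⟩
          (ι 3 * (1# + a * i) - 1#) + (ι 3 * (1# + b * j) - 1#) - 1#
            ≈⟨ solveℤ 2 (λ x y → (con (+ 3) :* (con (+ 1) :+ x) :- con (+ 1)) :+ (con (+ 3) :* (con (+ 1) :+ y) :- con (+ 1)) :- con (+ 1)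
                 := con (+ 3) :+ con (+ 3) :* (x :+ y)) refl (a * i) (b * j) ⟩
          ι 3 + ι 3 * (a * i + b * j) ∎))
          (+-nonneg (ι-nonneg 3) (*-nonneg (ι-nonneg 3) (+-nonneg (*-nonneg 0≤a 0≤i) (*-nonneg 0≤b 0≤j))))

        -- In terms of X, Y and w, X * M = 4 * X + 3 * w and C = 3 * X + Y. With 9 * X written as 9
        -- * X * (X + Y + w), the product X * (M * C - 9) becomes the form in `discriminant-nonneg`.
        0≤MC-9 : 0# ≤ M * C - ι 9
        0≤MC-9 = ≤-respʳ (sym (begin
          M * C - ι 9
            ≈⟨ +-cong (*-congʳ M-split) (-‿cong 9-split) ⟩
          ((ι 3 * (1# - a) + ι 3 * (1# - b)) - ι 2 * X) * (i * j) * C - ι 9 * (X * (i * j))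
            ≈⟨ solveℤ 4 (λ a b i j →
                 let p = con (+ 1) :- a; q = con (+ 1) :- b; X = p :* q; Y = a :* b; w = p :* b :+ q :* a in
                 ((con (+ 3) :* p :+ con (+ 3) :* q) :- con (+ 2) :* X) :* (i :* j) :*
                   (con (+ 4) :* (a :* b) :+ con (+ 3) :* (con (+ 1) :- a :- b)) :- con (+ 9) :* (X :* (i :* j)) :=
                 i :* j :* (con (+ 3) :* (X :* X) :- con (+ 5) :* (X :* Y) :+ con (+ 3) :* (w :* Y))) refl a b i j ⟩
          i * j * (ι 3 * (X * X) - ι 5 * (X * Y) + ι 3 * (w * Y)) ∎))
          (*-nonneg (*-nonneg 0≤i 0≤j) discriminant-nonneg)
          where
          Xij≈1 : X * (i * j) ≈ 1#
          Xij≈1 = trans (solveℤ 4 (λ p q i j → p :* q :* (i :* j) := (p :* i) :* (q :* j)) refl (1# - a) (1# - b) i j)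
            (trans (*-cong pi≈1 qj≈1) (*-identityˡ 1#))
          9-split : ι 9 ≈ ι 9 * (X * (i * j))
          9-split = sym (trans (*-congˡ Xij≈1) (*-identityʳ _))
          M-split : M ≈ ((ι 3 * (1# - a) + ι 3 * (1# - b)) - ι 2 * X) * (i * j)
          M-split = sym (begin
            ((ι 3 * (1# - a) + ι 3 * (1# - b)) - ι 2 * X) * (i * j)
              ≈⟨ solveℤ 4 (λ p q i j → ((con (+ 3) :* p :+ con (+ 3) :* q) :- con (+ 2) :* (p :* q)) :* (i :* j) :=
                   (con (+ 3) :* (q :* j) :* i :- (p :* i) :* (q :* j)) :+ (con (+ 3) :* (p :* i) :* j :- (p :* i) :* (q :* j)))
                   refl (1# - a) (1# - b) i j ⟩
            _ ≈⟨ +-cong (+-cong (*-congʳ (*-congˡ qj≈1)) (-‿cong (*-cong pi≈1 qj≈1)))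
                        (+-cong (*-congʳ (*-congˡ pi≈1)) (-‿cong (*-cong pi≈1 qj≈1))) ⟩
            (ι 3 * 1# * i - 1# * 1#) + (ι 3 * 1# * j - 1# * 1#)
              ≈⟨ solveℤ 2 (λ i j → (con (+ 3) :* con (+ 1) :* i :- con (+ 1) :* con (+ 1)) :+ (con (+ 3) :* con (+ 1) :* j :- con (+ 1) :* con (+ 1))
                   := (con (+ 3) :* i :- con (+ 1)) :+ (con (+ 3) :* j :- con (+ 1))) refl i j ⟩
            M ∎)

      -- The difference M x² + 6 x + C of the two sides is nonnegative, as its discriminant 36 − 4 M C is nonpositive.
      pair-bound : ∀ x → ι 3 * (a + b - (x + x) - 1#) ≤ M * (x * x) + ι 4 * (a * b)
      pair-bound x = ≤-by {d = S} 0≤S (solveℤ 4 (λ a b x M →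
        (M :* (x :* x) :+ con (+ 4) :* (a :* b)) :- con (+ 3) :* (a :+ b :- (x :+ x) :- con (+ 1)) :=
        M :* (x :* x) :+ con (+ 6) :* x :+ (con (+ 4) :* (a :* b) :+ con (+ 3) :* (con (+ 1) :- a :- b))) refl a b x M)
        where
        S = M * (x * x) + ι 6 * x + C
        0≤MS : 0# ≤ M * S
        0≤MS = ≤-respʳ (solveℤ 3 (λ M x C → (M :* x :+ con (+ 3)) :* (M :* x :+ con (+ 3)) :+ (M :* C :- con (+ 9)) :=
            M :* (M :* (x :* x) :+ con (+ 6) :* x :+ C)) refl M x C)
          (+-nonneg (square-nonneg (M * x + ι 3)) 0≤MC-9)
        0≤S : 0# ≤ S
        0≤S = ≤-cases 0# S id λ S≤0 → ≤-respʳ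
          (solveℤ 2 (λ M S → M :* S :+ (M :- con (+ 1)) :* (:- S) := S) refl M S)
          (+-nonneg 0≤MS (*-nonneg 0≤M-1 (≤0⇒0≤- S≤0)))

  -- d = 3 / (1 - a) - 1, where a row of P with a = 1 has no other nonzero entries and needs
  -- no weight.
  data Weight (a d : Carrier) : Set where
    regular : ∀ {i} → (1# - a) * i ≈ 1# → d ≈ ι 3 * i - 1# → Weight a d
    full    : a ≈ 1# → d ≈ 0# → Weight a d

  weight-exists : ∀ a → ¬ ¬ (∃[ d ] Weight a d)
  weight-exists a ¬w = zero-or-invertible (1# - a) λ
    { (inj₁ 1-a≈0) → ¬w (0# , full (trans (solveℤ 1 (λ a → a := con (+ 1) :- (con (+ 1) :- a)) refl a)
        (trans (+-congˡ (trans (-‿cong 1-a≈0) (solveℤ 0 (:- con (+ 0) := con (+ 0)) refl))) (+-identityʳ 1#))) refl)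
    ; (inj₂ (i , eq)) → ¬w (ι 3 * i - 1# , regular eq refl) }

  weight-nonneg : ∀ {a d} → 0# ≤ a → 0# ≤ 1# - a → Weight a d → 0# ≤ d
  weight-nonneg 0≤a 0≤p (full _ d≈0) = ≤-reflexive (sym d≈0)
  weight-nonneg {a} 0≤a 0≤p (regular {i} pi≈1 d≈) = ≤-respʳ (sym (trans d≈ (trans
      (+-congʳ (*-congˡ (trans (solveℤ 2 (λ a i → i := (con (+ 1) :- a) :* i :+ a :* i) refl a i) (+-congʳ pi≈1))))
      (solveℤ 1 (λ x → con (+ 3) :* (con (+ 1) :+ x) :- con (+ 1) := con (+ 2) :+ con (+ 3) :* x) refl (a * i)))))
    (+-nonneg (ι-nonneg 2) (*-nonneg (ι-nonneg 3) (*-nonneg 0≤a (reciprocal-nonneg pi≈1 0≤p))))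

  -- For a regular weight d = (2 + a) / (1 - a), and equality holds.
  weight-budget : ∀ {a d} → 0# ≤ a → Weight a d → d * (a - a * a) ≤ a * (ι 2 + a)
  weight-budget {a} 0≤a (full _ d≈0) = ≤-respˡ (sym (trans (*-congʳ d≈0) (zeroˡ _))) (*-nonneg 0≤a (+-nonneg (ι-nonneg 2) 0≤a))
  weight-budget {a} {d} 0≤a (regular {i} pi≈1 d≈) = ≤-reflexive (begin
    d * (a - a * a)
      ≈⟨ *-congʳ d≈ ⟩
    (ι 3 * i - 1#) * (a - a * a)
      ≈⟨ solveℤ 2 (λ a i → (con (+ 3) :* i :- con (+ 1)) :* (a :- a :* a) :=
           con (+ 3) :* a :* ((con (+ 1) :- a) :* i) :- (a :- a :* a)) refl a i ⟩
    ι 3 * a * ((1# - a) * i) - (a - a * a)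
      ≈⟨ +-congʳ (*-congˡ pi≈1) ⟩
    ι 3 * a * 1# - (a - a * a)
      ≈⟨ solveℤ 1 (λ a → con (+ 3) :* a :* con (+ 1) :- (a :- a :* a) := a :* (con (+ 2) :+ a)) refl a ⟩
    a * (ι 2 + a) ∎)

  -- If a = 1 or b = 1, then x = 0 and (1 - a) * (1 - b) = 0, and the two sides differ by exactly a
  -- * b. Otherwise `pair-bound` applies.
  weighted-pair-bound : ∀ {a b d e} x → 0# ≤ a → 0# ≤ b → 0# ≤ 1# - a → 0# ≤ 1# - b →
    Weight a d → Weight b e → (a ≈ 1# → x ≈ 0#) → (b ≈ 1# → x ≈ 0#) →
    ι 3 * (a + b - (x + x) - 1#) ≤ (d + e) * (x * x) + ι 4 * (a * b)
  weighted-pair-bound {a} {b} {d} {e} x 0≤a 0≤b 0≤p 0≤q wa wb za zb = go wa wb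
    where
    degenerate : x ≈ 0# → (1# - a) * (1# - b) ≈ 0# → ι 3 * (a + b - (x + x) - 1#) ≤ (d + e) * (x * x) + ι 4 * (a * b)
    degenerate x≈0 X≈0 = ≤-by (*-nonneg 0≤a 0≤b) (begin
      ((d + e) * (x * x) + ι 4 * (a * b)) - ι 3 * (a + b - (x + x) - 1#)
        ≈⟨ solveℤ 4 (λ a b x f → (f :* (x :* x) :+ con (+ 4) :* (a :* b)) :- con (+ 3) :* (a :+ b :- (x :+ x) :- con (+ 1)) :=
             a :* b :+ (con (+ 3) :* ((con (+ 1) :- a) :* (con (+ 1) :- b)) :+ (f :* x :+ con (+ 6)) :* x)) refl a b x (d + e) ⟩
      a * b + (ι 3 * ((1# - a) * (1# - b)) + ((d + e) * x + ι 6) * x)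
        ≈⟨ +-congˡ (+-cong (trans (*-congˡ X≈0) (zeroʳ _)) (trans (*-congˡ x≈0) (zeroʳ _))) ⟩
      a * b + (0# + 0#)
        ≈⟨ trans (+-congˡ (+-identityˡ 0#)) (+-identityʳ _) ⟩
      a * b ∎)
    go : Weight a d → Weight b e → _
    go (full a≈1 _) _ = degenerate (za a≈1) (trans (*-congʳ (trans (+-congˡ (-‿cong a≈1)) (-‿inverseʳ 1#))) (zeroˡ _))
    go _ (full b≈1 _) = degenerate (zb b≈1) (trans (*-congˡ (trans (+-congˡ (-‿cong b≈1)) (-‿inverseʳ 1#))) (zeroʳ _))
    go (regular pi≈1 d≈) (regular qj≈1 e≈) =
      ≤-respʳ (+-congʳ (*-congʳ (sym (+-cong d≈ e≈)))) (pair-bound 0≤a 0≤b 0≤p 0≤q pi≈1 qj≈1 x)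

-- Bounding the trace of L P by the number of edges

module GraphBound (F : OrderedField) {n} (G : SimpleGraph n) where

  open import Data.List.Base as List using (length; filter; tabulate; allFin; cartesianProduct; _++_)
  import Data.List.Properties as List
  open import Relation.Unary using (Pred; Decidable)
  open OrderedField F
  open OrderedFieldProperties F
  open MatrixAlgebra F
  open PairInequality F
  open SimpleGraph G
  open Solver using (_:+_; _:*_; _:-_; :-_; _:=_; con) renaming (solve to solveℤ)
  open import Relation.Binary.Reasoning.Setoid setoid

  indicator : ∀ {A : Set} → Dec A → Carrier
  indicator a? = if does a? then 1# else 0#

  indicator-nonneg : ∀ {A : Set} (a? : Dec A) → 0# ≤ indicator a?
  indicator-nonneg (yes _) = 0≤1
  indicator-nonneg (no _)  = ≤-refl

  indicator-cong : ∀ {A B : Set} (a? : Dec A) (b? : Dec B) → (A → B) → (B → A) → indicator a? ≈ indicator b?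
  indicator-cong (yes _) (yes _) _ _ = refl
  indicator-cong (no _)  (no _)  _ _ = refl
  indicator-cong (yes a) (no ¬b) f _ = ⊥-elim (¬b (f a))
  indicator-cong (no ¬a) (yes b) _ g = ⊥-elim (¬a (g b))

  indicator-no : ∀ {A : Set} (a? : Dec A) → ¬ A → indicator a? ≈ 0#
  indicator-no (yes a) ¬a = ⊥-elim (¬a a)
  indicator-no (no _)  _  = refl

  count-tabulate : ∀ {A : Set} {P : Pred A _} (P? : Decidable P) {m} (f : Fin m → A) →
    ι (length (filter P? (tabulate f))) ≈ ∑ (λ i → indicator (P? (f i)))
  count-tabulate P? {zero}  f = sym (∑-empty _)
  count-tabulate P? {suc m} f with does (P? (f zero)) in eq
  ... | true  = trans (ι-suc (length (filter P? (tabulate (f ∘ suc))))) (trans (+-cong (reflexive (≡.cong (if_then 1# else 0#) (≡.sym eq)))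
                  (count-tabulate P? (f ∘ suc))) (sym (∑-suc _)))
  ... | false = trans (count-tabulate P? (f ∘ suc)) (trans (sym (+-identityˡ _))
                  (trans (+-congʳ (reflexive (≡.cong (if_then 1# else 0#) (≡.sym eq)))) (sym (∑-suc _))))

  count-product : ∀ {A : Set} {P : Pred (A × Fin n) _} (P? : Decidable P) {m} (f : Fin m → A) →
    ι (length (filter P? (cartesianProduct (tabulate f) (allFin n)))) ≈ ∑ (λ i → ∑ (λ j → indicator (P? (f i , j))))
  count-product P? {zero}  f = sym (∑-empty _)
  count-product P? {suc m} f = begin
    ι (length (filter P? (row ++ rest)))
      ≈⟨ reflexive (≡.cong ι (≡.trans (≡.cong length (List.filter-++ P? row rest)) (List.length-++ (filter P? row)))) ⟩
    ι (length (filter P? row) ℕ.+ length (filter P? rest))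
      ≈⟨ ι-+ (length (filter P? row)) _ ⟩
    ι (length (filter P? row)) + ι (length (filter P? rest))
      ≈⟨ +-cong (trans (reflexive (≡.cong (λ l → ι (length (filter P? l))) (List.map-tabulate id (f zero ,_))))
                       (count-tabulate P? (f zero ,_)))
                (count-product P? (f ∘ suc)) ⟩
    ∑ (λ j → indicator (P? (f zero , j))) + ∑ (λ i → ∑ (λ j → indicator (P? (f (suc i) , j))))
      ≈⟨ ∑-suc _ ⟨
    ∑ (λ i → ∑ (λ j → indicator (P? (f i , j)))) ∎
    where
    row  = List.map (f zero ,_) (allFin n)
    rest = cartesianProduct (tabulate (f ∘ suc)) (allFin n)

  adjacency : Matrix Carrier n
  adjacency u v = indicator (adj? u v)

  adjacency-sym : ∀ u v → adjacency u v ≈ adjacency v u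
  adjacency-sym u v = indicator-cong (adj? u v) (adj? v u) adj-sym adj-sym

  adjacency-diag : ∀ u → adjacency u u ≈ 0#
  adjacency-diag u = indicator-no (adj? u u) (adj-irrefl ≡.refl)

  adj⇒≢ : ∀ {u v} → Adj u v → u ≢ v
  adj⇒≢ u~v ≡.refl = adj-irrefl ≡.refl u~v

  deg : Vector Carrier n
  deg u = ι (degree G u)

  deg-sum : ∀ u → deg u ≈ ∑ (adjacency u)
  deg-sum u = count-tabulate (adj? u) id

  m : Carrier
  m = ι (edgeCount G)

  -- `edges` lists only pairs with u < v, so each adjacency entry is split by the orientation of its
  -- pair.
  handshake : ∑ (λ u → ∑ (adjacency u)) ≈ m + m
  handshake = begin
    ∑ (λ u → ∑ (adjacency u))
      ≈⟨ ∑-cong (λ u → trans (∑-cong (split u)) (∑-distrib-+ (arc u) _)) ⟩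
    ∑ (λ u → ∑ (arc u) + ∑ (λ v → arc v u))
      ≈⟨ ∑-distrib-+ (λ u → ∑ (arc u)) _ ⟩
    ∑ (λ u → ∑ (arc u)) + ∑ (λ u → ∑ (λ v → arc v u))
      ≈⟨ +-congˡ (∑-comm (λ u v → arc v u)) ⟩
    ∑ (λ u → ∑ (arc u)) + ∑ (λ u → ∑ (arc u))
      ≈⟨ +-cong m-sum m-sum ⟨
    m + m ∎
    where
    edge? : Decidable (λ (e : Fin n × Fin n) → proj₁ e Fin.< proj₂ e × Adj (proj₁ e) (proj₂ e))
    edge? e = (proj₁ e Fin.<? proj₂ e) ×-dec adj? (proj₁ e) (proj₂ e)
    arc : Matrix Carrier n
    arc u v = indicator (edge? (u , v))
    m-sum : m ≈ ∑ (λ u → ∑ (arc u))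
    m-sum = count-product edge? id
    no-arc : ∀ {u v} → ¬ u Fin.< v → arc u v ≈ 0#
    no-arc {u} {v} u≮v = indicator-no (edge? (u , v)) (u≮v ∘ proj₁)
    arc-< : ∀ {u v} → u Fin.< v → arc u v ≈ adjacency u v
    arc-< {u} {v} u<v = indicator-cong (edge? (u , v)) (adj? u v) proj₂ (u<v ,_)
    split : ∀ u v → adjacency u v ≈ arc u v + arc v u
    split u v with Fin.<-cmp u v
    ... | tri< u<v _ v≮u = sym (trans (+-cong (arc-< u<v) (no-arc v≮u)) (+-identityʳ _))
    ... | tri≈ u≮v ≡.refl _ = trans (adjacency-diag u) (sym (trans (+-cong (no-arc u≮v) (no-arc u≮v)) (+-identityʳ _)))
    ... | tri> u≮v _ v<u = trans (adjacency-sym u v) (sym (trans (+-cong (no-arc u≮v) (arc-< v<u)) (+-identityˡ _)))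

  -- The form D - A, without nested conditionals, lets sums over entries be split.
  L : Matrix Carrier n
  L u v = deg u * δ u v - adjacency u v

  L-sym : ∀ u v → L u v ≈ L v u
  L-sym u v = go (u Fin.≟ v)
    where
    go : Dec (u ≡ v) → L u v ≈ L v u
    go (yes ≡.refl) = refl
    go (no u≢v) = +-cong
      (trans (trans (*-congˡ (δ-off u≢v)) (zeroʳ _)) (sym (trans (*-congˡ (δ-off (u≢v ∘ ≡.sym))) (zeroʳ _))))
      (-‿cong (adjacency-sym u v))

  -- `c` stands for the degree as a real number in the theorem, which is only `≈` to the multiple of
  -- 1 used here.
  laplacian-entry : ∀ {c} i j → c ≈ deg i →
    (if does (i Fin.≟ j) then c else if does (adj? i j) then - 1# else 0#) ≈ L i j
  laplacian-entry i j c≈deg with i Fin.≟ j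
  ... | yes i≡j = trans c≈deg (trans (solveℤ 1 (λ d → d := d :* con (+ 1) :- con (+ 0)) refl (deg i))
          (+-congˡ (-‿cong (sym (indicator-no (adj? i j) (λ i~j → adj⇒≢ i~j i≡j))))))
  ... | no _ with adj? i j
  ...   | yes _ = solveℤ 1 (λ d → :- con (+ 1) := d :* con (+ 0) :- con (+ 1)) refl (deg i)
  ...   | no _  = solveℤ 1 (λ d → con (+ 0) := d :* con (+ 0) :- con (+ 0)) refl (deg i)

  ∑∑ : Matrix Carrier n → Carrier
  ∑∑ f = ∑ (λ u → ∑ (f u))

  ∑∑-cong : ∀ {f g} → (∀ u v → f u v ≈ g u v) → ∑∑ f ≈ ∑∑ g
  ∑∑-cong eq = ∑-cong λ u → ∑-cong (eq u)

  ∑∑-+ : ∀ f g → ∑∑ (λ u v → f u v + g u v) ≈ ∑∑ f + ∑∑ g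
  ∑∑-+ f g = trans (∑-cong λ u → ∑-distrib-+ (f u) (g u)) (∑-distrib-+ (λ u → ∑ (f u)) _)

  ∑∑-* : ∀ c f → ∑∑ (λ u v → c * f u v) ≈ c * ∑∑ f
  ∑∑-* c f = trans (∑-cong λ u → sym (*-distribˡ-∑ c (f u))) (sym (*-distribˡ-∑ c _))

  ∑∑-transpose : ∀ f → ∑∑ (λ u v → f v u) ≈ ∑∑ f
  ∑∑-transpose f = ∑-comm (λ u v → f v u)

  adjacency-edge : ∀ {u v} → Adj u v → adjacency u v ≈ 1#
  adjacency-edge {u} {v} u~v with adj? u v
  ... | yes _   = refl
  ... | no ¬u~v = ⊥-elim (¬u~v u~v)

  -- Sum the adjacency matrix outside of the rows and columns u and v.
  degree-pair : ∀ {u v} → Adj u v → deg u + deg v ≤ m + 1#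
  degree-pair {u} {v} u~v = 0≤-⇒≤ (ι-divide-nonneg 1 (≤-respʳ total
    (∑-nonneg λ i → *-nonneg (outside-nonneg i) (∑-nonneg λ j → *-nonneg (outside-nonneg j) (indicator-nonneg (adj? i j))))))
    where
    outside : Vector Carrier n
    outside i = 1# - δ u i - δ v i
    outside-nonneg : ∀ i → 0# ≤ outside i
    outside-nonneg i = go (u Fin.≟ i) (v Fin.≟ i)
      where
      value : ∀ {x y z} → δ u i ≈ x → δ v i ≈ y → 1# - x - y ≈ z → 0# ≤ z → 0# ≤ outside i
      value p q eq = ≤-respʳ (trans (sym eq) (sym (+-cong (+-congˡ (-‿cong p)) (-‿cong q))))
      go : Dec (u ≡ i) → Dec (v ≡ i) → 0# ≤ outside i
      go (yes ≡.refl) (yes v≡u) = ⊥-elim (adj⇒≢ u~v (≡.sym v≡u))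
      go (yes ≡.refl) (no v≢i)  = value (δ-diag u) (δ-off v≢i) (solveℤ 0 (con (+ 1) :- con (+ 1) :- con (+ 0) := con (+ 0)) refl) ≤-refl
      go (no u≢i) (yes ≡.refl)  = value (δ-off u≢i) (δ-diag v) (solveℤ 0 (con (+ 1) :- con (+ 0) :- con (+ 1) := con (+ 0)) refl) ≤-refl
      go (no u≢i) (no v≢i)      = value (δ-off u≢i) (δ-off v≢i) (solveℤ 0 (con (+ 1) :- con (+ 0) :- con (+ 0) := con (+ 1)) refl) 0≤1
    ∑-outside : ∀ (x : Vector Carrier n) → ∑ (λ i → outside i * x i) ≈ ∑ x - x u - x v
    ∑-outside x = begin
      ∑ (λ i → outside i * x i)
        ≈⟨ ∑-cong (λ i → solveℤ 3 (λ d e x → (con (+ 1) :- d :- e) :* x := x :+ (d :* (:- x) :+ e :* (:- x))) refl (δ u i) (δ v i) (x i)) ⟩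
      ∑ (λ i → x i + (δ u i * - x i + δ v i * - x i))
        ≈⟨ trans (∑-distrib-+ x _) (+-congˡ (∑-distrib-+ (λ i → δ u i * - x i) _)) ⟩
      ∑ x + (∑ (λ i → δ u i * - x i) + ∑ (λ i → δ v i * - x i))
        ≈⟨ +-congˡ (+-cong (∑-δˡ (λ i → - x i) u) (∑-δˡ (λ i → - x i) v)) ⟩
      ∑ x + (- x u + - x v)
        ≈⟨ +-assoc _ _ _ ⟨
      ∑ x - x u - x v ∎
    column : ∀ w → ∑ (λ i → adjacency i w) ≈ deg w
    column w = trans (∑-cong λ i → adjacency-sym i w) (sym (deg-sum w))
    inner : Vector Carrier n
    inner i = deg i - adjacency i u - adjacency i v
    ∑-inner : ∑ inner ≈ (m + m) - deg u - deg v
    ∑-inner = begin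
      ∑ inner
        ≈⟨ ∑-cong (λ i → solveℤ 3 (λ d x y → d :- x :- y := d :+ :- con (+ 1) :* (x :+ y)) refl (deg i) (adjacency i u) (adjacency i v)) ⟩
      ∑ (λ i → deg i + - 1# * (adjacency i u + adjacency i v))
        ≈⟨ trans (∑-distrib-+ deg _) (+-cong (trans (∑-cong deg-sum) handshake)
             (trans (sym (*-distribˡ-∑ (- 1#) _)) (*-congˡ (trans (∑-distrib-+ (λ i → adjacency i u) _) (+-cong (column u) (column v)))))) ⟩
      (m + m) + - 1# * (deg u + deg v)
        ≈⟨ solveℤ 3 (λ m x y → m :+ :- con (+ 1) :* (x :+ y) := m :- x :- y) refl (m + m) (deg u) (deg v) ⟩
      (m + m) - deg u - deg v ∎
    total : ∑ (λ i → outside i * ∑ (λ j → outside j * adjacency i j)) ≈ ι 2 * (m + 1# - (deg u + deg v))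
    total = begin
      ∑ (λ i → outside i * ∑ (λ j → outside j * adjacency i j))
        ≈⟨ ∑-cong (λ i → *-congˡ (trans (∑-outside (adjacency i)) (+-congʳ (+-congʳ (sym (deg-sum i)))))) ⟩
      ∑ (λ i → outside i * inner i)
        ≈⟨ ∑-outside inner ⟩
      ∑ inner - inner u - inner v
        ≈⟨ +-cong (+-cong ∑-inner
             (-‿cong (+-cong (+-congˡ (-‿cong (adjacency-diag u))) (-‿cong (adjacency-edge u~v)))))
             (-‿cong (+-cong (+-congˡ (-‿cong (adjacency-edge (adj-sym u~v)))) (-‿cong (adjacency-diag v)))) ⟩
      (m + m) - deg u - deg v - (deg u - 0# - 1#) - (deg v - 1# - 0#)
        ≈⟨ solveℤ 3 (λ m x y → (m :+ m) :- x :- y :- (x :- con (+ 0) :- con (+ 1)) :- (y :- con (+ 1) :- con (+ 0)) :=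
             con (+ 2) :* (m :+ con (+ 1) :- (x :+ y))) refl m (deg u) (deg v) ⟩
      ι 2 * (m + 1# - (deg u + deg v)) ∎

  -- An isolated vertex gets r = 0. The equation is only claimed in the presence of a neighbour,
  -- while the inequality is enough for summing a row.
  degree-reciprocal : ∀ u → ∃[ r ] (0# ≤ r × deg u * r ≤ 1# × (∀ {v} → Adj u v → deg u * r ≈ 1#))
  degree-reciprocal u with degree G u in eq
  ... | zero  = 0# , ≤-refl , ≤-respˡ (sym (zeroʳ _)) 0≤1 , λ {v} u~v → trans (zeroˡ _) (sym (no-neighbour v u~v))
    where
    no-neighbour : ∀ v → Adj u v → 1# ≈ 0#
    no-neighbour v u~v = ≤-antisym (≤-respˡ (adjacency-edge u~v) (≤-respʳ
      (trans (sym (deg-sum u)) (reflexive (≡.cong ι eq)))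
      (∑-term-≤ (λ w → indicator-nonneg (adj? u w)) v))) 0≤1
  ... | suc d = let y , inv = ι-invertible d in
    y , reciprocal-nonneg inv (ι-nonneg (suc d)) , ≤-reflexive inv , λ _ → inv

  module _ {κ : Carrier} {P : Matrix Carrier n} (density : Density F κ P) where

    open Density density

    a : Vector Carrier n
    a u = P u u

    energy : Matrix Carrier n
    energy u v = adjacency u v * (a u + a v - (P u v + P u v))

    -- Each edge is counted in both directions.
    trace-energy : tr (L ⊗ P) + tr (L ⊗ P) ≈ ∑∑ energy
    trace-energy = sym (begin
      ∑∑ energy
        ≈⟨ ∑∑-cong (λ u v → trans (solveℤ 4 (λ e x y p → e :* (x :+ y :- (p :+ p)) := (e :* (x :- p)) :+ (e :* (y :- p)))
             refl (adjacency u v) (a u) (a v) (P u v)) (+-congˡ (*-cong (adjacency-sym u v) (+-congˡ (-‿cong (symmetric u v)))))) ⟩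
      ∑∑ (λ u v → half u v + half v u)
        ≈⟨ ∑∑-+ half (λ u v → half v u) ⟩
      ∑∑ half + ∑∑ (λ u v → half v u)
        ≈⟨ +-congˡ (∑∑-transpose half) ⟩
      ∑∑ half + ∑∑ half
        ≈⟨ +-cong ∑∑-half ∑∑-half ⟩
      tr (L ⊗ P) + tr (L ⊗ P) ∎)
      where
      half : Matrix Carrier n
      half u v = adjacency u v * (a u - P u v)
      ∑∑-half : ∑∑ half ≈ tr (L ⊗ P)
      ∑∑-half = ∑-cong λ u → sym (begin
        ∑ (λ v → (deg u * δ u v - adjacency u v) * P v u)
          ≈⟨ ∑-cong (λ v → trans (solveℤ 4 (λ d e x p → (d :* e :- x) :* p := e :* (d :* p) :+ (:- x) :* p) refl
               (deg u) (δ u v) (adjacency u v) (P v u)) (+-congˡ (*-congˡ (symmetric v u)))) ⟩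
        ∑ (λ v → δ u v * (deg u * P v u) + (- adjacency u v) * P u v)
          ≈⟨ ∑-distrib-+ (λ v → δ u v * (deg u * P v u)) _ ⟩
        ∑ (λ v → δ u v * (deg u * P v u)) + ∑ (λ v → (- adjacency u v) * P u v)
          ≈⟨ +-congʳ (trans (∑-δˡ (λ v → deg u * P v u) u) (trans (*-congʳ (deg-sum u)) (*-distribʳ-∑ (a u) (adjacency u)))) ⟩
        ∑ (λ v → adjacency u v * a u) + ∑ (λ v → (- adjacency u v) * P u v)
          ≈⟨ ∑-distrib-+ (λ v → adjacency u v * a u) _ ⟨
        ∑ (λ v → adjacency u v * a u + (- adjacency u v) * P u v)
          ≈⟨ ∑-cong (λ v → solveℤ 3 (λ e x p → e :* x :+ (:- e) :* p := e :* (x :- p)) refl (adjacency u v) (a u) (P u v)) ⟩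
        ∑ (half u) ∎)

    a-nonneg : ∀ u → 0# ≤ a u
    a-nonneg u = ≤-trans (∑-nonneg λ v → square-nonneg (P u v)) (rows u)

    offDiagonal-rows : ∀ u → ∑ (λ v → (1# - δ u v) * (P u v * P u v)) ≤ a u - a u * a u
    offDiagonal-rows u = ≤-respˡ (sym (begin
      ∑ (λ v → (1# - δ u v) * (P u v * P u v))
        ≈⟨ ∑-cong (λ v → solveℤ 2 (λ d s → (con (+ 1) :- d) :* s := s :+ :- con (+ 1) :* (d :* s)) refl (δ u v) _) ⟩
      ∑ (λ v → P u v * P u v + - 1# * (δ u v * (P u v * P u v)))
        ≈⟨ trans (∑-distrib-+ (λ v → P u v * P u v) _) (+-congˡ (sym (*-distribˡ-∑ (- 1#) _))) ⟩
      ∑ (λ v → P u v * P u v) + - 1# * ∑ (λ v → δ u v * (P u v * P u v))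
        ≈⟨ +-congˡ (trans (*-congˡ (∑-δˡ (λ v → P u v * P u v) u))
             (solveℤ 1 (λ s → :- con (+ 1) :* s := :- s) refl (a u * a u))) ⟩
      ∑ (λ v → P u v * P u v) - a u * a u ∎))
      (+-mono-≤ (rows u) ≤-refl)

    1-δ-nonneg : ∀ (u v : Fin n) → 0# ≤ 1# - δ u v
    1-δ-nonneg u v with does (u Fin.≟ v)
    ... | true  = ≤-reflexive (sym (-‿inverseʳ 1#))
    ... | false = ≤-respʳ (solveℤ 0 (con (+ 1) := con (+ 1) :- con (+ 0)) refl) 0≤1

    offDiagonal-nonneg : ∀ u v → 0# ≤ (1# - δ u v) * (P u v * P u v)
    offDiagonal-nonneg u v = *-nonneg (1-δ-nonneg u v) (square-nonneg (P u v))

    -- 1 - a = (1 - a)² + (a - a²), and a - a² bounds a sum of squares.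
    a≤1 : ∀ u → 0# ≤ 1# - a u
    a≤1 u = ≤-respʳ (solveℤ 1 (λ a → (con (+ 1) :- a) :* (con (+ 1) :- a) :+ (a :- a :* a) := con (+ 1) :- a) refl (a u))
      (+-nonneg (square-nonneg (1# - a u)) (≤-trans (∑-nonneg (offDiagonal-nonneg u)) (offDiagonal-rows u)))

    1-δ-diag : ∀ (u : Fin n) → 1# - δ u u ≈ 0#
    1-δ-diag u = trans (+-congˡ (-‿cong (δ-diag u))) (-‿inverseʳ 1#)

    1-δ-off : ∀ {u v : Fin n} → u ≢ v → 1# - δ u v ≈ 1#
    1-δ-off u≢v = trans (+-congˡ (-‿cong (δ-off u≢v))) (solveℤ 0 (con (+ 1) :- con (+ 0) := con (+ 1)) refl)

    -- The budget a - a² of such a row is 0.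
    full-row : ∀ {u v} → u ≢ v → a u ≈ 1# → P u v ≈ 0#
    full-row {u} {v} u≢v a≈1 = square≈0⇒≈0 (≤-antisym
      (≤-respˡ (trans (*-congʳ (1-δ-off u≢v)) (*-identityˡ _)) (≤-respʳ
        (trans (+-cong a≈1 (-‿cong (trans (*-cong a≈1 a≈1) (*-identityˡ 1#)))) (-‿inverseʳ 1#))
        (≤-trans (∑-term-≤ (offDiagonal-nonneg u) v) (offDiagonal-rows u))))
      (square-nonneg (P u v)))

    -- The case κ ≥ 2: an edge is charged to (d u + d v) (P u v)² and to a u * a v, with
    -- denominators cleared by a factor 3.
    module _ (d : Vector Carrier n) (weight : ∀ u → Weight (a u) (d u)) where

      charge : Matrix Carrier n
      charge u v = (1# - δ u v) * ((d u + d v) * (P u v * P u v)) + (1# - δ u v) * (ι 4 * (a u * a v))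

      -- Off the diagonal, a nonadjacent pair has left side 0 and a nonnegative charge. Charges can
      -- thus be summed over all pairs, independently of the graph.
      edge-charge : ∀ u v → ι 3 * (energy u v - adjacency u v) ≤ charge u v
      edge-charge u v = go (u Fin.≟ v)
        where
        diag : ι 3 * (energy u u - adjacency u u) ≈ charge u u
        diag = begin
          ι 3 * (adjacency u u * (a u + a u - (P u u + P u u)) - adjacency u u)
            ≈⟨ *-congˡ (+-cong (trans (*-congʳ (adjacency-diag u)) (zeroˡ _)) (-‿cong (adjacency-diag u))) ⟩
          ι 3 * (0# - 0#)
            ≈⟨ solveℤ 2 (λ x y → con (+ 3) :* (con (+ 0) :- con (+ 0)) := con (+ 0) :* x :+ con (+ 0) :* y) refl _ _ ⟩
          0# * ((d u + d u) * (P u u * P u u)) + 0# * (ι 4 * (a u * a u))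
            ≈⟨ +-cong (*-congʳ (1-δ-diag u)) (*-congʳ (1-δ-diag u)) ⟨
          charge u u ∎
        bound : u ≢ v → ι 3 * (a u + a v - (P u v + P u v) - 1#) ≤ (d u + d v) * (P u v * P u v) + ι 4 * (a u * a v)
        bound u≢v = weighted-pair-bound (P u v) (a-nonneg u) (a-nonneg v) (a≤1 u) (a≤1 v) (weight u) (weight v)
          (full-row u≢v) (λ a≈1 → trans (symmetric u v) (full-row (u≢v ∘ ≡.sym) a≈1))
        edge : u ≢ v → ι 3 * (energy u v - adjacency u v) ≤ (d u + d v) * (P u v * P u v) + ι 4 * (a u * a v)
        edge u≢v with adj? u v
        ... | yes _ = ≤-respˡ (solveℤ 1 (λ x → con (+ 3) :* (x :- con (+ 1)) := con (+ 3) :* (con (+ 1) :* x :- con (+ 1))) refl _) (bound u≢v)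
        ... | no _  = ≤-respˡ (solveℤ 1 (λ x → con (+ 0) := con (+ 3) :* (con (+ 0) :* x :- con (+ 0))) refl _)
          (+-nonneg (*-nonneg (+-nonneg (weight-nonneg (a-nonneg u) (a≤1 u) (weight u)) (weight-nonneg (a-nonneg v) (a≤1 v) (weight v)))
                              (square-nonneg (P u v)))
                    (*-nonneg (ι-nonneg 4) (*-nonneg (a-nonneg u) (a-nonneg v))))
        go : Dec (u ≡ v) → ι 3 * (energy u v - adjacency u v) ≤ charge u v
        go (yes ≡.refl) = ≤-reflexive diag
        go (no u≢v)     = ≤-respʳ (sym (+-cong (trans (*-congʳ (1-δ-off u≢v)) (*-identityˡ _))
                                               (trans (*-congʳ (1-δ-off u≢v)) (*-identityˡ _)))) (edge u≢v)

      private
        Q : Carrier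
        Q = ∑ (λ u → a u * a u)

        S : Matrix Carrier n
        S u v = d u * ((1# - δ u v) * (P u v * P u v))

        S-total : ∑∑ S ≤ ι 2 * κ + Q
        S-total = ≤-respʳ budget (∑-mono λ u → ≤-respˡ (*-distribˡ-∑ (d u) _)
          (≤-trans (*-monoˡ (weight-nonneg (a-nonneg u) (a≤1 u) (weight u)) (offDiagonal-rows u))
                   (weight-budget (a-nonneg u) (weight u))))
          where
          budget : ∑ (λ u → a u * (ι 2 + a u)) ≈ ι 2 * κ + Q
          budget = begin
            ∑ (λ u → a u * (ι 2 + a u))
              ≈⟨ ∑-cong (λ u → solveℤ 1 (λ a → a :* (con (+ 2) :+ a) := con (+ 2) :* a :+ a :* a) refl (a u)) ⟩
            ∑ (λ u → ι 2 * a u + a u * a u)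
              ≈⟨ trans (∑-distrib-+ (λ u → ι 2 * a u) _) (+-congʳ (sym (*-distribˡ-∑ (ι 2) a))) ⟩
            ι 2 * ∑ a + Q
              ≈⟨ +-congʳ (*-congˡ trace) ⟩
            ι 2 * κ + Q ∎

        products : ∑∑ (λ u v → (1# - δ u v) * (ι 4 * (a u * a v))) ≈ ι 4 * (κ * κ - Q)
        products = begin
          ∑∑ (λ u v → (1# - δ u v) * (ι 4 * (a u * a v)))
            ≈⟨ ∑-cong (λ u → trans (∑-cong λ v → solveℤ 3 (λ d x y → (con (+ 1) :- d) :* (con (+ 4) :* (x :* y)) :=
                 con (+ 4) :* x :* y :+ d :* (:- con (+ 4) :* (x :* y))) refl (δ u v) (a u) (a v))
                 (∑-distrib-+ (λ v → ι 4 * a u * a v) _)) ⟩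
          ∑ (λ u → ∑ (λ v → ι 4 * a u * a v) + ∑ (λ v → δ u v * ((- ι 4) * (a u * a v))))
            ≈⟨ ∑-cong (λ u → +-cong (trans (sym (*-distribˡ-∑ (ι 4 * a u) a)) (*-congˡ trace)) (∑-δˡ (λ v → (- ι 4) * (a u * a v)) u)) ⟩
          ∑ (λ u → ι 4 * a u * κ + (- ι 4) * (a u * a u))
            ≈⟨ ∑-distrib-+ (λ u → ι 4 * a u * κ) _ ⟩
          ∑ (λ u → ι 4 * a u * κ) + ∑ (λ u → (- ι 4) * (a u * a u))
            ≈⟨ +-cong (trans (sym (*-distribʳ-∑ κ _)) (*-congʳ (trans (sym (*-distribˡ-∑ (ι 4) a)) (*-congˡ trace)))) (sym (*-distribˡ-∑ (- ι 4) _)) ⟩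
          ι 4 * κ * κ + (- ι 4) * Q
            ≈⟨ solveℤ 2 (λ k q → con (+ 4) :* k :* k :+ :- con (+ 4) :* q := con (+ 4) :* (k :* k :- q)) refl κ Q ⟩
          ι 4 * (κ * κ - Q) ∎

        charge-total : ∑∑ charge ≈ (∑∑ S + ∑∑ S) + ι 4 * (κ * κ - Q)
        charge-total = begin
          ∑∑ charge
            ≈⟨ ∑∑-+ (λ u v → (1# - δ u v) * ((d u + d v) * (P u v * P u v))) _ ⟩
          ∑∑ (λ u v → (1# - δ u v) * ((d u + d v) * (P u v * P u v))) + ∑∑ (λ u v → (1# - δ u v) * (ι 4 * (a u * a v)))
            ≈⟨ +-cong (∑∑-cong λ u v → trans
                 (solveℤ 4 (λ e x y s → (con (+ 1) :- e) :* ((x :+ y) :* s) :=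
                   x :* ((con (+ 1) :- e) :* s) :+ y :* ((con (+ 1) :- e) :* s)) refl (δ u v) (d u) (d v) _)
                 (+-congˡ (*-congˡ (*-cong (+-congˡ (-‿cong (reflexive (δ-sym u v)))) (*-cong (symmetric u v) (symmetric u v))))))
               products ⟩
          ∑∑ (λ u v → S u v + S v u) + ι 4 * (κ * κ - Q)
            ≈⟨ +-congʳ (trans (∑∑-+ S (λ u v → S v u)) (+-congˡ (∑∑-transpose S))) ⟩
          (∑∑ S + ∑∑ S) + ι 4 * (κ * κ - Q) ∎

      -- Everything is multiplied by 6: by 3 for the cleared denominators and by 2 for the two
      -- directions of an edge. What remains, 6 * κ² - 2 * (2 * κ + Q) - 4 * (κ² - Q), equals 2 * κ
      -- * (κ - 2) + 2 * Q.
      excess-bound : 0# ≤ κ * (κ - ι 2) → tr (L ⊗ P) ≤ m + κ * κ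
      excess-bound 2≤κ = 0≤-⇒≤ (ι-divide-nonneg 5 (≤-respʳ
        (solveℤ 3 (λ t m k → con (+ 6) :* (k :* k) :- con (+ 3) :* ((t :+ t) :- (m :+ m)) := con (+ 6) :* ((m :+ k :* k) :- t)) refl (tr (L ⊗ P)) m κ)
        (≤⇒0≤- (≤-trans total-≤ (≤-by (+-nonneg (*-nonneg (ι-nonneg 2) 2≤κ) (*-nonneg (ι-nonneg 2) (∑-nonneg λ u → square-nonneg (a u))))
          (solveℤ 2 (λ k q → con (+ 6) :* (k :* k) :- ((con (+ 2) :* k :+ q :+ (con (+ 2) :* k :+ q)) :+ con (+ 4) :* (k :* k :- q)) :=
            con (+ 2) :* (k :* (k :- con (+ 2))) :+ con (+ 2) :* q) refl κ Q))))))
        where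
        lhs : ∑∑ (λ u v → ι 3 * (energy u v - adjacency u v)) ≈ ι 3 * ((tr (L ⊗ P) + tr (L ⊗ P)) - (m + m))
        lhs = trans (∑∑-* (ι 3) _) (*-congˡ (begin
          ∑∑ (λ u v → energy u v - adjacency u v)
            ≈⟨ ∑∑-cong (λ u v → +-congˡ (solveℤ 1 (λ x → :- x := :- con (+ 1) :* x) refl (adjacency u v))) ⟩
          ∑∑ (λ u v → energy u v + - 1# * adjacency u v)
            ≈⟨ trans (∑∑-+ energy _) (+-congˡ (∑∑-* (- 1#) adjacency)) ⟩
          ∑∑ energy + - 1# * ∑∑ adjacency
            ≈⟨ +-cong (sym trace-energy) (trans (*-congˡ handshake) (solveℤ 1 (λ x → :- con (+ 1) :* x := :- x) refl (m + m))) ⟩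
          (tr (L ⊗ P) + tr (L ⊗ P)) - (m + m) ∎))
        total-≤ : ι 3 * ((tr (L ⊗ P) + tr (L ⊗ P)) - (m + m)) ≤ (ι 2 * κ + Q + (ι 2 * κ + Q)) + ι 4 * (κ * κ - Q)
        total-≤ = ≤-respˡ lhs (≤-trans (∑-mono λ u → ∑-mono (edge-charge u))
          (≤-respˡ (sym charge-total) (+-mono-≤ (+-mono-≤ S-total S-total) ≤-refl)))

    excess-bound-≥2 : 0# ≤ κ * (κ - ι 2) → tr (L ⊗ P) ≤ m + κ * κ
    excess-bound-≥2 2≤κ = ≤-classical (¬¬-∀ λ u → weight-exists (a u)) λ w →
      excess-bound (proj₁ ∘ w) (proj₂ ∘ w) 2≤κ

    -- The case κ = 1: weigh the two ends of an edge by their degrees.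
    private
      r : Vector Carrier n
      r u = proj₁ (degree-reciprocal u)

      0≤r : ∀ u → 0# ≤ r u
      0≤r u = proj₁ (proj₂ (degree-reciprocal u))

      share : Matrix Carrier n
      share u v = adjacency u v * (r u * (deg u + deg v) * a u)

      -- For an edge, positivity of the form at (deg v , deg u), divided by deg u * deg v, bounds -
      -- 2 * P u v by (deg v / deg u) * a u + (deg u / deg v) * a v. Adding a u + a v gives the two
      -- shares.
      edge-share : ∀ u v → energy u v ≤ share u v + share v u
      edge-share u v with adj? u v in u?v
      ... | no ¬u~v = ≤-reflexive (trans (zeroˡ _) (sym (trans (+-cong (zeroˡ _)
              (trans (*-congʳ (indicator-no (adj? v u) (¬u~v ∘ adj-sym))) (zeroˡ _))) (+-identityˡ 0#))))
      ... | yes u~v = ≤-by (*-nonneg (*-nonneg (0≤r u) (0≤r v)) (psd (deg v) (deg u) u v)) (begin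
          (1# * (r u * (deg u + deg v) * a u) + adjacency v u * (r v * (deg v + deg u) * a v)) - 1# * (a u + a v - (P u v + P u v))
            ≈⟨ +-congʳ (+-congˡ (*-congʳ (adjacency-edge (adj-sym u~v)))) ⟩
          (1# * (r u * (deg u + deg v) * a u) + 1# * (r v * (deg v + deg u) * a v)) - 1# * (a u + a v - (P u v + P u v))
            ≈⟨ solveℤ 7 (λ r s x y a b p →
                 (con (+ 1) :* (r :* (x :+ y) :* a) :+ con (+ 1) :* (s :* (y :+ x) :* b)) :- con (+ 1) :* (a :+ b :- (p :+ p)) :=
                 (x :* r :- con (+ 1)) :* a :+ (y :* s :- con (+ 1)) :* b :+ (r :* y :* a :+ s :* x :* b :+ (p :+ p)))
                 refl (r u) (r v) (deg u) (deg v) (a u) (a v) (P u v) ⟩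
          (deg u * r u - 1#) * a u + (deg v * r v - 1#) * a v + (r u * deg v * a u + r v * deg u * a v + (P u v + P u v))
            ≈⟨ +-cong (trans (+-cong (trans (*-congʳ (trans (+-congʳ du) (-‿inverseʳ 1#))) (zeroˡ _))
                                     (trans (*-congʳ (trans (+-congʳ dv) (-‿inverseʳ 1#))) (zeroˡ _))) (+-identityˡ 0#)) refl ⟩
          0# + (r u * deg v * a u + r v * deg u * a v + (P u v + P u v))
            ≈⟨ +-identityˡ _ ⟩
          r u * deg v * a u + r v * deg u * a v + (P u v + P u v)
            ≈⟨ +-cong (+-cong (*-congʳ (trans (sym (*-identityˡ _)) (*-congʳ (sym dv))))
                              (*-congʳ (trans (sym (*-identityˡ _)) (*-congʳ (sym du)))))
                      (trans (sym (*-identityˡ _)) (*-congʳ (trans (sym (*-identityˡ 1#)) (*-cong (sym du) (sym dv))))) ⟩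
          deg v * r v * (r u * deg v) * a u + deg u * r u * (r v * deg u) * a v + deg u * r u * (deg v * r v) * (P u v + P u v)
            ≈⟨ solveℤ 7 (λ r s x y a b p →
                 y :* s :* (r :* y) :* a :+ x :* r :* (s :* x) :* b :+ x :* r :* (y :* s) :* (p :+ p) :=
                 r :* s :* (y :* y :* a :+ (y :* x :* p :+ y :* x :* p) :+ x :* x :* b))
                 refl (r u) (r v) (deg u) (deg v) (a u) (a v) (P u v) ⟩
          r u * r v * (deg v * deg v * a u + (deg v * deg u * P u v + deg v * deg u * P u v) + deg u * deg u * a v) ∎)
        where
        du : deg u * r u ≈ 1#
        du = proj₂ (proj₂ (proj₂ (degree-reciprocal u))) u~v
        dv : deg v * r v ≈ 1#
        dv = proj₂ (proj₂ (proj₂ (degree-reciprocal v))) (adj-sym u~v)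

      share-bound : ∀ u v → share u v ≤ adjacency u v * (r u * (m + 1#) * a u)
      share-bound u v with adj? u v
      ... | no _    = ≤-reflexive (trans (zeroˡ _) (sym (zeroˡ _)))
      ... | yes u~v = *-monoˡ 0≤1 (≤-respˡ (reorder _) (≤-respʳ (reorder _)
          (*-monoˡ (*-nonneg (0≤r u) (a-nonneg u)) (degree-pair u~v))))
        where
        reorder : ∀ x → r u * a u * x ≈ r u * x * a u
        reorder = solveℤ 3 (λ r a x → r :* a :* x := r :* x :* a) refl (r u) (a u)

      -- The row has deg u nonzero entries, and the factor `r u` of each cancels this number.
      row-bound : ∀ u → ∑ (share u) ≤ (m + 1#) * a u
      row-bound u = ≤-trans (∑-mono (share-bound u)) (≤-respˡ (begin
        (m + 1#) * a u * (deg u * r u)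
          ≈⟨ solveℤ 4 (λ k a d r → k :* a :* (d :* r) := d :* (r :* k :* a)) refl (m + 1#) (a u) (deg u) (r u) ⟩
        deg u * (r u * (m + 1#) * a u)
          ≈⟨ trans (*-congʳ (deg-sum u)) (*-distribʳ-∑ _ (adjacency u)) ⟩
        ∑ (λ v → adjacency u v * (r u * (m + 1#) * a u)) ∎)
        (≤-respʳ (*-identityʳ _) (*-monoˡ (*-nonneg (+-nonneg (ι-nonneg (edgeCount G)) 0≤1) (a-nonneg u))
          (proj₁ (proj₂ (proj₂ (degree-reciprocal u)))))))

    trace-bound : tr (L ⊗ P) ≤ (m + 1#) * κ
    trace-bound = 0≤-⇒≤ (ι-divide-nonneg 1 (≤-respʳ
      (solveℤ 2 (λ x t → (x :+ x) :- (t :+ t) := con (+ 2) :* (x :- t)) refl ((m + 1#) * κ) (tr (L ⊗ P)))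
      (≤⇒0≤- (≤-respˡ (sym trace-energy) (≤-trans (∑-mono λ u → ∑-mono (edge-share u)) (≤-respˡ
        (sym (trans (∑∑-+ share (λ u v → share v u)) (+-congˡ (∑∑-transpose share))))
        (+-mono-≤ shares shares)))))))
      where
      shares : ∑∑ share ≤ (m + 1#) * κ
      shares = ≤-respʳ (trans (sym (*-distribˡ-∑ (m + 1#) a)) (*-congˡ trace)) (∑-mono row-bound)

  edges+k² : ∀ k {P : Matrix Carrier n} → 1 ℕ.≤ k → Density F (ι k) P → tr (L ⊗ P) ≤ ι (edgeCount G ℕ.+ k ℕ.^ 2)
  -- At κ = 1 the bound (m + 1) * κ coincides with m + κ².
  edges+k² (suc zero)    _ density = ≤-respʳ
    (trans (*-identityʳ _) (sym (ι-+ (edgeCount G) 1))) (trace-bound density)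
  edges+k² (suc (suc k)) _ density = ≤-respʳ
    (sym (trans (ι-+ (edgeCount G) (K ℕ.^ 2)) (+-congˡ (trans (reflexive (≡.cong (λ j → ι (K ℕ.* j)) (ℕ.*-identityʳ K))) (ι-* K K)))))
    (excess-bound-≥2 density (*-nonneg (ι-nonneg K) (≤-respʳ
      (sym (trans (+-congʳ (ι-+ 2 k)) (solveℤ 1 (λ x → con (+ 2) :+ x :- con (+ 2) := x) refl (ι k)))) (ι-nonneg k))))
    where
    K = suc (suc k)

-- The bound over an arbitrary ordered field

module LaplacianSpectrum (F : OrderedField) where

  open OrderedField F
  open OrderedFieldProperties F
  open DetTheory commutativeRing using (det)
  open Spectral F using (initial; density)
  open import Algebra.Definitions.RawSemiring (Semiring.rawSemiring semiring) using (product) renaming (sum to rawSum)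

  ∑-initial-inject≤ : ∀ {n} k .(k≤n : k ℕ.≤ n) (f : Vector Carrier n) →
    ∑ (λ i → initial k i * f i) ≈ rawSum {k} (λ i → f (inject≤ i k≤n))
  ∑-initial-inject≤ zero    k≤n f = ∑-0 λ i → zeroˡ _
  ∑-initial-inject≤ {suc n} (suc k) k≤n f =
    trans (∑-suc _) (+-cong (*-identityˡ _) (∑-initial-inject≤ k (ℕ.s≤s⁻¹ k≤n) (f ∘ suc)))

  partial-sum-bound : ∀ {n} k (k≤n : k ℕ.≤ n) → 1 ℕ.≤ k → (G : SimpleGraph n) (μ : Vector Carrier n) →
    (∀ x → det (λ i j → x * δ i j - GraphBound.L F G i j) ≈ product (λ i → x - μ i)) →
    (∀ i j → i Fin.≤ j → μ j ≤ μ i) →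
    rawSum {k} (λ i → μ (inject≤ i k≤n)) ≤ ι (edgeCount G ℕ.+ k ℕ.^ 2)
  partial-sum-bound {n} (suc k) k≤n 1≤k G μ splits decreasing = ≤-classical
    (density (GraphBound.L F G) (GraphBound.L-sym F G) μ splits decreasing κ)
    λ { (P , dens , value) → ≤-respˡ
          (trans value (trans (∑-cong λ i → *-congʳ (reflexive (≡.cong (λ j → initial (suc j) i) κ≡k)))
            (∑-initial-inject≤ (suc k) k≤n μ)))
          (GraphBound.edges+k² F G (suc k) 1≤k
            (≡.subst (λ j → Density F (ι (suc j)) P) κ≡k dens)) }
    where
    κ : Fin n
    -- Here `k≤n` proves suc k ≤ n, so k itself is an index: that of the last eigenvalue in the sum.
    κ = fromℕ< k≤n
    κ≡k : toℕ κ ≡ k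
    κ≡k = Fin.toℕ-fromℕ< k≤n

-- Real numbers

module Reals where

  open import Defs using (ℝ; mkℝ; seq; cauchy; Eventually; IsCauchy; 0ℝ; 1ℝ)
  import Defs as R
  open import Data.Rational.Base as ℚ using (ℚ; 0ℚ; 1ℚ; ½; _+_; _*_; -_; _-_; _≤_; _<_; ∣_∣; _⊔_; 1/_; Positive)
  import Data.Rational.Properties as ℚ
  open import Data.Rational.Solver using (module +-*-Solver)
  open ≡ using (refl; sym; trans; cong; cong₂; subst; subst₂)
  open +-*-Solver using (solve; _:+_; _:*_; _:-_; :-_; _:=_; con)

  Eventually-map : ∀ {P Q : ℕ → Set} → (∀ n → P n → Q n) → Eventually P → Eventually Q
  Eventually-map f (N , p) = N , λ n N≤n → f n (p n N≤n)

  Eventually-map₂ : ∀ {P Q S : ℕ → Set} → (∀ n → P n → Q n → S n) →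
    Eventually P → Eventually Q → Eventually S
  Eventually-map₂ f (M , p) (N , q) = M ℕ.⊔ N , λ n ≤n →
    f n (p n (ℕ.m⊔n≤o⇒m≤o M N ≤n)) (q n (ℕ.m⊔n≤o⇒n≤o M N ≤n))

  Eventually-witness : ∀ {P : ℕ → Set} → Eventually P → ∃[ n ] P n
  Eventually-witness (N , p) = N , p N ℕ.≤-refl

  ½+½ : ∀ ε → ½ * ε + ½ * ε ≡ ε
  ½+½ ε = trans (sym (ℚ.*-distribʳ-+ ε ½ ½)) (ℚ.*-identityˡ ε)

  ½>0 : ∀ {ε} → 0ℚ < ε → 0ℚ < ½ * ε
  ½>0 {ε} ε>0 = subst (_< ½ * ε) (ℚ.*-zeroʳ ½) (ℚ.*-monoʳ-<-pos ½ ε>0)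

  ½<1 : ∀ {ε} → 0ℚ < ε → ½ * ε < ε
  ½<1 {ε} ε>0 = subst₂ _<_ (ℚ.+-identityʳ (½ * ε)) (½+½ ε) (ℚ.+-monoʳ-< (½ * ε) (½>0 ε>0))

  *>0 : ∀ {p q} → 0ℚ < p → 0ℚ < q → 0ℚ < p * q
  *>0 {p} {q} p>0 q>0 = subst (_< p * q) (ℚ.*-zeroˡ q) (ℚ.*-monoˡ-<-pos q {{ℚ.positive q>0}} p>0)

  *≥0 : ∀ {p q} → 0ℚ ≤ p → 0ℚ ≤ q → 0ℚ ≤ p * q
  *≥0 {p} {q} p≥0 q≥0 = subst (_≤ p * q) (ℚ.*-zeroˡ q) (ℚ.*-monoʳ-≤-nonNeg q {{ℚ.nonNegative q≥0}} p≥0)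

  quotient : ∀ {B ε} → 0ℚ < B → 0ℚ < ε → ∃[ δ ] (0ℚ < δ × δ * B ≡ ε)
  quotient {B} {ε} B>0 ε>0 = ε * 1/ B ,
    *>0 ε>0 (ℚ.positive⁻¹ (1/ B) {{ℚ.1/pos⇒pos B}}) ,
    trans (ℚ.*-assoc ε (1/ B) B) (trans (cong (ε *_) (ℚ.*-inverseˡ B)) (ℚ.*-identityʳ ε))
    where
    instance
      B⁺ : Positive B
      B⁺ = ℚ.positive B>0
      B≢0 : ℚ.NonZero B
      B≢0 = ℚ.pos⇒nonZero B

  p≤∣p∣ : ∀ p → p ≤ ∣ p ∣
  p≤∣p∣ p with ℚ.≤-total 0ℚ p
  ... | inj₁ 0≤p = ℚ.≤-reflexive (sym (ℚ.0≤p⇒∣p∣≡p 0≤p))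
  ... | inj₂ p≤0 = ℚ.≤-trans p≤0 (ℚ.0≤∣p∣ p)

  ∣p∣≤ : ∀ {p q} → p ≤ q → - p ≤ q → ∣ p ∣ ≤ q
  ∣p∣≤ {p} {q} p≤q -p≤q with ℚ.∣p∣≡p∨∣p∣≡-p p
  ... | inj₁ eq = subst (_≤ q) (sym eq) p≤q
  ... | inj₂ eq = subst (_≤ q) (sym eq) -p≤q

  shiftʳ : ∀ {p q r} → p ≤ q + r → p - q ≤ r
  shiftʳ {p} {q} {r} h = subst (p - q ≤_)
    (solve 2 (λ q r → (q :+ r) :- q := r) refl q r) (ℚ.+-monoˡ-≤ (- q) h)

  shiftˡ : ∀ {p q r} → p - q ≤ r → p ≤ q + r
  shiftˡ {p} {q} {r} h = subst₂ _≤_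
    (solve 2 (λ p q → (p :- q) :+ q := p) refl p q) (ℚ.+-comm r q) (ℚ.+-monoˡ-≤ q h)

  -- `x ≈ y` unfolds to `Null` of the difference, so the congruence laws become closure properties
  -- of null sequences.
  Null : (ℕ → ℚ) → Set
  Null s = ∀ ε → 0ℚ < ε → Eventually λ n → ∣ s n ∣ < ε

  Null-resp : ∀ {s t} → (∀ n → s n ≡ t n) → Null s → Null t
  Null-resp s≡t null ε ε>0 = Eventually-map (λ n → subst (λ r → ∣ r ∣ < ε) (s≡t n)) (null ε ε>0)

  Null-+ : ∀ {s t} → Null s → Null t → Null (λ n → s n + t n)
  Null-+ {s} {t} ns nt ε ε>0 = Eventually-map₂
    (λ n p q → ℚ.≤-<-trans (ℚ.∣p+q∣≤∣p∣+∣q∣ (s n) (t n)) (subst (∣ s n ∣ + ∣ t n ∣ <_) (½+½ ε) (ℚ.+-mono-< p q)))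
    (ns (½ * ε) (½>0 ε>0)) (nt (½ * ε) (½>0 ε>0))

  Null-neg : ∀ {s} → Null s → Null (λ n → - s n)
  Null-neg {s} ns ε ε>0 = Eventually-map (λ n → subst (_< ε) (sym (ℚ.∣-p∣≡∣p∣ (s n)))) (ns ε ε>0)

  Null-0 : ∀ {s} → (∀ n → s n ≡ 0ℚ) → Null s
  Null-0 s≡0 ε ε>0 = 0 , λ n _ → subst (λ r → ∣ r ∣ < ε) (sym (s≡0 n)) ε>0

  bounded : ∀ x → ∃[ B ] (0ℚ < B × Eventually λ n → ∣ seq x n ∣ ≤ B)
  bounded x with cauchy x 1ℚ (ℚ.positive⁻¹ 1ℚ)
  ... | N , h = ∣ s N ∣ + 1ℚ ,
    ℚ.+-mono-≤-< (ℚ.0≤∣p∣ (s N)) (ℚ.positive⁻¹ 1ℚ) ,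
    N , λ n N≤n → ℚ.≤-trans
      (ℚ.≤-reflexive (cong ∣_∣ (solve 2 (λ a b → b := a :+ (b :- a)) refl (s N) (s n))))
      (ℚ.≤-trans (ℚ.∣p+q∣≤∣p∣+∣q∣ (s N) (s n - s N))
        (ℚ.+-monoʳ-≤ ∣ s N ∣ (ℚ.<⇒≤ (h n N N≤n ℕ.≤-refl))))
    where s = seq x

  Null-* : ∀ {s} → Null s → ∀ x → Null (λ n → s n * seq x n)
  Null-* {s} ns x ε ε>0 =
    let B , B>0 , evB = bounded x
        δ , δ>0 , δB≡ε = quotient B>0 ε>0
    in Eventually-map₂ (λ n p q → subst₂ _<_ (sym (ℚ.∣p*q∣≡∣p∣*∣q∣ (s n) (seq x n))) δB≡ε
         (ℚ.≤-<-trans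
           (ℚ.*-monoˡ-≤-nonNeg ∣ s n ∣ {{ℚ.∣-∣-nonNeg (s n)}} q)
           (ℚ.*-monoˡ-<-pos B {{ℚ.positive B>0}} p)))
       (ns δ δ>0) evB

  pointwise : ∀ {x y} → (∀ n → seq x n ≡ seq y n) → x R.≈ y
  pointwise {x} {y} eq = Null-0 λ n → trans (cong (_- seq y n) (eq n)) (ℚ.+-inverseʳ (seq y n))

  ≈-sym : ∀ {x y} → x R.≈ y → y R.≈ x
  ≈-sym {x} {y} h = Null-resp (λ n → solve 2 (λ a b → :- (a :- b) := b :- a) refl (seq x n) (seq y n)) (Null-neg h)

  ≈-trans : ∀ {x y z} → x R.≈ y → y R.≈ z → x R.≈ z
  ≈-trans {x} {y} {z} h k = Null-resp
    (λ n → solve 3 (λ a b c → (a :- b) :+ (b :- c) := a :- c) refl (seq x n) (seq y n) (seq z n)) (Null-+ h k)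

  +-cong : ∀ {x y u v} → x R.≈ y → u R.≈ v → (x R.+ u) R.≈ (y R.+ v)
  +-cong {x} {y} {u} {v} h k = Null-resp
    (λ n → solve 4 (λ a b c d → (a :- b) :+ (c :- d) := (a :+ c) :- (b :+ d)) refl
      (seq x n) (seq y n) (seq u n) (seq v n)) (Null-+ h k)

  neg-cong : ∀ {x y} → x R.≈ y → (R.- x) R.≈ (R.- y)
  neg-cong {x} {y} h = Null-resp
    (λ n → solve 2 (λ a b → :- (a :- b) := :- a :- :- b) refl (seq x n) (seq y n)) (Null-neg h)

  *-cong : ∀ {x y u v} → x R.≈ y → u R.≈ v → (x R.* u) R.≈ (y R.* v)
  *-cong {x} {y} {u} {v} h k = Null-resp
    (λ n → solve 4 (λ a b c d → (a :- b) :* c :+ (c :- d) :* b := a :* c :- b :* d) refl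
      (seq x n) (seq y n) (seq u n) (seq v n)) (Null-+ (Null-* h u) (Null-* k y))

  ℝ-commutativeRing : CommutativeRing 0ℓ 0ℓ
  ℝ-commutativeRing = record
    { Carrier = ℝ ; _≈_ = R._≈_ ; _+_ = R._+_ ; _*_ = R._*_ ; -_ = R.-_ ; 0# = 0ℝ ; 1# = 1ℝ
    ; isCommutativeRing = record
      { isRing = record
        { +-isAbelianGroup = record
          { isGroup = record
            { isMonoid = record
              { isSemigroup = record
                { isMagma = record
                  { isEquivalence = record
                    { refl  = λ {x} → pointwise {x} {x} λ _ → refl
                    ; sym   = λ {x} {y} → ≈-sym {x} {y}
                    ; trans = λ {x} {y} {z} → ≈-trans {x} {y} {z} }
                  ; ∙-cong = λ {x} {y} {u} {v} → +-cong {x} {y} {u} {v} }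
                ; assoc = λ x y z → pointwise {(x R.+ y) R.+ z} {x R.+ (y R.+ z)} λ n → ℚ.+-assoc (seq x n) (seq y n) (seq z n) }
              ; identity = (λ x → pointwise {0ℝ R.+ x} {x} λ n → ℚ.+-identityˡ (seq x n))
                         , (λ x → pointwise {x R.+ 0ℝ} {x} λ n → ℚ.+-identityʳ (seq x n)) }
            ; inverse = (λ x → pointwise {(R.- x) R.+ x} {0ℝ} λ n → ℚ.+-inverseˡ (seq x n))
                      , (λ x → pointwise {x R.+ (R.- x)} {0ℝ} λ n → ℚ.+-inverseʳ (seq x n))
            ; ⁻¹-cong = λ {x} {y} → neg-cong {x} {y} }
          ; comm = λ x y → pointwise {x R.+ y} {y R.+ x} λ n → ℚ.+-comm (seq x n) (seq y n) }
        ; *-cong = λ {x} {y} {u} {v} → *-cong {x} {y} {u} {v}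
        ; *-assoc = λ x y z → pointwise {(x R.* y) R.* z} {x R.* (y R.* z)} λ n → ℚ.*-assoc (seq x n) (seq y n) (seq z n)
        ; *-identity = (λ x → pointwise {1ℝ R.* x} {x} λ n → ℚ.*-identityˡ (seq x n))
                     , (λ x → pointwise {x R.* 1ℝ} {x} λ n → ℚ.*-identityʳ (seq x n))
        ; distrib = (λ x y z → pointwise {x R.* (y R.+ z)} {x R.* y R.+ x R.* z} λ n → ℚ.*-distribˡ-+ (seq x n) (seq y n) (seq z n))
                  , (λ x y z → pointwise {(y R.+ z) R.* x} {y R.* x R.+ z R.* x} λ n → ℚ.*-distribʳ-+ (seq x n) (seq y n) (seq z n)) }
      ; *-comm = λ x y → pointwise {x R.* y} {y R.* x} λ n → ℚ.*-comm (seq x n) (seq y n) } }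

  ≤-reflexive : ∀ {x y} → x R.≈ y → x R.≤ y
  ≤-reflexive {x} {y} h ε ε>0 = Eventually-map
    (λ n p → shiftˡ (ℚ.≤-trans (p≤∣p∣ (seq x n - seq y n)) (ℚ.<⇒≤ p))) (h ε ε>0)

  ≤-trans : ∀ {x y z} → x R.≤ y → y R.≤ z → x R.≤ z
  ≤-trans {x} {y} {z} h k ε ε>0 = Eventually-map₂
    (λ n p q → ℚ.≤-trans p (ℚ.≤-trans (ℚ.+-monoˡ-≤ (½ * ε) q)
      (ℚ.≤-reflexive (trans (ℚ.+-assoc (seq z n) _ _) (cong (λ r → seq z n + r) (½+½ ε))))))
    (h (½ * ε) (½>0 ε>0)) (k (½ * ε) (½>0 ε>0))

  ≤-antisym : ∀ {x y} → x R.≤ y → y R.≤ x → x R.≈ y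
  ≤-antisym {x} {y} h k ε ε>0 = Eventually-map₂
    (λ n p q → ℚ.≤-<-trans (∣p∣≤ (shiftʳ {q = seq y n} p)
        (subst (_≤ ½ * ε) (solve 2 (λ a b → b :- a := :- (a :- b)) refl (seq x n) (seq y n)) (shiftʳ {q = seq x n} q)))
      (½<1 ε>0))
    (h (½ * ε) (½>0 ε>0)) (k (½ * ε) (½>0 ε>0))

  +-mono-≤ : ∀ {x y u v} → x R.≤ y → u R.≤ v → (x R.+ u) R.≤ (y R.+ v)
  +-mono-≤ {x} {y} {u} {v} h k ε ε>0 = Eventually-map₂
    (λ n p q → ℚ.≤-trans (ℚ.+-mono-≤ p q) (ℚ.≤-reflexive (trans
      (solve 3 (λ a b e → (a :+ e) :+ (b :+ e) := (a :+ b) :+ (e :+ e)) refl (seq y n) (seq v n) (½ * ε))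
      (cong (λ r → seq y n + seq v n + r) (½+½ ε)))))
    (h (½ * ε) (½>0 ε>0)) (k (½ * ε) (½>0 ε>0))

  -- The terms are only known to be at least - η, so (x + η) * (y + η) ≥ 0 is used: it gives x * y ≥
  -- - η * (x + y + η). The last factor is at most C as η ≤ ε, and η * C ≤ ε as η ≤ δ.
  *-nonneg : ∀ {x y} → 0ℝ R.≤ x → 0ℝ R.≤ y → 0ℝ R.≤ (x R.* y)
  *-nonneg {x} {y} h k ε ε>0 =
    let A , A>0 , evA = bounded x
        B , B>0 , evB = bounded y
        C = A + B + ε
        C>0 = ℚ.+-mono-< (ℚ.+-mono-< A>0 B>0) ε>0
        δ , δ>0 , δC≡ε = quotient {C} {ε} (subst (_< C) refl C>0) ε>0
        η = δ ℚ.⊓ ε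
        η>0 = ⊓>0 δ>0 ε>0
    in Eventually-map₂
         (λ n → λ { (p , a) (q , b) →
           ℚ.≤-trans (*≥0 p q) (ℚ.≤-trans
             (ℚ.≤-reflexive (solve 3 (λ x y e → (x :+ e) :* (y :+ e) := x :* y :+ e :* (x :+ y :+ e)) refl (seq x n) (seq y n) η))
             (ℚ.+-monoʳ-≤ (seq x n * seq y n) (ℚ.≤-trans
               (ℚ.*-monoˡ-≤-nonNeg η {{ℚ.nonNegative (ℚ.<⇒≤ η>0)}}
                 (ℚ.+-mono-≤ (ℚ.+-mono-≤ (ℚ.≤-trans (p≤∣p∣ (seq x n)) a) (ℚ.≤-trans (p≤∣p∣ (seq y n)) b))
                             (ℚ.p⊓q≤q δ ε)))
               (ℚ.≤-trans (ℚ.*-monoʳ-≤-nonNeg C {{ℚ.nonNegative (ℚ.<⇒≤ C>0)}} (ℚ.p⊓q≤p δ ε))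
                          (ℚ.≤-reflexive δC≡ε))))) })
         (Eventually-map₂ (λ n p a → p , a) (h η η>0) evA)
         (Eventually-map₂ (λ n p a → p , a) (k η η>0) evB)
    where
    ⊓>0 : ∀ {p q} → 0ℚ < p → 0ℚ < q → 0ℚ < p ℚ.⊓ q
    ⊓>0 {p} {q} p>0 q>0 with ℚ.≤-total p q
    ... | inj₁ p≤q = subst (0ℚ <_) (sym (ℚ.p≤q⇒p⊓q≡p p≤q)) p>0
    ... | inj₂ q≤p = subst (0ℚ <_) (sym (ℚ.p≥q⇒p⊓q≡q q≤p)) q>0

  EventuallyPos : ℝ → Set
  EventuallyPos x = ∃[ δ ] (0ℚ < δ × Eventually λ n → δ ≤ seq x n)

  -- One term, accurate to ε / 4, is compared with ε / 2. The two answers overlap, so this can be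
  -- decided although the sign of `x` cannot.
  small-or-positive : ∀ x {ε} → 0ℚ < ε → Eventually (λ n → seq x n ≤ ε) ⊎ EventuallyPos x
  small-or-positive x {ε} ε>0 with cauchy x (½ * (½ * ε)) (½>0 (½>0 ε>0))
  ... | N , h with ℚ.≤-total (seq x N) (½ * ε)
  ...   | inj₁ small = inj₁ (N , λ n N≤n → ℚ.≤-trans
            (shiftˡ {q = seq x N} (ℚ.≤-trans (p≤∣p∣ (seq x n - seq x N)) (ℚ.<⇒≤ (h n N N≤n ℕ.≤-refl))))
            (ℚ.≤-trans (ℚ.+-mono-≤ small (ℚ.<⇒≤ (½<1 (½>0 ε>0)))) (ℚ.≤-reflexive (½+½ ε))))
  ...   | inj₂ large = inj₂ (½ * (½ * ε) , ½>0 (½>0 ε>0) , N , λ n N≤n →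
            subst₂ _≤_
              (trans (cong (_- ½ * (½ * ε)) (sym (½+½ (½ * ε))))
                     (solve 1 (λ e → (e :+ e) :- e := e) refl (½ * (½ * ε))))
              (solve 2 (λ a b → a :- (a :- b) := b) refl (seq x N) (seq x n))
              (ℚ.+-mono-≤ large (ℚ.neg-antimono-≤
                (ℚ.≤-trans (p≤∣p∣ (seq x N - seq x n)) (ℚ.<⇒≤ (h N n ℕ.≤-refl N≤n))))))

  pos≰0 : ∀ x → EventuallyPos x → ¬ (x R.≤ 0ℝ)
  pos≰0 x (δ , δ>0 , ev) x≤0 with Eventually-witness (Eventually-map₂ {S = λ n → δ ≤ ½ * δ}
    (λ n p q → ℚ.≤-trans p (subst (seq x n ≤_) (ℚ.+-identityˡ (½ * δ)) q)) ev (x≤0 (½ * δ) (½>0 δ>0)))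
  ... | _ , δ≤½δ = ℚ.<-irrefl refl (ℚ.<-≤-trans (½<1 δ>0) δ≤½δ)

  ≤-from-¬pos : ∀ {x y} → ¬ EventuallyPos (x R.- y) → x R.≤ y
  ≤-from-¬pos {x} {y} ¬pos ε ε>0 with small-or-positive (x R.- y) ε>0
  ... | inj₁ small = Eventually-map (λ n → shiftˡ {q = seq y n}) small
  ... | inj₂ pos   = ⊥-elim (¬pos pos)

  pos⇒≰ : ∀ {x y} → EventuallyPos (x R.- y) → ¬ (x R.≤ y)
  pos⇒≰ {x} {y} pos x≤y = pos≰0 (x R.- y) pos λ ε ε>0 → Eventually-map
    (λ n p → subst (seq x n - seq y n ≤_) (sym (ℚ.+-identityˡ ε)) (shiftʳ {q = seq y n} p)) (x≤y ε ε>0)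

  -- By `pos⇒≰` and `≤-from-¬pos`, x ≤ y is equivalent to a negation, and negations are stable.
  ≤-stable : ∀ {x y} → ¬ ¬ (x R.≤ y) → x R.≤ y
  ≤-stable {x} {y} ¬¬x≤y = ≤-from-¬pos {x} {y} λ pos → ¬¬x≤y (pos⇒≰ {x} {y} pos)

  pos⇒≥ : ∀ {x y} → EventuallyPos (x R.- y) → y R.≤ x
  pos⇒≥ {x} {y} (δ , δ>0 , ev) ε ε>0 = Eventually-map
    (λ n p → ℚ.≤-trans (subst₂ _≤_ (ℚ.+-identityʳ (seq y n))
        (solve 2 (λ a b → b :+ (a :- b) := a) refl (seq x n) (seq y n))
        (ℚ.+-monoʳ-≤ (seq y n) (ℚ.≤-trans (ℚ.<⇒≤ δ>0) p)))
      (subst (_≤ seq x n + ε) (ℚ.+-identityʳ (seq x n)) (ℚ.+-monoʳ-≤ (seq x n) (ℚ.<⇒≤ ε>0)))) ev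

  ≤-total : ∀ x y → ¬ ¬ (x R.≤ y ⊎ y R.≤ x)
  ≤-total x y ¬either = ¬either (inj₁ (≤-from-¬pos {x} {y} λ pos → ¬either (inj₂ (pos⇒≥ {x} {y} pos))))

  -- Clamping the sequence at δ makes all of its terms invertible.
  module Reciprocal (x : ℝ) {δ} (δ>0 : 0ℚ < δ) (ev : Eventually λ n → δ ≤ seq x n) where

    x′ : ℕ → ℚ
    x′ n = seq x n ⊔ δ

    x′>0 : ∀ n → 0ℚ < x′ n
    x′>0 n = ℚ.<-≤-trans δ>0 (ℚ.p≤q⊔p (seq x n) δ)

    x′≡x : ∀ {n} → δ ≤ seq x n → x′ n ≡ seq x n
    x′≡x = ℚ.p≥q⇒p⊔q≡p

    x′⁺ : ∀ n → Positive (x′ n)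
    x′⁺ n = ℚ.positive (x′>0 n)

    x′≢0 : ∀ n → ℚ.NonZero (x′ n)
    x′≢0 n = ℚ.pos⇒nonZero (x′ n) {{x′⁺ n}}

    y : ℕ → ℚ
    y n = (1/ x′ n) {{x′≢0 n}}

    y>0 : ∀ n → 0ℚ < y n
    y>0 n = ℚ.positive⁻¹ (y n) {{ℚ.1/pos⇒pos (x′ n) {{x′⁺ n}}}}

    x′y≡1 : ∀ n → x′ n * y n ≡ 1ℚ
    x′y≡1 n = ℚ.*-inverseʳ (x′ n) {{x′≢0 n}}

    K : ℚ
    K = (1/ δ) {{ℚ.pos⇒nonZero δ {{ℚ.positive δ>0}}}}

    δK≡1 : δ * K ≡ 1ℚ
    δK≡1 = ℚ.*-inverseʳ δ {{ℚ.pos⇒nonZero δ {{ℚ.positive δ>0}}}}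

    K>0 : 0ℚ < K
    K>0 = ℚ.positive⁻¹ K {{ℚ.1/pos⇒pos δ {{ℚ.positive δ>0}}}}

    y≤K : ∀ n → y n ≤ K
    y≤K n = subst₂ _≤_
      (trans (solve 3 (λ d y k → (d :* y) :* k := (d :* k) :* y) refl δ (y n) K)
             (trans (cong (_* y n) δK≡1) (ℚ.*-identityˡ (y n))))
      (trans (cong (_* K) (x′y≡1 n)) (ℚ.*-identityˡ K))
      (ℚ.*-monoʳ-≤-nonNeg K {{ℚ.nonNegative (ℚ.<⇒≤ K>0)}}
        (ℚ.*-monoʳ-≤-nonNeg (y n) {{ℚ.nonNegative (ℚ.<⇒≤ (y>0 n))}} (ℚ.p≤q⊔p (seq x n) δ)))

    difference : ∀ m n → y m - y n ≡ (x′ n - x′ m) * (y m * y n)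
    difference m n = trans
      (cong₂ _-_ (sym (trans (cong (_* y m) (x′y≡1 n)) (ℚ.*-identityˡ (y m))))
                 (sym (trans (cong (_* y n) (x′y≡1 m)) (ℚ.*-identityˡ (y n)))))
      (solve 4 (λ a b c d → (b :* d) :* c :- (a :* c) :* d := (b :- a) :* (c :* d)) refl (x′ m) (x′ n) (y m) (y n))

    -- The difference of two reciprocals is the difference of the terms times y m * y n, which is at
    -- most K².
    y-cauchy : IsCauchy y
    y-cauchy ε ε>0 =
      let η , η>0 , ηKK≡ε = quotient (*>0 K>0 K>0) ε>0
          N , h = cauchy x η η>0
          M , k = ev
      in N ℕ.⊔ M , λ m n ≤m ≤n → subst₂ _<_
        (sym (trans (cong ∣_∣ (difference m n)) (trans (ℚ.∣p*q∣≡∣p∣*∣q∣ (x′ n - x′ m) (y m * y n))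
          (cong₂ _*_ (cong ∣_∣ (cong₂ _-_ (x′≡x (k n (ℕ.m⊔n≤o⇒n≤o N M ≤n))) (x′≡x (k m (ℕ.m⊔n≤o⇒n≤o N M ≤m)))))
                     (ℚ.0≤p⇒∣p∣≡p (ℚ.<⇒≤ (*>0 (y>0 m) (y>0 n))))))))
        ηKK≡ε
        (ℚ.<-≤-trans
          (ℚ.*-monoˡ-<-pos (y m * y n) {{ℚ.positive (*>0 (y>0 m) (y>0 n))}}
            (h n m (ℕ.m⊔n≤o⇒m≤o N M ≤n) (ℕ.m⊔n≤o⇒m≤o N M ≤m)))
          (ℚ.*-monoˡ-≤-nonNeg η {{ℚ.nonNegative (ℚ.<⇒≤ η>0)}}
            (ℚ.≤-trans (ℚ.*-monoʳ-≤-nonNeg (y n) {{ℚ.nonNegative (ℚ.<⇒≤ (y>0 n))}} (y≤K m))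
                       (ℚ.*-monoˡ-≤-nonNeg K {{ℚ.nonNegative (ℚ.<⇒≤ K>0)}} (y≤K n)))))

    reciprocal : ∃[ z ] (x R.* z) R.≈ 1ℝ
    reciprocal = mkℝ y y-cauchy , λ ε ε>0 → Eventually-map
      (λ n δ≤x → subst (λ r → ∣ r ∣ < ε)
        (sym (trans (cong (_- 1ℚ) (trans (cong (_* y n) (sym (x′≡x δ≤x))) (x′y≡1 n))) (ℚ.+-inverseʳ 1ℚ)))
        ε>0) ev

  ≈0-from-¬pos : ∀ {x} → ¬ EventuallyPos (x R.- 0ℝ) → ¬ EventuallyPos (0ℝ R.- x) → x R.≈ 0ℝ
  ≈0-from-¬pos {x} ¬p ¬n = ≤-antisym {x} {0ℝ} (≤-from-¬pos {x} {0ℝ} ¬p) (≤-from-¬pos {0ℝ} {x} ¬n)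

  zero-or-invertible : ∀ x → ¬ ¬ (x R.≈ 0ℝ ⊎ ∃[ y ] (x R.* y) R.≈ 1ℝ)
  zero-or-invertible x ¬either = ¬either (inj₁ (≈0-from-¬pos {x}
    (λ { (δ , δ>0 , ev) → let z , eq = Reciprocal.reciprocal (x R.- 0ℝ) δ>0 ev in
         ¬either (inj₂ (z , ≈-trans {x R.* z} {(x R.- 0ℝ) R.* z} {1ℝ}
           (pointwise {x R.* z} {(x R.- 0ℝ) R.* z} λ n →
             solve 2 (λ x z → x :* z := (x :- con 0ℚ) :* z) refl (seq x n) (seq z n)) eq)) })
    (λ { (δ , δ>0 , ev) → let z , eq = Reciprocal.reciprocal (0ℝ R.- x) δ>0 ev in
         ¬either (inj₂ (R.- z , ≈-trans {x R.* (R.- z)} {(0ℝ R.- x) R.* z} {1ℝ}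
           (pointwise {x R.* (R.- z)} {(0ℝ R.- x) R.* z} λ n →
             solve 2 (λ x z → x :* (:- z) := (con 0ℚ :- x) :* z) refl (seq x n) (seq z n)) eq)) })))

-- The real numbers as an ordered field, and the theorem

open import Defs
open import Data.Rational.Base as ℚ using (ℚ; 1ℚ; ½; mkℚ)
import Data.Rational.Properties as ℚ
open Reals

module ℝ-Ring = CommutativeRing ℝ-commutativeRing
open IntegerCoefficients ℝ-commutativeRing using (ι; 1+×)

-- The fraction is normalised by a gcd, which does not reduce for a variable `n`; this exposes its
-- numerator and denominator.
integer : ∀ n → + n ℚ./ 1 ≡ mkℚ (+ n) 0 (Coprime.sym (Coprime.1-coprimeTo n))
integer n = ℚ.normalize-coprime (Coprime.sym (Coprime.1-coprimeTo n))

integer-suc : ∀ n → + suc n ℚ./ 1 ≡ 1ℚ ℚ.+ (+ n ℚ./ 1)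
integer-suc n = ≡.sym (≡.trans (≡.cong (1ℚ ℚ.+_) (integer n))
  (≡.cong (λ i → i ℚ./ 1) (≡.cong (λ i → ℤ.1ℤ ℤ.+ i) (ℤ.*-identityʳ (+ n)))))

ι≈fromℕ : ∀ n → ι n ≈ fromℕ n
ι≈fromℕ zero    = ℝ-Ring.refl {0ℝ}
ι≈fromℕ (suc n) = ≈-trans {ι (suc n)} {1ℝ + ι n} {fromℕ (suc n)} (1+× n 1ℝ)
  (≈-trans {1ℝ + ι n} {1ℝ + fromℕ n} {fromℕ (suc n)}
    (+-cong {1ℝ} {1ℝ} {ι n} {fromℕ n} (ℝ-Ring.refl {1ℝ}) (ι≈fromℕ n))
    (pointwise {1ℝ + fromℕ n} {fromℕ (suc n)} λ _ → ≡.sym (integer-suc n)))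

ι-invertible : ∀ n → ∃[ y ] ι (suc n) * y ≈ 1ℝ
ι-invertible n = y , ≈-trans {ι (suc n) * y} {fromℕ (suc n) * y} {1ℝ}
  (*-cong {ι (suc n)} {fromℕ (suc n)} {y} {y} (ι≈fromℕ (suc n)) (ℝ-Ring.refl {y}))
  (pointwise {fromℕ (suc n) * y} {1ℝ} λ _ → ℚ.*-inverseʳ q)
  where
  q : ℚ
  q = + suc n ℚ./ 1
  instance
    q≢0 : ℚ.NonZero q
    q≢0 = ≡.subst ℚ.NonZero (≡.sym (integer (suc n))) _
  y : ℝ
  y = fromℚ (ℚ.1/ q)

-- A nonnegative fraction is at most its numerator, a negative one at most 0.
≤-natural : ∀ q → ∃[ n ] q ℚ.≤ (+ n ℚ./ 1)
≤-natural (mkℚ (+ n) d c) = n , ≡.subst (mkℚ (+ n) d c ℚ.≤_) (≡.sym (integer n))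
  (ℚ.*≤* (ℤ.*-monoˡ-≤-nonNeg (+ n) (ℤ.+≤+ (ℕ.s≤s ℕ.z≤n))))
≤-natural (mkℚ -[1+ n ] d c) = 0 , ℚ.*≤* ℤ.-≤+

-- If x were eventually at least δ > 0, some N ≥ (B + 1) / δ would give B + 1 ≤ N * x ≤ B + ½ at a
-- late term, where B bounds the terms of y.
archimedean : ∀ x y → (∀ n → (ι n * x) ≤ y) → x ≤ 0ℝ
archimedean x y h = ≤-from-¬pos {x} {0ℝ} λ { (δ , δ>0 , ev) →
  let B , B>0 , evB = bounded y
      η , η>0 , ηδ≡ = quotient δ>0 (ℚ.+-mono-< B>0 (ℚ.positive⁻¹ 1ℚ))
      N , η≤N = ≤-natural η
      Nx≤y : (fromℕ N * x) ≤ y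
      Nx≤y = ≤-trans {fromℕ N * x} {ι N * x} {y}
        (≤-reflexive {fromℕ N * x} {ι N * x}
          (*-cong {fromℕ N} {ι N} {x} {x} (≈-sym {ι N} {fromℕ N} (ι≈fromℕ N)) (ℝ-Ring.refl {x})))
        (h N)
      0≤N = ℚ.≤-trans (ℚ.<⇒≤ η>0) η≤N
      _ , B+1≤B+½ = Eventually-witness (Eventually-map₂ {S = λ _ → B ℚ.+ 1ℚ ℚ.≤ B ℚ.+ ½}
        (λ n p q → ℚ.≤-trans (ℚ.≤-reflexive (≡.sym ηδ≡)) (ℚ.≤-trans
          (ℚ.*-monoʳ-≤-nonNeg δ {{ℚ.nonNegative (ℚ.<⇒≤ δ>0)}} η≤N) (ℚ.≤-trans
          (ℚ.*-monoˡ-≤-nonNeg (+ N ℚ./ 1) {{ℚ.nonNegative 0≤N}} (≡.subst (δ ℚ.≤_) (ℚ.+-identityʳ (seq x n)) p)) q)))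
        ev (Eventually-map₂ {S = λ n → (+ N ℚ./ 1) ℚ.* seq x n ℚ.≤ B ℚ.+ ½}
          (λ n p q → ℚ.≤-trans p (ℚ.+-monoˡ-≤ ½ (ℚ.≤-trans (p≤∣p∣ (seq y n)) q)))
          (Nx≤y ½ (ℚ.positive⁻¹ ½)) evB))
  in ℚ.<-irrefl ≡.refl (ℚ.<-≤-trans (ℚ.+-monoʳ-< B (ℚ.*<* (ℤ.+<+ (ℕ.s≤s (ℕ.s≤s ℕ.z≤n))))) B+1≤B+½) }

ℝ-orderedField : OrderedField
ℝ-orderedField = record
  { commutativeRing = ℝ-commutativeRing
  ; _≤_ = _≤_
  ; ≤-reflexive = λ {x} {y} → ≤-reflexive {x} {y}
  ; ≤-trans = λ {x} {y} {z} → ≤-trans {x} {y} {z}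
  ; ≤-antisym = λ {x} {y} → ≤-antisym {x} {y}
  ; +-mono-≤ = λ {x} {y} {u} {v} → +-mono-≤ {x} {y} {u} {v}
  ; *-nonneg = λ {x} {y} → *-nonneg {x} {y}
  ; ≤-stable = λ {x} {y} → ≤-stable {x} {y}
  ; ≤-total = ≤-total
  ; zero-or-invertible = zero-or-invertible
  ; ι-invertible = ι-invertible
  ; archimedean = archimedean
  }

open LaplacianSpectrum ℝ-orderedField

theorem1p8 : ∀ (n k : ℕ) → 1 ℕ.≤ k → (k≤n : k ℕ.≤ n) →
    (G : SimpleGraph n) (μ : Vector ℝ n) → IsOrderedSpectrum (laplacian G) μ →
    sumFirst k k≤n μ ≤ fromℕ (edgeCount G ℕ.+ k ℕ.^ 2)
theorem1p8 n k 1≤k k≤n G μ spectrum = ≤-trans {sumFirst k k≤n μ} {ι m} {fromℕ m}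
  (partial-sum-bound k k≤n 1≤k G μ splits (IsOrderedSpectrum.decreasing spectrum))
  (≤-reflexive {ι m} {fromℕ m} (ι≈fromℕ m))
  where
  m = edgeCount G ℕ.+ k ℕ.^ 2
  module Δ = DetTheory ℝ-commutativeRing
  module Γ = GraphBound ℝ-orderedField G
  module F = OrderedFieldProperties ℝ-orderedField

  scalar-entry : ∀ x i j → (x * F.δ i j) ≈ scalar x i j
  scalar-entry x i j with does (i Fin.≟ j)
  ... | true  = ℝ-Ring.*-identityʳ x
  ... | false = ℝ-Ring.zeroʳ x

  entry : ∀ x i j → (x * F.δ i j - Γ.L i j) ≈ (scalar x i j - laplacian G i j)
  entry x i j = +-cong {x * F.δ i j} {scalar x i j} { - Γ.L i j} { - laplacian G i j} (scalar-entry x i j)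
    (neg-cong {Γ.L i j} {laplacian G i j} (≈-sym {laplacian G i j} {Γ.L i j}
      (Γ.laplacian-entry {fromℕ (degree G i)} i j (≈-sym {ι (degree G i)} {fromℕ (degree G i)} (ι≈fromℕ (degree G i))))))

  splits : ∀ x → Δ.det (λ i j → x * F.δ i j - Γ.L i j) ≈ product (λ i → x - μ i)
  splits x = ≈-trans {Δ.det (λ i j → x * F.δ i j - Γ.L i j)} {charpoly (laplacian G) x} {product (λ i → x - μ i)}
    (≡.subst (Δ.det (λ i j → x * F.δ i j - Γ.L i j) ≈_) (Δ.det≡det (λ i j → scalar x i j - laplacian G i j))
      (Δ.det-cong (entry x)))
    (IsOrderedSpectrum.charpoly-splits spectrum x)
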